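{- Suppose that for every even positive integer $N$, every positive integer $k$ and every $(k,N)$-necklace $X$ one has $T^{N-3k}X=X$ (equivalently, the length of every cycle in the directed graph $\mathrm{Neck}(k,N)$ divides $N-3k$). Then for every integer $n\ge 0$ there are polynomials $h_{4n+2}(t)$ and $h_{4n}(t)$ such that $$f_{4n+2}(t)=\frac{h_{4n+2}(t)}{(1+t^2)\cdot\big[(1-t^{8n-2})(1-t^{8n-8})(1-t^{8n-14})\cdots(1-t^{2n+4})\big]},$$ $$f_{4n}(t)=\frac{h_{4n}(t)}{(1-t^2)\cdot\big[(1-t^{8n-6})(1-t^{8n-12})(1-t^{8n-18})\cdots(1-t^{2n})\big]},$$ where in each bracket the exponents decrease by $6$ (so each bracket has exactly $n$ factors, and is $1$ for $n=0$).
   Context: $P_m$ is the path with $m$ vertices ($P_0$ empty); $C_n$ is the cycle with $n$ vertices, with $C_2=P_2$ and $C_0$ the empty graph. $P_m\times C_n$ is the Cartesian (grid) product. For a finite graph $G$, $Z(G)=1-\chi(\mathrm{Ind}(G))$, where $\mathrm{Ind}(G)$ is the complex of independent sets and $\chi$ the unreduced Euler characteristic; equivalently $Z(G)=\sum_\sigma(-1)^{|\sigma|}$ over all independent sets $\sigma$ including $\emptyset$. Define $f_n(t)=\sum_{m=0}^\infty Z(P_m\times C_n)t^m$. **Necklaces.** Let $n$ be an even positive integer and $k$ a positive integer. A $(k,n)$-necklace is a collection of $2k$ points (stones) on a circle of length $n$ with a stone vector from $\{ -2,-1,1,2\}$ assigned to each stone. A positive (negative) vector points that many units clockwise (anti-clockwise)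 and the stone faces in that direction; its length is the absolute value. Conditions: consecutive stones face in opposite directions; if two consecutive stones face away from each other, their distance (along the arc between them) is an odd integer; if two consecutive stones face towards each other, their distance plus the lengths of their vectors is an odd integer, their distance is at least $3$, and if it is exactly $3$ then both vectors have length $1$. Necklaces differing by an isometry of the circle are identified. The transformation $T$ on $(k,n)$-necklaces: (JUMP) every stone moves along the circle by its vector; (TURN) vectors change by $-2\to1,\ -1\to2,\ 1\to-2,\ 2\to-1$; (FIX) if two stones are then at distance $3$ facing each other, any of their vectors of length $2$ is reduced to length $1$ (same direction). $\mathrm{Neck}(k,n)$ is the directed graph whose vertices are the isomorphism classes of $(k,n)$-necklaces, with an edge $N\to TN$ for each $N$; it is a disjoint union of directed cycles. $(k,n)$-necklaces exist only if $k\le n/4$. -}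

module Defs where

open import Algebra.Properties.CommutativeMonoid.Sum using (sum)
open import Data.Bool.Base using (true; false; _∨_; if_then_else_)
open import Data.Empty using (⊥-elim)
open import Data.Fin.Base using (Fin; toℕ; remQuot)
import Data.Fin.Properties as Fin
open import Data.Fin.Subset using (Subset; inside; outside; _∈_; _⊆_; ∣_∣; Nonempty)
open import Data.Fin.Subset.Properties using (_∈?_; nonempty?)
open import Data.Integer.Base as ℤ
  using (ℤ; +_; -[1+_]; 0ℤ; 1ℤ; -1ℤ; _+_; _-_; _*_; -_; _^_; _≤_; _<_; +≤+)
import Data.Integer.Properties as ℤ
open import Data.Integer.Tactic.RingSolver using (solve-∀)
open import Data.List.Base using (List; []; _∷_; foldr; applyUpTo)
open import Data.Nat.Base as ℕ using (ℕ; zero; suc; _∸_; z≤n; s≤s)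
import Data.Nat.Properties as ℕ
open import Data.Product.Base using (∃; ∃₂; _×_; _,_; proj₁; proj₂)
open import Data.Sum.Base using (_⊎_; inj₁; inj₂; swap)
open import Data.Vec.Base using ([]; _∷_)
open import Function.Base using (_∘_)
open import Function.Bundles using (_⇔_; mk⇔)
open import Relation.Binary.Definitions using (Decidable; Symmetric; Irreflexive)
open import Relation.Binary.PropositionalEquality
  using (_≡_; _≢_; _≗_; refl; sym; trans; cong; cong₂; subst; subst₂)
open import Relation.Nullary using (¬_; Dec; yes; no; does)
open import Relation.Nullary.Decidable using (_×-dec_; _⊎-dec_; _→-dec_; ¬?; dec-true; dec-false; does-⇔)

sumOverSubsets : ∀ {n} → (Subset n → ℤ) → ℤ
sumOverSubsets {zero}  g = g []
sumOverSubsets {suc n} g =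
  sumOverSubsets (g ∘ (inside ∷_)) + sumOverSubsets (g ∘ (outside ∷_))

record SimplicialComplex (n : ℕ) : Set₁ where
  field
    Face       : Subset n → Set
    face?      : ∀ σ → Dec (Face σ)
    downClosed : ∀ {σ τ} → σ ⊆ τ → Face τ → Face σ

-- A nonempty face σ has dimension ∣ σ ∣ ∸ 1; the empty face does not count.
χ : ∀ {n} → SimplicialComplex n → ℤ
χ K = sumOverSubsets λ σ →
  if does (nonempty? σ ×-dec face? σ) then -1ℤ ^ (∣ σ ∣ ∸ 1) else 0ℤ
  where open SimplicialComplex K

record Graph : Set₁ where
  field
    order  : ℕ
    _∼_    : Fin order → Fin order → Set
    _∼?_   : Decidable _∼_
    sym-∼  : Symmetric _∼_
    irrefl : Irreflexive _≡_ _∼_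

Ind : (G : Graph) → SimplicialComplex (Graph.order G)
Ind G = record
  { Face       = λ σ → ∀ x y → x ∈ σ → y ∈ σ → ¬ (x ∼ y)
  ; face?      = λ σ → Fin.all? λ x → Fin.all? λ y →
                   (x ∈? σ) →-dec ((y ∈? σ) →-dec ¬? (x ∼? y))
  ; downClosed = λ σ⊆τ indep x y x∈σ y∈σ → indep x y (σ⊆τ x∈σ) (σ⊆τ y∈σ)
  }
  where open Graph G

Z : Graph → ℤ
Z G = 1ℤ - χ (Ind G)

path : ℕ → Graph
path m = record
  { order  = m
  ; _∼_    = λ x y → suc (toℕ x) ≡ toℕ y ⊎ suc (toℕ y) ≡ toℕ x
  ; _∼?_   = λ x y → (suc (toℕ x) ℕ.≟ toℕ y) ⊎-dec (suc (toℕ y) ℕ.≟ toℕ x)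
  ; sym-∼  = swap
  ; irrefl = λ { refl (inj₁ p) → ℕ.1+n≢n p ; refl (inj₂ p) → ℕ.1+n≢n p }
  }

-- `cycle 0` is empty, `cycle 1` is an isolated vertex and `cycle 2` is `path 2`.
cycle : ℕ → Graph
cycle n = record
  { order  = n
  ; _∼_    = λ x y → x ≢ y × (Next x y ⊎ Next y x)
  ; _∼?_   = λ x y → ¬? (x Fin.≟ y) ×-dec (next? x y ⊎-dec next? y x)
  ; sym-∼  = λ (x≢y , p) → (λ y≡x → x≢y (sym y≡x)) , swap p
  ; irrefl = λ x≡y (x≢y , _) → x≢y x≡y
  }
  where
  Next : Fin n → Fin n → Set
  Next x y = suc (toℕ x) ≡ toℕ y ⊎ (suc (toℕ x) ≡ n × toℕ y ≡ 0)

  next? : Decidable Next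
  next? x y = (suc (toℕ x) ℕ.≟ toℕ y)
         ⊎-dec ((suc (toℕ x) ℕ.≟ n) ×-dec (toℕ y ℕ.≟ 0))

-- Cartesian product; `remQuot` identifies Fin (m * n) with Fin m × Fin n.
infixl 7 _□_
_□_ : Graph → Graph → Graph
G □ H = record
  { order  = G.order ℕ.* H.order
  ; _∼_    = λ x y → Adj (split x) (split y)
  ; _∼?_   = λ x y → adj? (split x) (split y)
  ; sym-∼  = λ { (inj₁ (p , q)) → inj₁ (sym p , H.sym-∼ q)
               ; (inj₂ (p , q)) → inj₂ (G.sym-∼ p , sym q) }
  ; irrefl = λ { refl (inj₁ (_ , q)) → H.irrefl refl q
               ; refl (inj₂ (p , _)) → G.irrefl refl p }
  }
  where
  module G = Graph G
  module H = Graph H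
  Pair : Set
  Pair = Fin G.order × Fin H.order

  split : Fin (G.order ℕ.* H.order) → Pair
  split = remQuot H.order

  Adj : Pair → Pair → Set
  Adj (a , b) (c , d) = (a ≡ c × b H.∼ d) ⊎ (a G.∼ c × b ≡ d)

  adj? : Decidable Adj
  adj? (a , b) (c , d) =
    ((a Fin.≟ c) ×-dec (b H.∼? d)) ⊎-dec ((a G.∼? c) ×-dec (b Fin.≟ d))

PowerSeries : Set
PowerSeries = ℕ → ℤ

infixl 6 _⊕_ _⊖_
infixl 7 _⊛_

_⊕_ _⊖_ _⊛_ : PowerSeries → PowerSeries → PowerSeries
(a ⊕ b) m = a m + b m
(a ⊖ b) m = a m - b m
(a ⊛ b) m = sum ℤ.+-0-commutativeMonoid {suc m} λ i → a (toℕ i) * b (m ∸ toℕ i)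

infix 8 t^_
t^_ : ℕ → PowerSeries
(t^ e) m = if does (m ℕ.≟ e) then 1ℤ else 0ℤ

∏ : ℕ → (ℕ → PowerSeries) → PowerSeries
∏ n a = foldr _⊛_ (t^ 0) (applyUpTo a n)

-- Coefficients are listed in increasing degree.
Polynomial : Set
Polynomial = List ℤ

⟦_⟧ : Polynomial → PowerSeries
⟦ [] ⟧    _       = 0ℤ
⟦ c ∷ h ⟧ zero    = c
⟦ c ∷ h ⟧ (suc m) = ⟦ h ⟧ m

-- The identity a = h / d, for d with constant term 1 (hence a unit in ℤ[[t]]).
infix 4 _≐_/_
_≐_/_ : PowerSeries → Polynomial → PowerSeries → Set
a ≐ h / d = a ⊛ d ≗ ⟦ h ⟧

f : ℕ → PowerSeries
f n m = Z (path m □ cycle n)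

-- The factor with index i runs over i = 0 , … , n ∸ 1, so that the truncated
-- subtractions below are exact.
denominator₄ₙ₊₂ denominator₄ₙ : ℕ → PowerSeries
denominator₄ₙ₊₂ n =
  (t^ 0 ⊕ t^ 2) ⊛ ∏ n (λ i → t^ 0 ⊖ t^ (8 ℕ.* n ∸ 2 ∸ 6 ℕ.* i))
denominator₄ₙ n =
  (t^ 0 ⊖ t^ 2) ⊛ ∏ n (λ i → t^ 0 ⊖ t^ (8 ℕ.* n ∸ 6 ∸ 6 ℕ.* i))

data Direction : Set where
  ↻ ↺ : Direction

data StoneVector : Set where
  -2⃗ -1⃗ 1⃗ 2⃗ : StoneVector

facing : StoneVector → Direction
facing -2⃗ = ↺
facing -1⃗ = ↺
facing 1⃗  = ↻
facing 2⃗  = ↻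

displacement : StoneVector → ℤ
displacement -2⃗ = - + 2
displacement -1⃗ = - + 1
displacement 1⃗  = + 1
displacement 2⃗  = + 2

len : StoneVector → ℤ
len v = + ℤ.∣ displacement v ∣

turn : StoneVector → StoneVector
turn -2⃗ = 1⃗
turn -1⃗ = 2⃗
turn 1⃗  = -2⃗
turn 2⃗  = -1⃗

shorten : StoneVector → StoneVector
shorten -2⃗ = -1⃗
shorten -1⃗ = -1⃗
shorten 1⃗  = 1⃗
shorten 2⃗  = 1⃗

reflect : StoneVector → StoneVector
reflect -2⃗ = 2⃗
reflect -1⃗ = 1⃗
reflect 1⃗  = -1⃗
reflect 2⃗  = -2⃗

Odd : ℤ → Set
Odd z = ∃ λ q → z ≡ + 2 * q + 1ℤ

-- A (k,N)-necklace on the circle ℝ/Nℤ, described on the universal cover: the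
-- stones, listed in clockwise order, lift to a strictly increasing sequence
-- indexed by ℤ, in which passing 2k stones means going once around.
-- The necklace conditions force all distances between consecutive stones to be
-- integers, so every necklace can be rotated to one with integer positions.
record Necklace (k N : ℕ) : Set where
  field
    pos : ℤ → ℤ
    vec : ℤ → StoneVector

  dist : ℤ → ℤ
  dist i = pos (ℤ.suc i) - pos i

  field
    pos-increasing : ∀ i → pos i < pos (ℤ.suc i)
    pos-periodic   : ∀ i → pos (i + + (2 ℕ.* k)) ≡ pos i + + N
    vec-periodic   : ∀ i → vec (i + + (2 ℕ.* k)) ≡ vec i
    alternating    : ∀ i → facing (vec i) ≢ facing (vec (ℤ.suc i))
    away           : ∀ i → facing (vec i) ≡ ↺ → facing (vec (ℤ.suc i)) ≡ ↻ →
                     Odd (dist i)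
    towards        : ∀ i → facing (vec i) ≡ ↻ → facing (vec (ℤ.suc i)) ≡ ↺ →
                     Odd (dist i + len (vec i) + len (vec (ℤ.suc i)))
                     × + 3 ≤ dist i
                     × (dist i ≡ + 3 →
                        len (vec i) ≡ 1ℤ × len (vec (ℤ.suc i)) ≡ 1ℤ)

-- Differing by a rotation (first case) or a reflection (second case) of the
-- circle; s accounts for the choice of which stone has index 0.
infix 4 _≅_
_≅_ : ∀ {k N} → Necklace k N → Necklace k N → Set
X ≅ Y = ∃₂ λ s r →
    (∀ i → Y.pos i ≡ X.pos (i + s) + r × Y.vec i ≡ X.vec (i + s))
  ⊎ (∀ i → Y.pos i ≡ r - X.pos (s - i) × Y.vec i ≡ reflect (X.vec (s - i)))
  where
  module X = Necklace X
  module Y = Necklace Y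

_≟ᵈ_ : Decidable {A = Direction} _≡_
↻ ≟ᵈ ↻ = yes refl
↻ ≟ᵈ ↺ = no λ ()
↺ ≟ᵈ ↻ = no λ ()
↺ ≟ᵈ ↺ = yes refl

module _ {k N : ℕ} (X : Necklace k N) where
  open Necklace X

  jumped : ℤ → ℤ
  jumped i = pos i + displacement (vec i)

  turned : ℤ → StoneVector
  turned i = turn (vec i)

  -- After JUMP and TURN, the stones i and i + 1 are at distance 3 and face each
  -- other.  Non-consecutive stones facing each other are further apart, because
  -- there are at least two other stones between them.
  Meet : ℤ → Set
  Meet i = facing (turned i) ≡ ↻
         × facing (turned (ℤ.suc i)) ≡ ↺
         × jumped (ℤ.suc i) - jumped i ≡ + 3

  meet? : ∀ i → Dec (Meet i)
  meet? i = (facing (turned i) ≟ᵈ ↻)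
      ×-dec (facing (turned (ℤ.suc i)) ≟ᵈ ↺)
      ×-dec (jumped (ℤ.suc i) - jumped i ℤ.≟ + 3)

  fixed : ℤ → StoneVector
  fixed i = if does (meet? i ⊎-dec meet? (ℤ.pred i))
            then shorten (turned i) else turned i

  private
    P = + (2 ℕ.* k)

    facing-shorten : ∀ v → facing (shorten v) ≡ facing v
    facing-shorten -2⃗ = refl
    facing-shorten -1⃗ = refl
    facing-shorten 1⃗  = refl
    facing-shorten 2⃗  = refl

    len-shorten : ∀ v → len (shorten v) ≡ 1ℤ
    len-shorten -2⃗ = refl
    len-shorten -1⃗ = refl
    len-shorten 1⃗  = refl
    len-shorten 2⃗  = refl

    turn-↻ : ∀ {v} → facing (turn v) ≡ ↻ → facing v ≡ ↺
    turn-↻ { -2⃗} _ = refl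
    turn-↻ { -1⃗} _ = refl

    turn-↺ : ∀ {v} → facing (turn v) ≡ ↺ → facing v ≡ ↻
    turn-↺ {1⃗} _ = refl
    turn-↺ {2⃗} _ = refl

    ↻≢↺ : ∀ {d} → d ≡ ↻ → d ≢ ↺
    ↻≢↺ refl ()

    suc-shift : ∀ i → ℤ.suc (i + P) ≡ ℤ.suc i + P
    suc-shift i = sym (ℤ.+-assoc 1ℤ i P)

    pred-shift : ∀ i → ℤ.pred (i + P) ≡ ℤ.pred i + P
    pred-shift i = sym (ℤ.+-assoc -1ℤ i P)

    facing-fixed : ∀ i → facing (fixed i) ≡ facing (turned i)
    facing-fixed i with does (meet? i ⊎-dec meet? (ℤ.pred i))
    ... | true  = facing-shorten (turned i)
    ... | false = refl

    fixed-meet : ∀ i → Meet i ⊎ Meet (ℤ.pred i) → len (fixed i) ≡ 1ℤ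
    fixed-meet i m =
      trans (cong (λ b → len (if b then shorten (turned i) else turned i))
                  (dec-true (meet? i ⊎-dec meet? (ℤ.pred i)) m))
            (len-shorten (turned i))

    fixed-free : ∀ i → ¬ (Meet i ⊎ Meet (ℤ.pred i)) → fixed i ≡ turned i
    fixed-free i ¬m =
      cong (λ b → if b then shorten (turned i) else turned i)
           (dec-false (meet? i ⊎-dec meet? (ℤ.pred i)) ¬m)

    meet-suc : ∀ i → Meet i → Meet (ℤ.pred (ℤ.suc i))
    meet-suc i = subst Meet (sym (ℤ.pred-suc i))

    free-left : ∀ i → facing (turned i) ≡ ↻ → ¬ Meet i → fixed i ≡ turned i
    free-left i cw ¬m = fixed-free i λ
      { (inj₁ m) → ¬m m
      ; (inj₂ (_ , acw , _)) →
          ↻≢↺ cw (subst (λ j → facing (turned j) ≡ ↺) (ℤ.suc-pred i) acw) }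

    free-right : ∀ i → facing (turned (ℤ.suc i)) ≡ ↺ → ¬ Meet i →
                 fixed (ℤ.suc i) ≡ turned (ℤ.suc i)
    free-right i acw ¬m = fixed-free (ℤ.suc i) λ
      { (inj₁ (cw , _)) → ↻≢↺ cw acw
      ; (inj₂ m) → ¬m (subst Meet (ℤ.pred-suc i) m) }

    jumped-periodic : ∀ i → jumped (i + P) ≡ jumped i + + N
    jumped-periodic i =
      trans (cong₂ _+_ (pos-periodic i) (cong displacement (vec-periodic i)))
            (swap-last (pos i) (+ N) (displacement (vec i)))
      where
      swap-last : ∀ a b c → a + b + c ≡ a + c + b
      swap-last = solve-∀

    turned-periodic : ∀ i → turned (i + P) ≡ turned i
    turned-periodic i = cong turn (vec-periodic i)

    turned-periodic⁺ : ∀ i → turned (ℤ.suc (i + P)) ≡ turned (ℤ.suc i)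
    turned-periodic⁺ i = trans (cong turned (suc-shift i)) (turned-periodic (ℤ.suc i))

    gap-periodic : ∀ i → jumped (ℤ.suc (i + P)) - jumped (i + P)
                       ≡ jumped (ℤ.suc i) - jumped i
    gap-periodic i =
      trans (cong₂ _-_ (trans (cong jumped (suc-shift i)) (jumped-periodic (ℤ.suc i)))
                       (jumped-periodic i))
            (cancel (jumped (ℤ.suc i)) (jumped i) (+ N))
      where
      cancel : ∀ a b c → (a + c) - (b + c) ≡ a - b
      cancel = solve-∀

    meet-periodic : ∀ i → Meet (i + P) ⇔ Meet i
    meet-periodic i = mk⇔
      (λ (a , b , c) → trans (sym e₁) a , trans (sym e₂) b , trans (sym e₃) c)
      (λ (a , b , c) → trans e₁ a , trans e₂ b , trans e₃ c)
      where
      e₁ = cong facing (turned-periodic i)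
      e₂ = cong facing (turned-periodic⁺ i)
      e₃ = gap-periodic i

    meet-periodic⁻ : ∀ i → Meet (ℤ.pred (i + P)) ⇔ Meet (ℤ.pred i)
    meet-periodic⁻ i =
      subst (λ j → Meet j ⇔ Meet (ℤ.pred i)) (sym (pred-shift i))
            (meet-periodic (ℤ.pred i))

    fixed-periodic : ∀ i → fixed (i + P) ≡ fixed i
    fixed-periodic i = cong₂ (λ b v → if b then shorten v else v)
      (cong₂ _∨_ (does-⇔ (meet-periodic i) (meet? (i + P)) (meet? i))
                 (does-⇔ (meet-periodic⁻ i) (meet? (ℤ.pred (i + P))) (meet? (ℤ.pred i))))
      (turned-periodic i)

    disp-↻ : ∀ {v} → facing v ≡ ↻ → displacement v ≡ len v
    disp-↻ {1⃗} _ = refl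
    disp-↻ {2⃗} _ = refl

    disp-↺ : ∀ {v} → facing v ≡ ↺ → displacement v ≡ - len v
    disp-↺ { -2⃗} _ = refl
    disp-↺ { -1⃗} _ = refl

    len-turn : ∀ v → len (turn v) ≡ + 3 - len v
    len-turn -2⃗ = refl
    len-turn -1⃗ = refl
    len-turn 1⃗  = refl
    len-turn 2⃗  = refl

    1≤len : ∀ v → 1ℤ ≤ len v
    1≤len -2⃗ = +≤+ (s≤s z≤n)
    1≤len -1⃗ = +≤+ (s≤s z≤n)
    1≤len 1⃗  = +≤+ (s≤s z≤n)
    1≤len 2⃗  = +≤+ (s≤s z≤n)

    newGap : ∀ i → jumped (ℤ.suc i) - jumped i
                 ≡ dist i + (displacement (vec (ℤ.suc i)) - displacement (vec i))
    newGap i = regroup (pos (ℤ.suc i)) (displacement (vec (ℤ.suc i)))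
                       (pos i) (displacement (vec i))
      where
      regroup : ∀ a b c d → (a + b) - (c + d) ≡ (a - c) + (b - d)
      regroup = solve-∀

    1≤dist : ∀ i → 1ℤ ≤ dist i
    1≤dist i = subst (_≤ dist i) (cancel (pos i))
                 (ℤ.+-monoˡ-≤ (- pos i) (ℤ.i<j⇒suc[i]≤j (pos-increasing i)))
      where
      cancel : ∀ a → (1ℤ + a) - a ≡ 1ℤ
      cancel = solve-∀

    module After-away (i : ℤ) (acw : facing (vec i) ≡ ↺)
                      (cw : facing (vec (ℤ.suc i)) ≡ ↻) where
      d a b g : ℤ
      d = dist i
      a = len (vec i)
      b = len (vec (ℤ.suc i))
      g = jumped (ℤ.suc i) - jumped i

      g≡ : g ≡ d + (b - - a)
      g≡ = trans (newGap i) (cong₂ (λ x y → d + (x - y)) (disp-↻ cw) (disp-↺ acw))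

      3≤g : + 3 ≤ g
      3≤g = subst (+ 3 ≤_) (sym (trans g≡ (neg-neg d a b)))
              (ℤ.+-mono-≤ (1≤dist i) (ℤ.+-mono-≤ (1≤len (vec (ℤ.suc i))) (1≤len (vec i))))
        where
        neg-neg : ∀ d a b → d + (b - - a) ≡ d + (b + a)
        neg-neg = solve-∀

    module After-towards (i : ℤ) (cw : facing (vec i) ≡ ↻)
                         (acw : facing (vec (ℤ.suc i)) ≡ ↺) where
      d a b g : ℤ
      d = dist i
      a = len (vec i)
      b = len (vec (ℤ.suc i))
      g = jumped (ℤ.suc i) - jumped i

      g≡ : g ≡ d + (- b - a)
      g≡ = trans (newGap i) (cong₂ (λ x y → d + (x - y)) (disp-↺ acw) (disp-↻ cw))

      odd-g : Odd g
      odd-g with proj₁ (towards i cw acw)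
      ... | q , e = q - (a + b) ,
        trans g≡ (trans (expand d a b) (trans (cong (_- + 2 * (a + b)) e) (collect q (a + b))))
        where
        expand : ∀ d a b → d + (- b - a) ≡ (d + a + b) - + 2 * (a + b)
        expand = solve-∀
        collect : ∀ q c → (+ 2 * q + 1ℤ) - + 2 * c ≡ + 2 * (q - c) + 1ℤ
        collect = solve-∀

      0<g : 0ℤ < g
      0<g = subst (0ℤ <_) (sym g≡)
              (bound (vec i) (vec (ℤ.suc i)) d
                     (proj₁ (towards i cw acw)) (proj₁ (proj₂ (towards i cw acw)))
                     (proj₂ (proj₂ (towards i cw acw))))
        where
        ¬odd8 : ¬ Odd (+ 8)
        ¬odd8 (+ q , e) = odd≢ q 4 (ℤ.+-injective (trans e (cong (_+ 1ℤ) (sym (ℤ.pos-* 2 q)))))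
          where
          odd≢ : ∀ q m → 2 ℕ.* m ≢ 2 ℕ.* q ℕ.+ 1
          odd≢ q m e′ = ℕ.even≢odd m q (trans e′ (ℕ.+-comm (2 ℕ.* q) 1))
        ¬odd8 (-[1+ q ] , e) rewrite ℕ.+-suc q (q ℕ.+ 0) with () ← e

        +<+′ : ∀ {m} → 0ℤ < + suc m
        +<+′ = ℤ.+<+ (s≤s z≤n)

        at-3 : ∀ v w → (len v ≡ 1ℤ × len w ≡ 1ℤ) → 0ℤ < + 3 + (- len w - len v)
        at-3 v w (p , q) =
          subst (λ z → 0ℤ < + 3 + z) (sym (cong₂ (λ x y → - x - y) q p)) +<+′

        at-4 : ∀ v w → Odd (+ 4 + len v + len w) → 0ℤ < + 4 + (- len w - len v)
        at-4 -2⃗ -2⃗ o = ⊥-elim (¬odd8 o)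
        at-4 -2⃗ -1⃗ o = +<+′
        at-4 -2⃗ 1⃗  o = +<+′
        at-4 -2⃗ 2⃗  o = ⊥-elim (¬odd8 o)
        at-4 -1⃗ -2⃗ o = +<+′
        at-4 -1⃗ -1⃗ o = +<+′
        at-4 -1⃗ 1⃗  o = +<+′
        at-4 -1⃗ 2⃗  o = +<+′
        at-4 1⃗ -2⃗ o = +<+′
        at-4 1⃗ -1⃗ o = +<+′
        at-4 1⃗ 1⃗  o = +<+′
        at-4 1⃗ 2⃗  o = +<+′
        at-4 2⃗ -2⃗ o = ⊥-elim (¬odd8 o)
        at-4 2⃗ -1⃗ o = +<+′
        at-4 2⃗ 1⃗  o = +<+′
        at-4 2⃗ 2⃗  o = ⊥-elim (¬odd8 o)

        len≤2 : ∀ v → - + 2 ≤ - len v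
        len≤2 -2⃗ = ℤ.≤-refl
        len≤2 -1⃗ = ℤ.-≤- z≤n
        len≤2 1⃗  = ℤ.-≤- z≤n
        len≤2 2⃗  = ℤ.≤-refl

        bound : ∀ v w d → Odd (d + len v + len w) → + 3 ≤ d →
                (d ≡ + 3 → len v ≡ 1ℤ × len w ≡ 1ℤ) →
                0ℤ < d + (- len w - len v)
        bound v w (+ 0) _ (+≤+ ()) _
        bound v w (+ 1) _ (+≤+ (s≤s ())) _
        bound v w (+ 2) _ (+≤+ (s≤s (s≤s ()))) _
        bound v w (+ 3) _ _ h = at-3 v w (h refl)
        bound v w (+ 4) o _ _ = at-4 v w o
        bound v w (+ suc (suc (suc (suc (suc m))))) _ _ _ =
          ℤ.<-≤-trans +<+′
            (ℤ.+-monoʳ-≤ (+ (5 ℕ.+ m)) (ℤ.+-mono-≤ (len≤2 w) (len≤2 v)))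

    positive⇒< : ∀ a b → 0ℤ < b - a → a < b
    positive⇒< a b p = subst₂ _<_ (ℤ.+-identityʳ a) (cancel a b) (ℤ.+-monoʳ-< a p)
      where
      cancel : ∀ a b → a + (b - a) ≡ b
      cancel = solve-∀

    jumped-increasing : ∀ i → jumped i < jumped (ℤ.suc i)
    jumped-increasing i = positive⇒< _ _ (go (facing (vec i)) (facing (vec (ℤ.suc i))) refl refl)
      where
      go : ∀ x y → facing (vec i) ≡ x → facing (vec (ℤ.suc i)) ≡ y →
           0ℤ < jumped (ℤ.suc i) - jumped i
      go ↻ ↻ p q = ⊥-elim (alternating i (trans p (sym q)))
      go ↺ ↺ p q = ⊥-elim (alternating i (trans p (sym q)))
      go ↻ ↺ p q = After-towards.0<g i p q
      go ↺ ↻ p q = ℤ.<-≤-trans (ℤ.+<+ (s≤s z≤n)) (After-away.3≤g i p q)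

    fixed-towards : ∀ i → facing (turned i) ≡ ↻ → facing (turned (ℤ.suc i)) ≡ ↺ →
      Odd (jumped (ℤ.suc i) - jumped i + len (fixed i) + len (fixed (ℤ.suc i)))
      × + 3 ≤ jumped (ℤ.suc i) - jumped i
      × (jumped (ℤ.suc i) - jumped i ≡ + 3 →
         len (fixed i) ≡ 1ℤ × len (fixed (ℤ.suc i)) ≡ 1ℤ)
    fixed-towards i cw acw = odd (meet? i) , 3≤g , λ e → short (cw , acw , e)
      where
      open After-away i (turn-↻ cw) (turn-↺ acw)

      short : Meet i → len (fixed i) ≡ 1ℤ × len (fixed (ℤ.suc i)) ≡ 1ℤ
      short m = fixed-meet i (inj₁ m) , fixed-meet (ℤ.suc i) (inj₂ (meet-suc i m))

      odd : Dec (Meet i) → Odd (g + len (fixed i) + len (fixed (ℤ.suc i)))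
      odd (yes m@(_ , _ , e)) = + 2 ,
        cong₂ _+_ (cong₂ _+_ e (proj₁ (short m))) (proj₂ (short m))
      odd (no ¬m) with away i (turn-↻ cw) (turn-↺ acw)
      ... | q , e = q + + 3 , trans
        (cong₂ _+_ (cong₂ _+_ g≡ (trans (cong len (free-left i cw ¬m)) (len-turn (vec i))))
                   (trans (cong len (free-right i acw ¬m)) (len-turn (vec (ℤ.suc i)))))
        (trans (cancel d a b) (trans (cong (_+ + 6) e) (collect q)))
        where
        cancel : ∀ d a b → d + (b - - a) + (+ 3 - a) + (+ 3 - b) ≡ d + + 6
        cancel = solve-∀
        collect : ∀ q → + 2 * q + 1ℤ + + 6 ≡ + 2 * (q + + 3) + 1ℤ
        collect = solve-∀

  T : Necklace k N
  T = record
    { pos            = jumped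
    ; vec            = fixed
    ; pos-increasing = jumped-increasing
    ; pos-periodic   = jumped-periodic
    ; vec-periodic   = fixed-periodic
    ; alternating    = λ i e → alternating i (turn-injective
        (trans (sym (facing-fixed i)) (trans e (facing-fixed (ℤ.suc i)))))
    ; away           = λ i acw cw → After-towards.odd-g i
        (turn-↺ (trans (sym (facing-fixed i)) acw))
        (turn-↻ (trans (sym (facing-fixed (ℤ.suc i))) cw))
    ; towards        = λ i cw acw → fixed-towards i
        (trans (sym (facing-fixed i)) cw)
        (trans (sym (facing-fixed (ℤ.suc i))) acw)
    }
    where
    turn-injective : ∀ {v w} → facing (turn v) ≡ facing (turn w) → facing v ≡ facing w
    turn-injective {v} {w} e with facing (turn w) in eq
    ... | ↻ = trans (turn-↻ {v} e) (sym (turn-↻ {w} eq))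
    ... | ↺ = trans (turn-↺ {v} e) (sym (turn-↺ {w} eq))

{-# OPTIONS --safe #-}

-- Cut the first row of P_{m+1} × C_N down to A and delete B from the second row.  If A
-- is independent and disjoint from B, inclusion–exclusion over the first row leaves, up
-- to sign, the same problem with one row less, where the new A consists of the vertices
-- outside A and B without neighbours in A and the new B is the old A.  Splitting by the
-- odd vertices of the first row reduces Z(P_{m+1} × C_N) to patterns (A , B) that consist
-- of arithmetic progressions of difference 2.  Their ends are the stones of a necklace,
-- and the step just described is T, except that a pair of stones brought to distance 3
-- is either kept (this is FIX) or removed, merging two progressions.  A removal lowers
-- the number k of pairs of stones.  Hence, modulo series belonging to smaller k, the
-- series G of a (k,N)-necklace satisfies S^{N−3k} G = ± G for the shift S, because
-- T^{N−3k} = 1, and induction on k shows that ∏_j (S^{2(N−3j)} − 1) over j = 1 , … , k,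
-- together with S² − (−1)^{N/2} for the patterns without stones, annihilates it.
-- Finally k ≤ N/4, since two consecutive distances between stones add up to at least 4.

module Submission where

import Data.Bool.Properties as Bool
open import Data.Bool.Base using (Bool; true; false; _∧_; _∨_; not; if_then_else_)
open import Data.Empty using (⊥-elim)
open import Data.Fin.Base as Fin using (Fin; toℕ)
open import Data.Fin.Subset using (Subset; _∪_)
open import Data.Integer.Base as ℤ using (ℤ; +_; -[1+_]; 0ℤ; 1ℤ; -1ℤ)
import Data.Integer.Properties as ℤ
open import Data.Integer.Tactic.RingSolver using (solve-∀)
open import Data.Nat.Base as ℕ using (ℕ)
import Data.Nat.Properties as ℕ
open import Data.Product.Base using (∃; ∃₂; Σ; _×_; _,_; proj₁; proj₂)
open import Data.Sum.Base using (_⊎_; inj₁; inj₂)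
open import Data.Vec.Base using (Vec; []; _∷_; lookup; tabulate)
open import Function.Base using (_∘_)
open import Relation.Binary.PropositionalEquality
open import Relation.Nullary using (¬_; Dec; yes; no; does)
open import Relation.Nullary.Decidable
  using (map′; dec-true; dec-false; _×-dec_; _⊎-dec_; _→-dec_; ¬?)
open import Defs

-- Necklaces live on stones indexed by ℤ, the recurrence on subsets of a finite circle. Both are
-- lifted to N-periodic words of cells on ℤ, where T with optional mergers becomes a cellular
-- automaton of radius two. Jumps, FIX and the shape of the rows then depend on at most nine cells
-- and are settled by finite search; only the counting of stones, periodicity and isometries need
-- global arguments.
--
-- The choice between FIX and a merger arises because two stones that come to distance 3 leave three
-- consecutive vertices in the new first row, which is no pattern. Sorting the independent sets by
-- whether they contain the middle vertex repairs this: a chosen middle vertex gives FIX, an omitted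
-- one the merger.
--
-- The sign in S^{N-3k} G = ± G is a product of parities of rows along a whole cycle and is not
-- computed; squaring removes it, whence the exponents 2(N-3j). It is evaluated only for patterns
-- without stones: two steps rotate such a pattern by one place, and their two rows have N/2
-- vertices together. This yields 1 + t² or 1 - t².

-- Alternating sums over subsets

module SubsetSums where
  open import Data.Fin.Base using (zero; suc)
  open import Data.Integer.Base using (_+_; _*_; -_)
  open import Data.Integer.Properties
  open import Data.Vec.Base using (_++_; _∷ʳ_)

  private variable
    m n : ℕ

  infix 4 _∋_
  _∋_ : Subset n → Fin n → Set
  σ ∋ x = lookup σ x ≡ true

  sum-cong : {g h : Subset n → ℤ} → (∀ σ → g σ ≡ h σ) → sumOverSubsets g ≡ sumOverSubsets h
  sum-cong {n = ℕ.zero}  e = e []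
  sum-cong {n = ℕ.suc n} e = cong₂ _+_ (sum-cong (e ∘ (true ∷_))) (sum-cong (e ∘ (false ∷_)))

  interchange : ∀ a b c d → (a + b) + (c + d) ≡ (a + c) + (b + d)
  interchange = solve-∀

  sum-+ : (g h : Subset n → ℤ) →
          sumOverSubsets (λ σ → g σ + h σ) ≡ sumOverSubsets g + sumOverSubsets h
  sum-+ {ℕ.zero}  g h = refl
  sum-+ {ℕ.suc n} g h = trans
    (cong₂ _+_ (sum-+ (g ∘ (true ∷_)) (h ∘ (true ∷_))) (sum-+ (g ∘ (false ∷_)) (h ∘ (false ∷_))))
    (interchange (sumOverSubsets (g ∘ (true ∷_))) (sumOverSubsets (h ∘ (true ∷_)))
                 (sumOverSubsets (g ∘ (false ∷_))) (sumOverSubsets (h ∘ (false ∷_))))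

  sum-* : ∀ c (g : Subset n → ℤ) → sumOverSubsets (λ σ → c * g σ) ≡ c * sumOverSubsets g
  sum-* {ℕ.zero}  c g = refl
  sum-* {ℕ.suc n} c g = trans
    (cong₂ _+_ (sum-* c (g ∘ (true ∷_))) (sum-* c (g ∘ (false ∷_))))
    (sym (*-distribˡ-+ c (sumOverSubsets (g ∘ (true ∷_))) (sumOverSubsets (g ∘ (false ∷_)))))

  sum-zero : ∀ n → sumOverSubsets {n} (λ _ → 0ℤ) ≡ 0ℤ
  sum-zero ℕ.zero    = refl
  sum-zero (ℕ.suc n) = cong₂ _+_ (sum-zero n) (sum-zero n)

  sum-neg : (g : Subset n → ℤ) → sumOverSubsets (λ σ → - g σ) ≡ - sumOverSubsets g
  sum-neg {ℕ.zero}  g = refl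
  sum-neg {ℕ.suc n} g = trans
    (cong₂ _+_ (sum-neg (g ∘ (true ∷_))) (sum-neg (g ∘ (false ∷_))))
    (sym (neg-distrib-+ (sumOverSubsets (g ∘ (true ∷_))) (sumOverSubsets (g ∘ (false ∷_)))))

  sum-swap : (g : Subset m → Subset n → ℤ) →
             sumOverSubsets (λ σ → sumOverSubsets (g σ)) ≡
             sumOverSubsets (λ τ → sumOverSubsets (λ σ → g σ τ))
  sum-swap {ℕ.zero}  g = refl
  sum-swap {ℕ.suc m} g = trans
    (cong₂ _+_ (sum-swap (g ∘ (true ∷_))) (sum-swap (g ∘ (false ∷_))))
    (sym (sum-+ (λ τ → sumOverSubsets (λ σ → g (true ∷ σ) τ))
                (λ τ → sumOverSubsets (λ σ → g (false ∷ σ) τ))))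

  sum-++ : (g : Subset (m ℕ.+ n) → ℤ) →
           sumOverSubsets g ≡ sumOverSubsets {m} (λ ρ → sumOverSubsets {n} (λ σ → g (ρ ++ σ)))
  sum-++ {ℕ.zero}  g = refl
  sum-++ {ℕ.suc m} g = cong₂ _+_ (sum-++ {m} (g ∘ (true ∷_))) (sum-++ {m} (g ∘ (false ∷_)))

  sum-∷ʳ : (g : Subset (ℕ.suc n) → ℤ) →
           sumOverSubsets g ≡ sumOverSubsets (λ σ → g (σ ∷ʳ true)) + sumOverSubsets (λ σ → g (σ ∷ʳ false))
  sum-∷ʳ {ℕ.zero}  g = refl
  sum-∷ʳ {ℕ.suc n} g = trans
    (cong₂ _+_ (sum-∷ʳ (g ∘ (true ∷_))) (sum-∷ʳ (g ∘ (false ∷_))))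
    (interchange (sumOverSubsets (λ σ → g (true ∷ (σ ∷ʳ true)))) (sumOverSubsets (λ σ → g (true ∷ (σ ∷ʳ false))))
                 (sumOverSubsets (λ σ → g (false ∷ (σ ∷ʳ true)))) (sumOverSubsets (λ σ → g (false ∷ (σ ∷ʳ false)))))

  𝟙 : Bool → ℤ
  𝟙 true  = 1ℤ
  𝟙 false = 0ℤ

  𝟙-∧ : ∀ a b → 𝟙 (a ∧ b) ≡ 𝟙 a * 𝟙 b
  𝟙-∧ true  b = sym (*-identityˡ (𝟙 b))
  𝟙-∧ false b = refl

  𝟙-cong : ∀ b {x y} → (b ≡ true → x ≡ y) → 𝟙 b * x ≡ 𝟙 b * y
  𝟙-cong true  e = cong (1ℤ *_) (e refl)
  𝟙-cong false e = refl

  sgn : Subset n → ℤ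
  sgn []          = 1ℤ
  sgn (true  ∷ σ) = - sgn σ
  sgn (false ∷ σ) = sgn σ

  sgn² : (σ : Subset n) → sgn σ * sgn σ ≡ 1ℤ
  sgn² []          = refl
  sgn² (true  ∷ σ) = trans (lemma (sgn σ)) (sgn² σ)
    where
    lemma : ∀ a → - a * - a ≡ a * a
    lemma = solve-∀
  sgn² (false ∷ σ) = sgn² σ

  infix 7 _⊆ᵇ_
  -- Boolean, so that they can stand inside the indicators of a sum, and recursive along
  -- `sumOverSubsets`, so that the sums below split by the first vertex.
  _⊆ᵇ_ disjointᵇ : Subset n → Subset n → Bool
  []      ⊆ᵇ []      = true
  (x ∷ σ) ⊆ᵇ (y ∷ τ) = (not x ∨ y) ∧ σ ⊆ᵇ τ
  disjointᵇ []      []      = true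
  disjointᵇ (x ∷ σ) (y ∷ τ) = not (x ∧ y) ∧ disjointᵇ σ τ

  does-elim : ∀ {P : Set} (d : Dec P) → does d ≡ true → P
  does-elim (yes p) _ = p

  bool-ext : ∀ {a b} → (a ≡ true → b ≡ true) → (b ≡ true → a ≡ true) → a ≡ b
  bool-ext {true}  {b}     f g = sym (f refl)
  bool-ext {false} {true}  f g = g refl
  bool-ext {false} {false} f g = refl

  ∧-split : ∀ {a b} → a ∧ b ≡ true → a ≡ true × b ≡ true
  ∧-split {true} {true} refl = refl , refl

  ∧-join : ∀ {a b} → a ≡ true → b ≡ true → a ∧ b ≡ true
  ∧-join refl refl = refl

  ∨-case : ∀ {a b} {P : Set} → (a ≡ true → P) → (b ≡ true → P) → a ∨ b ≡ true → P
  ∨-case {true}  f g e = f refl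
  ∨-case {false} f g e = g e

  ∨-left : ∀ {a} b → a ≡ true → a ∨ b ≡ true
  ∨-left b refl = refl

  ∨-right : ∀ a {b} → b ≡ true → a ∨ b ≡ true
  ∨-right true  _ = refl
  ∨-right false e = e

  ⊆ᵇ-elim : (σ τ : Subset n) → σ ⊆ᵇ τ ≡ true → ∀ x → σ ∋ x → τ ∋ x
  ⊆ᵇ-elim (true ∷ σ) (true ∷ τ) e zero    refl = refl
  ⊆ᵇ-elim (x ∷ σ)    (y ∷ τ)    e (suc i) p    = ⊆ᵇ-elim σ τ (proj₂ (∧-split {not x ∨ y} e)) i p

  ⊆ᵇ-intro : (σ τ : Subset n) → (∀ x → σ ∋ x → τ ∋ x) → σ ⊆ᵇ τ ≡ true
  ⊆ᵇ-intro []         []      f = refl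
  ⊆ᵇ-intro (true ∷ σ) (y ∷ τ) f rewrite f zero refl = ⊆ᵇ-intro σ τ (f ∘ suc)
  ⊆ᵇ-intro (false ∷ σ) (y ∷ τ) f = ⊆ᵇ-intro σ τ (f ∘ suc)

  disjointᵇ-elim : (σ τ : Subset n) → disjointᵇ σ τ ≡ true → ∀ x → σ ∋ x → ¬ τ ∋ x
  disjointᵇ-elim (true ∷ σ) (true ∷ τ) () zero    refl refl
  disjointᵇ-elim (x ∷ σ)    (y ∷ τ)    e (suc i) p    q    =
    disjointᵇ-elim σ τ (proj₂ (∧-split {not (x ∧ y)} e)) i p q

  disjointᵇ-intro : (σ τ : Subset n) → (∀ x → σ ∋ x → ¬ τ ∋ x) → disjointᵇ σ τ ≡ true
  disjointᵇ-intro []          []          f = refl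
  disjointᵇ-intro (true ∷ σ)  (true ∷ τ)  f = ⊥-elim (f zero refl refl)
  disjointᵇ-intro (true ∷ σ)  (false ∷ τ) f = disjointᵇ-intro σ τ (f ∘ suc)
  disjointᵇ-intro (false ∷ σ) (y ∷ τ)     f = disjointᵇ-intro σ τ (f ∘ suc)

  ∪-∋ : (σ τ : Subset n) → ∀ x → lookup (σ ∪ τ) x ≡ lookup σ x ∨ lookup τ x
  ∪-∋ (x ∷ σ) (y ∷ τ) zero    = refl
  ∪-∋ (x ∷ σ) (y ∷ τ) (suc i) = ∪-∋ σ τ i

  sgn-∪ : (σ τ : Subset n) → disjointᵇ σ τ ≡ true → sgn (σ ∪ τ) ≡ sgn σ * sgn τ
  sgn-∪ []          []          e = refl
  sgn-∪ (true ∷ σ)  (false ∷ τ) e = trans (cong -_ (sgn-∪ σ τ e)) (neg-distribˡ-* (sgn σ) (sgn τ))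
  sgn-∪ (false ∷ σ) (true ∷ τ)  e = trans (cong -_ (sgn-∪ σ τ e)) (neg-distribʳ-* (sgn σ) (sgn τ))
  sgn-∪ (false ∷ σ) (false ∷ τ) e = sgn-∪ σ τ e

  -- The sets σ are the subsets of A outside τ. A vertex in A but not in τ can be inserted or
  -- removed, which reverses the sign, so everything cancels unless A ⊆ τ.
  sum-sgn : (A τ : Subset n) →
    sumOverSubsets (λ σ → 𝟙 (σ ⊆ᵇ A ∧ disjointᵇ σ τ) * sgn σ) ≡ 𝟙 (A ⊆ᵇ τ)
  sum-sgn []         []          = refl
  sum-sgn {ℕ.suc n} (true ∷ A)  (true ∷ τ)  = trans
    (cong₂ _+_ (trans (sum-cong λ σ → cong (λ b → 𝟙 b * - sgn σ) (∧-false (σ ⊆ᵇ A))) (sum-zero n)) (sum-sgn A τ))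
    (+-identityˡ _)
    where
    ∧-false : ∀ b → b ∧ false ≡ false
    ∧-false true  = refl
    ∧-false false = refl
  sum-sgn (true ∷ A)  (false ∷ τ) = trans
    (cong (_+ s) (trans (sum-cong λ σ → sym (neg-distribʳ-* (𝟙 (σ ⊆ᵇ A ∧ disjointᵇ σ τ)) (sgn σ)))
                        (sum-neg (λ σ → 𝟙 (σ ⊆ᵇ A ∧ disjointᵇ σ τ) * sgn σ))))
    (+-inverseˡ s)
    where s = sumOverSubsets (λ σ → 𝟙 (σ ⊆ᵇ A ∧ disjointᵇ σ τ) * sgn σ)
  sum-sgn {ℕ.suc n} (false ∷ A) (y ∷ τ) = trans
    (cong₂ _+_ (sum-zero n) (sum-sgn A τ)) (+-identityˡ _)

  sum-zero-+ : ∀ n x → sumOverSubsets {n} (λ _ → 0ℤ) + x ≡ x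
  sum-zero-+ n x = trans (cong (_+ x) (sum-zero n)) (+-identityˡ x)

  -- A superset of A is determined by its part outside A, which is arbitrary.
  sum-superset : (A : Subset n) (h : Subset n → ℤ) →
    sumOverSubsets (λ τ → 𝟙 (A ⊆ᵇ τ) * h τ) ≡
    sumOverSubsets (λ τ → 𝟙 (disjointᵇ τ A) * h (τ ∪ A))
  sum-superset []          h = refl
  sum-superset {ℕ.suc n} (true ∷ A)  h = trans
    (cong₂ _+_ (sum-superset A (h ∘ (true ∷_))) (sum-zero n))
    (trans (+-identityʳ s) (sym (sum-zero-+ n s)))
    where s = sumOverSubsets (λ τ → 𝟙 (disjointᵇ τ A) * h (true ∷ (τ ∪ A)))
  sum-superset (false ∷ A) h =
    cong₂ _+_ (sum-superset A (h ∘ (true ∷_))) (sum-superset A (h ∘ (false ∷_)))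

  -- Every set is the union of its trace c on C and a remainder τ outside C, in exactly one way.
  sum-split : (C : Subset n) (h : Subset n → ℤ) →
    sumOverSubsets h ≡
    sumOverSubsets (λ c → 𝟙 (c ⊆ᵇ C) * sumOverSubsets (λ τ → 𝟙 (disjointᵇ τ C) * h (τ ∪ c)))
  sum-split []          h = sym (trans (*-identityˡ (1ℤ * h [])) (*-identityˡ (h [])))
  sum-split {ℕ.suc n} (true ∷ C)  h = cong₂ _+_ (branch true) (branch false)
    where
    branch : ∀ b → sumOverSubsets (h ∘ (b ∷_)) ≡
      sumOverSubsets (λ c → 𝟙 (c ⊆ᵇ C) *
        (sumOverSubsets {n} (λ _ → 0ℤ) + sumOverSubsets (λ τ → 𝟙 (disjointᵇ τ C) * h (b ∷ (τ ∪ c)))))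
    branch b = trans (sum-split C (h ∘ (b ∷_))) (sum-cong λ c → cong (𝟙 (c ⊆ᵇ C) *_)
      (sym (sum-zero-+ n _)))
  sum-split {ℕ.suc n} (false ∷ C) h = trans
    (cong₂ _+_ (sum-split C (h ∘ (true ∷_))) (sum-split C (h ∘ (false ∷_))))
    (trans (sym (sum-+ (term true) (term false)))
    (trans (sum-cong λ c → sym (*-distribˡ-+ (𝟙 (c ⊆ᵇ C)) (inner true c) (inner false c)))
           (sym (sum-zero-+ n _))))
    where
    inner term : Bool → Subset n → ℤ
    inner b c = sumOverSubsets (λ τ → 𝟙 (disjointᵇ τ C) * h (b ∷ (τ ∪ c)))
    term b c  = 𝟙 (c ⊆ᵇ C) * inner b c

-- Transfer from one row of the grid to the next

module Transfer where
  open import Data.Fin.Base using (zero; suc)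
  open import Data.Fin.Subset.Properties using (∪-assoc)
  open import Data.Integer.Base using (_*_)
  open import Data.Integer.Properties using (*-zeroʳ)
  open import Data.Vec.Properties using ([]=⇒lookup; lookup⇒[]=)
  open SubsetSums

  module _ (H : Graph) where
    open Graph H using (_∼_; sym-∼) renaming (order to n)

    independentᵇ : Subset n → Bool
    independentᵇ σ = does (SimplicialComplex.face? (Ind H) σ)

    independentᵇ-elim : ∀ σ → independentᵇ σ ≡ true → ∀ x y → σ ∋ x → σ ∋ y → ¬ x ∼ y
    independentᵇ-elim σ e x y p q =
      does-elim (SimplicialComplex.face? (Ind H) σ) e x y (lookup⇒[]= x σ p) (lookup⇒[]= y σ q)

    independentᵇ-intro : ∀ σ → (∀ x y → σ ∋ x → σ ∋ y → ¬ x ∼ y) → independentᵇ σ ≡ true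
    independentᵇ-intro σ f = dec-true (SimplicialComplex.face? (Ind H) σ)
      λ x y p q → f x y ([]=⇒lookup p) ([]=⇒lookup q)

    -- F m R is Z of P_m × H with the vertices of R deleted from the first row;
    -- G m A B is Z of P_{m+1} × H with the first row cut down to A and the
    -- vertices of B deleted from the second row.
    F : ℕ → Subset n → ℤ
    F ℕ.zero    R = 1ℤ
    F (ℕ.suc m) R = sumOverSubsets λ τ →
      𝟙 (independentᵇ τ ∧ disjointᵇ τ R) * (sgn τ * F m τ)

    G : ℕ → Subset n → Subset n → ℤ
    G m A B = sumOverSubsets λ σ →
      𝟙 (independentᵇ σ ∧ σ ⊆ᵇ A) * (sgn σ * F m (σ ∪ B))

    -- The first row is A, each of whose vertices then has a single neighbour, in the
    -- second row.  By inclusion–exclusion only the sets containing all of these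
    -- neighbours contribute.
    G-step : ∀ m A B A′ →
      (∀ x y → A ∋ x → A ∋ y → ¬ x ∼ y) →
      (∀ x → A ∋ x → ¬ B ∋ x) →
      (∀ x → A′ ∋ x → ¬ A ∋ x × ¬ B ∋ x × (∀ y → A ∋ y → ¬ x ∼ y)) →
      (∀ x → ¬ A ∋ x → ¬ B ∋ x → (∀ y → A ∋ y → ¬ x ∼ y) → A′ ∋ x) →
      G (ℕ.suc m) A B ≡ sgn A * G m A′ A
    G-step m A B A′ nonadj A∩B A′-elim A′-intro = begin
      G (ℕ.suc m) A B
        ≡⟨ sum-cong (λ σ → trans (assoc (𝟙 (i σ ∧ σ ⊆ᵇ A)) (sgn σ) _) (sym (sum-* {n} (𝟙 (i σ ∧ σ ⊆ᵇ A) * sgn σ) _))) ⟩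
      sumOverSubsets (λ σ → sumOverSubsets λ τ →
        𝟙 (i σ ∧ σ ⊆ᵇ A) * sgn σ * (𝟙 (i τ ∧ disjointᵇ τ (σ ∪ B)) * w τ))
        ≡⟨ sum-swap {n} {n} _ ⟩
      sumOverSubsets (λ τ → sumOverSubsets λ σ →
        𝟙 (i σ ∧ σ ⊆ᵇ A) * sgn σ * (𝟙 (i τ ∧ disjointᵇ τ (σ ∪ B)) * w τ))
        ≡⟨ sum-cong (λ τ → trans (sum-cong (λ σ → regroup σ τ)) (sum-* {n} (r τ) _)) ⟩
      sumOverSubsets (λ τ → r τ * sumOverSubsets λ σ → 𝟙 (σ ⊆ᵇ A ∧ disjointᵇ σ τ) * sgn σ)
        ≡⟨ sum-cong (λ τ → trans (cong (r τ *_) (sum-sgn A τ)) (comm (r τ) _)) ⟩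
      sumOverSubsets (λ τ → 𝟙 (A ⊆ᵇ τ) * r τ)
        ≡⟨ sum-superset A r ⟩
      sumOverSubsets (λ τ → 𝟙 (disjointᵇ τ A) * r (τ ∪ A))
        ≡⟨ sum-cong pull-sign ⟩
      sumOverSubsets (λ τ → sgn A * (𝟙 (i τ ∧ τ ⊆ᵇ A′) * (sgn τ * F m (τ ∪ A))))
        ≡⟨ sum-* {n} (sgn A) _ ⟩
      sgn A * G m A′ A ∎
      where
      open ≡-Reasoning
      i = independentᵇ
      w r : Subset n → ℤ
      w τ = sgn τ * F m τ
      r τ = 𝟙 (i τ ∧ disjointᵇ τ B) * w τ

      assoc : ∀ a b c → a * (b * c) ≡ a * b * c
      assoc = solve-∀
      comm : ∀ a b → a * b ≡ b * a
      comm = solve-∀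

      -- Every subset of A is independent, since A contains no edge, and avoiding σ ∪ B means
      -- avoiding σ and avoiding B. Afterwards σ occurs in the second factor only, as `sum-sgn`
      -- requires.
      conditions : ∀ σ τ → (i σ ∧ σ ⊆ᵇ A) ∧ (i τ ∧ disjointᵇ τ (σ ∪ B)) ≡
                           (i τ ∧ disjointᵇ τ B) ∧ (σ ⊆ᵇ A ∧ disjointᵇ σ τ)
      conditions σ τ = bool-ext
        (λ e → let (p , q) = ∧-split {i σ ∧ σ ⊆ᵇ A} e
                   (_ , σ⊆A) = ∧-split {i σ} p
                   (iτ , dis) = ∧-split {i τ} q in
          ∧-join (∧-join iτ (disjointᵇ-intro τ B λ x x∈τ x∈B → disjointᵇ-elim τ (σ ∪ B) dis x x∈τ
                    (trans (∪-∋ σ B x) (∨-right (lookup σ x) x∈B))))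
                 (∧-join σ⊆A (disjointᵇ-intro σ τ λ x x∈σ x∈τ → disjointᵇ-elim τ (σ ∪ B) dis x x∈τ
                    (trans (∪-∋ σ B x) (∨-left (lookup B x) x∈σ)))))
        (λ e → let (p , q) = ∧-split {i τ ∧ disjointᵇ τ B} e
                   (iτ , τB) = ∧-split {i τ} p
                   (σ⊆A , στ) = ∧-split {σ ⊆ᵇ A} q in
          ∧-join (∧-join (independentᵇ-intro σ λ x y x∈σ y∈σ →
                            nonadj x y (⊆ᵇ-elim σ A σ⊆A x x∈σ) (⊆ᵇ-elim σ A σ⊆A y y∈σ)) σ⊆A)
                 (∧-join iτ (disjointᵇ-intro τ (σ ∪ B) λ x x∈τ x∈∪ →
                    ∨-case (λ x∈σ → disjointᵇ-elim σ τ στ x x∈σ x∈τ)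
                           (disjointᵇ-elim τ B τB x x∈τ)
                           (trans (sym (∪-∋ σ B x)) x∈∪))))

      regroup : ∀ σ τ → 𝟙 (i σ ∧ σ ⊆ᵇ A) * sgn σ * (𝟙 (i τ ∧ disjointᵇ τ (σ ∪ B)) * w τ) ≡
                        r τ * (𝟙 (σ ⊆ᵇ A ∧ disjointᵇ σ τ) * sgn σ)
      regroup σ τ = begin
        𝟙 p * sgn σ * (𝟙 q * w τ)     ≡⟨ shuffle (𝟙 p) (sgn σ) (𝟙 q) (w τ) ⟩
        (𝟙 p * 𝟙 q) * (w τ * sgn σ)   ≡⟨ cong (_* (w τ * sgn σ)) (𝟙-∧ p q) ⟨
        𝟙 (p ∧ q) * (w τ * sgn σ)     ≡⟨ cong (λ b → 𝟙 b * (w τ * sgn σ)) (conditions σ τ) ⟩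
        𝟙 (p′ ∧ q′) * (w τ * sgn σ)   ≡⟨ cong (_* (w τ * sgn σ)) (𝟙-∧ p′ q′) ⟩
        (𝟙 p′ * 𝟙 q′) * (w τ * sgn σ) ≡⟨ shuffle′ (𝟙 p′) (w τ) (𝟙 q′) (sgn σ) ⟨
        𝟙 p′ * w τ * (𝟙 q′ * sgn σ)   ∎
        where
        p  = i σ ∧ σ ⊆ᵇ A
        q  = i τ ∧ disjointᵇ τ (σ ∪ B)
        p′ = i τ ∧ disjointᵇ τ B
        q′ = σ ⊆ᵇ A ∧ disjointᵇ σ τ
        shuffle : ∀ a b c d → a * b * (c * d) ≡ (a * c) * (d * b)
        shuffle = solve-∀
        shuffle′ : ∀ a b c d → a * b * (c * d) ≡ (a * c) * (b * d)
        shuffle′ = solve-∀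

      -- The surviving sets contain all of A and are written τ ∪ A. As A avoids B and has no edge,
      -- only conditions on τ remain, and these are the ones that define A′.
      new-row : ∀ τ → disjointᵇ τ A ∧ (i (τ ∪ A) ∧ disjointᵇ (τ ∪ A) B) ≡ i τ ∧ τ ⊆ᵇ A′
      new-row τ = bool-ext
        (λ e → let (τA , q) = ∧-split {disjointᵇ τ A} e
                   (ind , dis) = ∧-split {i (τ ∪ A)} q
                   left = λ {x} (x∈τ : τ ∋ x) → trans (∪-∋ τ A x) (∨-left (lookup A x) x∈τ)
                   right = λ {x} (x∈A : A ∋ x) → trans (∪-∋ τ A x) (∨-right (lookup τ x) x∈A) in
          ∧-join (independentᵇ-intro τ λ x y x∈τ y∈τ →
                    independentᵇ-elim (τ ∪ A) ind x y (left x∈τ) (left y∈τ))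
                 (⊆ᵇ-intro τ A′ λ x x∈τ → A′-intro x (disjointᵇ-elim τ A τA x x∈τ)
                    (disjointᵇ-elim (τ ∪ A) B dis x (left x∈τ))
                    λ y y∈A → independentᵇ-elim (τ ∪ A) ind x y (left x∈τ) (right y∈A)))
        (λ e → let (ind , τ⊆A′) = ∧-split {i τ} e
                   A′∋ = λ {x} (x∈τ : τ ∋ x) → A′-elim x (⊆ᵇ-elim τ A′ τ⊆A′ x x∈τ) in
          ∧-join (disjointᵇ-intro τ A λ x x∈τ → proj₁ (A′∋ x∈τ))
          (∧-join (independentᵇ-intro (τ ∪ A) λ x y x∈ y∈ →
                    ∨-case (λ x∈τ → ∨-case (independentᵇ-elim τ ind x y x∈τ)
                                           (proj₂ (proj₂ (A′∋ x∈τ)) y) (trans (sym (∪-∋ τ A y)) y∈))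
                           (λ x∈A → ∨-case (λ y∈τ x∼y → proj₂ (proj₂ (A′∋ y∈τ)) x x∈A (sym-∼ x∼y))
                                           (nonadj x y x∈A) (trans (sym (∪-∋ τ A y)) y∈))
                           (trans (sym (∪-∋ τ A x)) x∈))
                  (disjointᵇ-intro (τ ∪ A) B λ x x∈ →
                    ∨-case (λ x∈τ → proj₁ (proj₂ (A′∋ x∈τ))) (A∩B x) (trans (sym (∪-∋ τ A x)) x∈))))

      pull-sign : ∀ τ → 𝟙 (disjointᵇ τ A) * r (τ ∪ A) ≡
                        sgn A * (𝟙 (i τ ∧ τ ⊆ᵇ A′) * (sgn τ * F m (τ ∪ A)))
      pull-sign τ with disjointᵇ τ A in e | new-row τ
      ... | false | new = trans (sym (*-zeroʳ (sgn A)))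
        (cong (λ b → sgn A * (𝟙 b * (sgn τ * F m (τ ∪ A)))) new)
      ... | true  | new = begin
        1ℤ * (𝟙 (i (τ ∪ A) ∧ disjointᵇ (τ ∪ A) B) * (sgn (τ ∪ A) * F m (τ ∪ A)))
          ≡⟨ cong₂ (λ b s → 1ℤ * (𝟙 b * (s * F m (τ ∪ A)))) new (sgn-∪ τ A e) ⟩
        1ℤ * (𝟙 (i τ ∧ τ ⊆ᵇ A′) * (sgn τ * sgn A * F m (τ ∪ A)))
          ≡⟨ shuffle (𝟙 (i τ ∧ τ ⊆ᵇ A′)) (sgn τ) (sgn A) (F m (τ ∪ A)) ⟩
        sgn A * (𝟙 (i τ ∧ τ ⊆ᵇ A′) * (sgn τ * F m (τ ∪ A))) ∎
        where
        shuffle : ∀ a b c d → 1ℤ * (a * (b * c * d)) ≡ c * (a * (b * d))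
        shuffle = solve-∀

    -- Sorting the independent sets by their trace c on C.
    G-split : ∀ m A B C (A′ : Subset n → Subset n) →
      (∀ x → C ∋ x → A ∋ x) →
      (∀ x y → C ∋ x → C ∋ y → ¬ x ∼ y) →
      (∀ c → (∀ x → c ∋ x → C ∋ x) →
         (∀ x → A′ c ∋ x → A ∋ x × ¬ C ∋ x × (∀ y → c ∋ y → ¬ x ∼ y))
         × (∀ x → A ∋ x → ¬ C ∋ x → (∀ y → c ∋ y → ¬ x ∼ y) → A′ c ∋ x)) →
      G m A B ≡ sumOverSubsets λ c → 𝟙 (c ⊆ᵇ C) * (sgn c * G m (A′ c) (c ∪ B))
    G-split m A B C A′ C⊆A nonadj A′-spec = trans
      (sum-split C (λ σ → 𝟙 (i σ ∧ σ ⊆ᵇ A) * (sgn σ * F m (σ ∪ B))))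
      (sum-cong λ c → restrict c)
      where
      open ≡-Reasoning
      i = independentᵇ

      -- As c lies in C, an edgeless subset of A, the conditions on τ ∪ c turn into conditions on τ
      -- alone: independence, and avoidance of the neighbours of c, which `A′ c` encodes.
      conditions : ∀ c → c ⊆ᵇ C ≡ true → ∀ τ →
        disjointᵇ τ C ∧ (i (τ ∪ c) ∧ (τ ∪ c) ⊆ᵇ A) ≡ i τ ∧ τ ⊆ᵇ A′ c
      conditions c c⊆C τ = bool-ext
        (λ e → let (τC , q) = ∧-split {disjointᵇ τ C} e
                   (ind , sub) = ∧-split {i (τ ∪ c)} q
                   left = λ {x} (x∈τ : τ ∋ x) → trans (∪-∋ τ c x) (∨-left (lookup c x) x∈τ)
                   right = λ {x} (x∈c : c ∋ x) → trans (∪-∋ τ c x) (∨-right (lookup τ x) x∈c) in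
          ∧-join (independentᵇ-intro τ λ x y x∈τ y∈τ →
                    independentᵇ-elim (τ ∪ c) ind x y (left x∈τ) (left y∈τ))
                 (⊆ᵇ-intro τ (A′ c) λ x x∈τ → proj₂ (A′-spec c c⊆) x
                    (⊆ᵇ-elim (τ ∪ c) A sub x (left x∈τ)) (disjointᵇ-elim τ C τC x x∈τ)
                    λ y y∈c → independentᵇ-elim (τ ∪ c) ind x y (left x∈τ) (right y∈c)))
        (λ e → let (ind , sub) = ∧-split {i τ} e
                   A′∋ = λ {x} (x∈τ : τ ∋ x) → proj₁ (A′-spec c c⊆) x (⊆ᵇ-elim τ (A′ c) sub x x∈τ) in
          ∧-join (disjointᵇ-intro τ C λ x x∈τ → proj₁ (proj₂ (A′∋ x∈τ)))
          (∧-join (independentᵇ-intro (τ ∪ c) λ x y x∈ y∈ →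
                    ∨-case (λ x∈τ → ∨-case (independentᵇ-elim τ ind x y x∈τ)
                                           (proj₂ (proj₂ (A′∋ x∈τ)) y) (trans (sym (∪-∋ τ c y)) y∈))
                           (λ x∈c → ∨-case (λ y∈τ x∼y → proj₂ (proj₂ (A′∋ y∈τ)) x x∈c (sym-∼ x∼y))
                                           (λ y∈c → nonadj x y (c⊆ x x∈c) (c⊆ y y∈c))
                                           (trans (sym (∪-∋ τ c y)) y∈))
                           (trans (sym (∪-∋ τ c x)) x∈))
                  (⊆ᵇ-intro (τ ∪ c) A λ x x∈ →
                    ∨-case (λ x∈τ → proj₁ (A′∋ x∈τ)) (λ x∈c → C⊆A x (c⊆ x x∈c))
                           (trans (sym (∪-∋ τ c x)) x∈))))
        where c⊆ = ⊆ᵇ-elim c C c⊆C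

      summand : ∀ c → c ⊆ᵇ C ≡ true → ∀ τ →
        𝟙 (disjointᵇ τ C) * (𝟙 (i (τ ∪ c) ∧ (τ ∪ c) ⊆ᵇ A) * (sgn (τ ∪ c) * F m ((τ ∪ c) ∪ B))) ≡
        sgn c * (𝟙 (i τ ∧ τ ⊆ᵇ A′ c) * (sgn τ * F m (τ ∪ (c ∪ B))))
      summand c c⊆C τ with disjointᵇ τ C in e | conditions c c⊆C τ
      ... | false | new = trans (sym (*-zeroʳ (sgn c)))
        (cong (λ b → sgn c * (𝟙 b * (sgn τ * F m (τ ∪ (c ∪ B))))) new)
      ... | true  | new = begin
        1ℤ * (𝟙 (i (τ ∪ c) ∧ (τ ∪ c) ⊆ᵇ A) * (sgn (τ ∪ c) * F m ((τ ∪ c) ∪ B)))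
          ≡⟨ cong₂ (λ b s → 1ℤ * (𝟙 b * (s * F m ((τ ∪ c) ∪ B)))) new
                   (sgn-∪ τ c (disjointᵇ-intro τ c λ x x∈τ x∈c →
                      disjointᵇ-elim τ C e x x∈τ (⊆ᵇ-elim c C c⊆C x x∈c))) ⟩
        1ℤ * (𝟙 (i τ ∧ τ ⊆ᵇ A′ c) * (sgn τ * sgn c * F m ((τ ∪ c) ∪ B)))
          ≡⟨ shuffle (𝟙 (i τ ∧ τ ⊆ᵇ A′ c)) (sgn τ) (sgn c) (F m ((τ ∪ c) ∪ B)) ⟩
        sgn c * (𝟙 (i τ ∧ τ ⊆ᵇ A′ c) * (sgn τ * F m ((τ ∪ c) ∪ B)))
          ≡⟨ cong (λ ρ → sgn c * (𝟙 (i τ ∧ τ ⊆ᵇ A′ c) * (sgn τ * F m ρ))) (∪-assoc τ c B) ⟩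
        sgn c * (𝟙 (i τ ∧ τ ⊆ᵇ A′ c) * (sgn τ * F m (τ ∪ (c ∪ B)))) ∎
        where
        shuffle : ∀ a b c d → 1ℤ * (a * (b * c * d)) ≡ c * (a * (b * d))
        shuffle = solve-∀

      restrict : ∀ c →
        𝟙 (c ⊆ᵇ C) * sumOverSubsets (λ τ → 𝟙 (disjointᵇ τ C) *
          (𝟙 (i (τ ∪ c) ∧ (τ ∪ c) ⊆ᵇ A) * (sgn (τ ∪ c) * F m ((τ ∪ c) ∪ B)))) ≡
        𝟙 (c ⊆ᵇ C) * (sgn c * G m (A′ c) (c ∪ B))
      restrict c = 𝟙-cong (c ⊆ᵇ C) λ e → trans (sum-cong (summand c e)) (sum-* {n} (sgn c) _)

-- Euler characteristics of grids, row by row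

module GridRows where
  open import Data.Fin.Base using (zero; suc; combine; remQuot; _↑ˡ_)
  open import Data.Fin.Properties using (remQuot-combine; combine-remQuot)
  open import Data.Fin.Subset using (⊥; ⊤; ∣_∣)
  open import Data.Fin.Subset.Properties using (nonempty?; ∪-identityʳ)
  open import Data.Integer.Base using (_+_; _-_; _*_; -_; _^_)
  open import Data.Integer.Properties
    using (*-identityˡ; +-identityˡ; *-zeroʳ; -1*i≡-i)
  open import Data.Vec.Base using (_++_; take; drop)
  open import Data.Vec.Properties
    using ([]=⇒lookup; lookup⇒[]=; lookup-++ˡ; lookup-++ʳ; take++drop≡id; lookup-replicate)
  open SubsetSums
  open Transfer

  emptyᵇ : ∀ {n} → Subset n → Bool
  emptyᵇ []          = true
  emptyᵇ (true  ∷ σ) = false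
  emptyᵇ (false ∷ σ) = emptyᵇ σ

  sum-empty : ∀ n → sumOverSubsets {n} (𝟙 ∘ emptyᵇ) ≡ 1ℤ
  sum-empty ℕ.zero    = refl
  sum-empty (ℕ.suc n) = trans (sum-zero-+ n _) (sum-empty n)

  sgn-^ : ∀ {n} (σ : Subset n) → sgn σ ≡ -1ℤ ^ ∣ σ ∣
  sgn-^ []          = refl
  sgn-^ (true  ∷ σ) = trans (cong -_ (sgn-^ σ)) (sym (-1*i≡-i (-1ℤ ^ ∣ σ ∣)))
  sgn-^ (false ∷ σ) = sgn-^ σ

  empty-true : ∀ {n} (σ : Subset n) → emptyᵇ σ ≡ true → sgn σ ≡ 1ℤ × (∀ x → ¬ σ ∋ x)
  empty-true []          e = refl , λ ()
  empty-true (false ∷ σ) e = proj₁ (empty-true σ e) , λ { zero () ; (suc x) → proj₂ (empty-true σ e) x }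

  empty-false : ∀ {n} (σ : Subset n) → emptyᵇ σ ≡ false →
                sgn σ ≡ - (-1ℤ ^ (∣ σ ∣ ℕ.∸ 1)) × ∃ (σ ∋_)
  empty-false (true  ∷ σ) e = cong -_ (sgn-^ σ) , zero , refl
  empty-false (false ∷ σ) e = let (p , x , q) = empty-false σ e in p , suc x , q

  -- `χ` skips the empty face, which the leading 1 restores, and its exponent is the dimension, one
  -- less than the size, so that subtracting it gives `sgn`.
  Z-sum : ∀ K → Z K ≡ sumOverSubsets λ σ → 𝟙 (independentᵇ K σ) * sgn σ
  Z-sum K = begin
    1ℤ - sumOverSubsets face           ≡⟨ cong₂ _+_ (sym (sum-empty (Graph.order K))) (sym (sum-neg face)) ⟩
    sumOverSubsets {Graph.order K} (𝟙 ∘ emptyᵇ) + sumOverSubsets (λ σ → - face σ)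
                                       ≡⟨ sym (sum-+ (𝟙 ∘ emptyᵇ) (λ σ → - face σ)) ⟩
    sumOverSubsets (λ σ → 𝟙 (emptyᵇ σ) + - face σ)
                                       ≡⟨ sum-cong term ⟩
    sumOverSubsets (λ σ → 𝟙 (independentᵇ K σ) * sgn σ) ∎
    where
    open ≡-Reasoning
    open SimplicialComplex (Ind K) using (face?)
    face : Subset (Graph.order K) → ℤ
    face σ = if does (nonempty? σ ×-dec face? σ) then -1ℤ ^ (∣ σ ∣ ℕ.∸ 1) else 0ℤ

    term : ∀ σ → 𝟙 (emptyᵇ σ) + - face σ ≡ 𝟙 (independentᵇ K σ) * sgn σ
    term σ with emptyᵇ σ in e
    ... | true rewrite independentᵇ-intro K σ (λ x y x∈σ → ⊥-elim (proj₂ (empty-true σ e) x x∈σ))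
                     | dec-false (nonempty? σ) (λ (x , x∈σ) → proj₂ (empty-true σ e) x ([]=⇒lookup x∈σ))
                     | proj₁ (empty-true σ e) = refl
    ... | false rewrite dec-true (nonempty? σ) (let (x , x∈σ) = proj₂ (empty-false σ e) in x , lookup⇒[]= x σ x∈σ)
                      | proj₁ (empty-false σ e) with does (face? σ)
    ...   | true  = trans (+-identityˡ _) (sym (*-identityˡ _))
    ...   | false = refl

  -- Vertices of a product are addressed by `combine`, the inverse of the `remQuot` in the
  -- definition of adjacency.
  □-independent-elim : ∀ G H σ → independentᵇ (G □ H) σ ≡ true → ∀ i j i′ j′ →
    σ ∋ combine i j → σ ∋ combine i′ j′ →
    ¬ ((i ≡ i′ × Graph._∼_ H j j′) ⊎ (Graph._∼_ G i i′ × j ≡ j′))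
  □-independent-elim G H σ e i j i′ j′ p q adj =
    independentᵇ-elim (G □ H) σ e (combine i j) (combine i′ j′) p q
      (subst₂ (λ a b → (proj₁ a ≡ proj₁ b × Graph._∼_ H (proj₂ a) (proj₂ b))
                     ⊎ (Graph._∼_ G (proj₁ a) (proj₁ b) × proj₂ a ≡ proj₂ b))
              (sym (remQuot-combine i j)) (sym (remQuot-combine i′ j′)) adj)

  □-independent-intro : ∀ G H σ → (∀ i j i′ j′ →
    σ ∋ combine i j → σ ∋ combine i′ j′ →
    ¬ ((i ≡ i′ × Graph._∼_ H j j′) ⊎ (Graph._∼_ G i i′ × j ≡ j′))) → independentᵇ (G □ H) σ ≡ true
  □-independent-intro G H σ f = independentᵇ-intro (G □ H) σ λ x y p q →
    f _ _ _ _ (at x p) (at y q)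
    where
    at : ∀ x → σ ∋ x → σ ∋ combine (proj₁ (remQuot {Graph.order G} (Graph.order H) x))
                                   (proj₂ (remQuot {Graph.order G} (Graph.order H) x))
    at x p = trans (cong (lookup σ) (combine-remQuot {Graph.order G} (Graph.order H) x)) p

  sgn-++ : ∀ {m n} (ρ : Subset m) (σ : Subset n) → sgn (ρ ++ σ) ≡ sgn ρ * sgn σ
  sgn-++ []          σ = sym (*-identityˡ (sgn σ))
  sgn-++ (true  ∷ ρ) σ = trans (cong -_ (sgn-++ ρ σ)) (lemma (sgn ρ) (sgn σ))
    where
    lemma : ∀ a b → - (a * b) ≡ - a * b
    lemma = solve-∀
  sgn-++ (false ∷ ρ) σ = sgn-++ ρ σ

  take-++ : ∀ {m n} (ρ : Subset m) (σ : Subset n) → take m (ρ ++ σ) ≡ ρ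
  take-++ []      σ = refl
  take-++ (x ∷ ρ) σ = cong (x ∷_) (take-++ ρ σ)

  module _ (H : Graph) where
    open Graph H using (_∼_) renaming (order to n)

    firstRowAvoids : ∀ m → Subset (m ℕ.* n) → Subset n → Bool
    firstRowAvoids ℕ.zero    σ R = true
    firstRowAvoids (ℕ.suc m) σ R = disjointᵇ (take n σ) R

    lookup-take : ∀ {k} (σ : Subset (n ℕ.+ k)) j → lookup (take n σ) j ≡ lookup σ (j ↑ˡ k)
    lookup-take {k} σ j = trans (sym (lookup-++ˡ (take n σ) (drop n σ) j))
                                (cong (λ v → lookup v (j ↑ˡ k)) (take++drop≡id n σ))

    first-elim : ∀ m σ R → firstRowAvoids m σ R ≡ true →
                 ∀ (i : Fin m) j → toℕ i ≡ 0 → σ ∋ combine i j → ¬ R ∋ j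
    first-elim (ℕ.suc m) σ R e zero j _ p = disjointᵇ-elim (take n σ) R e j (trans (lookup-take σ j) p)

    first-intro : ∀ m σ R → (∀ (i : Fin m) j → toℕ i ≡ 0 → σ ∋ combine i j → ¬ R ∋ j) →
                  firstRowAvoids m σ R ≡ true
    first-intro ℕ.zero    σ R f = refl
    first-intro (ℕ.suc m) σ R f = disjointᵇ-intro (take n σ) R λ j p →
      f zero j refl (trans (sym (lookup-take σ j)) p)

    -- The initial vertex of the path is adjacent only to the next one, so the remaining rows form a
    -- shorter grid that feels ρ only through its own first row.
    rows : ∀ m ρ σ → independentᵇ (path (ℕ.suc m) □ H) (ρ ++ σ) ≡
           independentᵇ H ρ ∧ (independentᵇ (path m □ H) σ ∧ firstRowAvoids m σ ρ)
    rows m ρ σ = bool-ext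
      (λ e → let el = □-independent-elim (path (ℕ.suc m)) H (ρ ++ σ) e in
        ∧-join (independentᵇ-intro H ρ λ j j′ p q j∼j′ →
                  el zero j zero j′ (bottom p) (bottom q) (inj₁ (refl , j∼j′)))
        (∧-join (□-independent-intro (path m) H σ λ i j i′ j′ p q →
                  λ { (inj₁ (i≡i′ , a)) → el (suc i) j (suc i′) j′ (upper i p) (upper i′ q) (inj₁ (cong suc i≡i′ , a))
                    ; (inj₂ (inj₁ a , j≡j′)) → el (suc i) j (suc i′) j′ (upper i p) (upper i′ q) (inj₂ (inj₁ (cong ℕ.suc a) , j≡j′))
                    ; (inj₂ (inj₂ a , j≡j′)) → el (suc i) j (suc i′) j′ (upper i p) (upper i′ q) (inj₂ (inj₂ (cong ℕ.suc a) , j≡j′)) })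
                (first-intro m σ ρ λ i j i≡0 p q →
                  el zero j (suc i) j (bottom q) (upper i p) (inj₂ (inj₁ (cong ℕ.suc (sym i≡0)) , refl)))))
      (λ e → let (ind , e′) = ∧-split {independentᵇ H ρ} e
                 (indσ , first) = ∧-split {independentᵇ (path m □ H) σ} e′
                 el = □-independent-elim (path m) H σ indσ
                 av = first-elim m σ ρ first in
        □-independent-intro (path (ℕ.suc m)) H (ρ ++ σ) λ
          { zero j zero j′ p q (inj₁ (_ , a)) → independentᵇ-elim H ρ ind j j′ (bottom⁻ p) (bottom⁻ q) a
          ; zero j zero j′ p q (inj₂ (inj₁ () , _))
          ; zero j zero j′ p q (inj₂ (inj₂ () , _))
          ; zero j (suc i) j′ p q (inj₂ (inj₁ a , j≡j′)) →
              av i j′ (sym (ℕ.suc-injective a)) (upper⁻ i q) (subst (ρ ∋_) j≡j′ (bottom⁻ p))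
          ; (suc i) j zero j′ p q (inj₂ (inj₂ a , j≡j′)) →
              av i j (sym (ℕ.suc-injective a)) (upper⁻ i p) (subst (ρ ∋_) (sym j≡j′) (bottom⁻ q))
          ; (suc i) j (suc .i) j′ p q (inj₁ (refl , a)) → el i j i j′ (upper⁻ i p) (upper⁻ i q) (inj₁ (refl , a))
          ; (suc i) j (suc i′) j′ p q (inj₂ (inj₁ a , j≡j′)) →
              el i j i′ j′ (upper⁻ i p) (upper⁻ i′ q) (inj₂ (inj₁ (ℕ.suc-injective a) , j≡j′))
          ; (suc i) j (suc i′) j′ p q (inj₂ (inj₂ a , j≡j′)) →
              el i j i′ j′ (upper⁻ i p) (upper⁻ i′ q) (inj₂ (inj₂ (ℕ.suc-injective a) , j≡j′)) })
      where
      bottom : ∀ {j} → ρ ∋ j → (ρ ++ σ) ∋ (combine {ℕ.suc m} zero j)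
      bottom {j} = trans (lookup-++ˡ ρ σ j)
      bottom⁻ : ∀ {j} → (ρ ++ σ) ∋ (combine {ℕ.suc m} zero j) → ρ ∋ j
      bottom⁻ {j} = trans (sym (lookup-++ˡ ρ σ j))
      upper : ∀ {j} (i : Fin m) → σ ∋ combine i j → (ρ ++ σ) ∋ combine (suc i) j
      upper {j} i = trans (lookup-++ʳ ρ σ (combine i j))
      upper⁻ : ∀ {j} (i : Fin m) → (ρ ++ σ) ∋ combine (suc i) j → σ ∋ combine i j
      upper⁻ {j} i = trans (sym (lookup-++ʳ ρ σ (combine i j)))

    F-grid : ∀ m R → F H m R ≡
      sumOverSubsets λ σ → 𝟙 (independentᵇ (path m □ H) σ ∧ firstRowAvoids m σ R) * sgn σ
    F-grid ℕ.zero    R rewrite independentᵇ-intro (path 0 □ H) [] (λ ()) = refl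
    F-grid (ℕ.suc m) R = sym (begin
      sumOverSubsets {n ℕ.+ m ℕ.* n} (λ σ → 𝟙 (independentᵇ (path (ℕ.suc m) □ H) σ ∧ disjointᵇ (take n σ) R) * sgn σ)
        ≡⟨ sum-++ {n} _ ⟩
      sumOverSubsets {n} (λ ρ → sumOverSubsets {m ℕ.* n} λ σ →
        𝟙 (independentᵇ (path (ℕ.suc m) □ H) (ρ ++ σ) ∧ disjointᵇ (take n (ρ ++ σ)) R) * sgn (ρ ++ σ))
        ≡⟨ sum-cong (λ ρ → trans (sum-cong (term ρ)) (sum-* {m ℕ.* n} (𝟙 (independentᵇ H ρ ∧ disjointᵇ ρ R) * sgn ρ) _)) ⟩
      sumOverSubsets (λ ρ → 𝟙 (independentᵇ H ρ ∧ disjointᵇ ρ R) * sgn ρ *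
        sumOverSubsets λ σ → 𝟙 (independentᵇ (path m □ H) σ ∧ firstRowAvoids m σ ρ) * sgn σ)
        ≡⟨ sum-cong (λ ρ → trans (cong (𝟙 (independentᵇ H ρ ∧ disjointᵇ ρ R) * sgn ρ *_) (sym (F-grid m ρ)))
                                 (assoc (𝟙 (independentᵇ H ρ ∧ disjointᵇ ρ R)) (sgn ρ) (F H m ρ))) ⟩
      F H (ℕ.suc m) R ∎)
      where
      open ≡-Reasoning
      assoc : ∀ a b c → a * b * c ≡ a * (b * c)
      assoc = solve-∀

      term : ∀ ρ σ →
        𝟙 (independentᵇ (path (ℕ.suc m) □ H) (ρ ++ σ) ∧ disjointᵇ (take n (ρ ++ σ)) R) * sgn (ρ ++ σ) ≡
        𝟙 (independentᵇ H ρ ∧ disjointᵇ ρ R) * sgn ρ *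
          (𝟙 (independentᵇ (path m □ H) σ ∧ firstRowAvoids m σ ρ) * sgn σ)
      term ρ σ rewrite rows m ρ σ | take-++ ρ σ | sgn-++ ρ σ
        with independentᵇ H ρ | independentᵇ (path m □ H) σ ∧ firstRowAvoids m σ ρ | disjointᵇ ρ R
      ... | false | _     | _     = refl
      ... | true  | false | true  = sym (*-zeroʳ (1ℤ * sgn ρ))
      ... | true  | false | false = refl
      ... | true  | true  | false = refl
      ... | true  | true  | true  = units (sgn ρ) (sgn σ)
        where
        units : ∀ a b → 1ℤ * (a * b) ≡ 1ℤ * a * (1ℤ * b)
        units = solve-∀

    Z-grid : ∀ m → Z (path m □ H) ≡ F H m ⊥
    Z-grid m = trans (Z-sum (path m □ H)) (trans
      (sum-cong λ σ → cong (λ b → 𝟙 b * sgn σ) (trans (sym (∧-identityʳ _))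
         (cong (independentᵇ (path m □ H) σ ∧_)
           (sym (first-intro m σ ⊥ λ i j _ _ j∈⊥ → absurd (trans (sym (lookup-replicate j false)) j∈⊥))))))
      (sym (F-grid m ⊥)))
      where
      open import Data.Bool.Properties using (∧-identityʳ)
      absurd : ¬ (false ≡ true)
      absurd ()

    -- `G` presupposes a first row, so its series starts with the grid of one row. This is why `f`
    -- is controlled only from the coefficient of index 1 on, which suffices for a polynomial
    -- numerator.
    Z-grid-suc : ∀ m → Z (path (ℕ.suc m) □ H) ≡ G H m ⊤ ⊥
    Z-grid-suc m = trans (Z-grid (ℕ.suc m)) (sum-cong λ σ →
      cong₂ (λ b τ → 𝟙 (independentᵇ H σ ∧ b) * (sgn σ * F H m τ))
            (trans (disjointᵇ-intro σ ⊥ (λ x _ x∈⊥ → absurd (trans (sym (lookup-replicate x false)) x∈⊥)))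
                   (sym (⊆ᵇ-intro σ ⊤ λ x _ → lookup-replicate x true)))
            (sym (∪-identityʳ σ)))
      where
      absurd : ¬ (false ≡ true)
      absurd ()

-- Symmetries of the circle and periodic predicates on the integers

module Circle where
  open import Data.Fin.Base using (zero; suc; fromℕ; inject₁; opposite)
  open import Data.Fin.Properties
    using (toℕ-injective; toℕ-fromℕ; toℕ-inject₁; toℕ<n; opposite-prop; opposite-involutive)
  open import Data.Fin.Relation.Unary.Top using (view; ‵fromℕ; ‵inject₁; view-fromℕ; view-inject₁)
  open import Data.Integer.Base using (_+_; _-_; _*_; -_)
  open import Data.Vec.Base using (_∷ʳ_; initLast)
  open import Data.Vec.Properties using (lookup∘tabulate; tabulate-cong; tabulate∘lookup)
  open SubsetSums
  open Transfer

  lookup-ext : ∀ {n} {A : Set} (u v : Vec A n) → (∀ i → lookup u i ≡ lookup v i) → u ≡ v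
  lookup-ext u v e = trans (sym (tabulate∘lookup u)) (trans (tabulate-cong e) (tabulate∘lookup v))

  module Automorphism (H : Graph)
    (π : Fin (Graph.order H) → Fin (Graph.order H))
    (π-surjective : ∀ i → ∃ λ j → π j ≡ i)
    (π-preserves : ∀ i j → Graph._∼_ H i j → Graph._∼_ H (π i) (π j))
    (π-reflects : ∀ i j → Graph._∼_ H (π i) (π j) → Graph._∼_ H i j) where

    open Graph H using (_∼_) renaming (order to n)

    act : Subset n → Subset n
    act σ = tabulate (lookup σ ∘ π)

    -- Invariance of sums and signs is a hypothesis here; it is verified for the two symmetries
    -- used, rotation by one place and reflection, by recursion on the vector.
    module _ (act-sum : ∀ (g : Subset n → ℤ) → sumOverSubsets (g ∘ act) ≡ sumOverSubsets g)
             (act-sgn : ∀ σ → sgn (act σ) ≡ sgn σ) where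

      lookup-act : ∀ σ i → lookup (act σ) i ≡ lookup σ (π i)
      lookup-act σ = lookup∘tabulate (lookup σ ∘ π)

      act-∪ : ∀ σ τ → act σ ∪ act τ ≡ act (σ ∪ τ)
      act-∪ σ τ = lookup-ext _ _ λ i → trans (∪-∋ (act σ) (act τ) i)
        (trans (cong₂ _∨_ (lookup-act σ i) (lookup-act τ i))
        (trans (sym (∪-∋ σ τ (π i))) (sym (lookup-act (σ ∪ τ) i))))

      act-independent : ∀ σ → independentᵇ H (act σ) ≡ independentᵇ H σ
      act-independent σ = bool-ext
        (λ e → independentᵇ-intro H σ λ x y x∈ y∈ x∼y →
          let (x′ , p) = π-surjective x
              (y′ , q) = π-surjective y
          in independentᵇ-elim H (act σ) e x′ y′
               (trans (lookup-act σ x′) (trans (cong (lookup σ) p) x∈))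
               (trans (lookup-act σ y′) (trans (cong (lookup σ) q) y∈))
               (π-reflects x′ y′ (subst₂ _∼_ (sym p) (sym q) x∼y)))
        (λ e → independentᵇ-intro H (act σ) λ x y x∈ y∈ x∼y →
          independentᵇ-elim H σ e (π x) (π y)
            (trans (sym (lookup-act σ x)) x∈) (trans (sym (lookup-act σ y)) y∈) (π-preserves x y x∼y))

      act-⊆ : ∀ σ τ → act σ ⊆ᵇ act τ ≡ σ ⊆ᵇ τ
      act-⊆ σ τ = bool-ext
        (λ e → ⊆ᵇ-intro σ τ λ x x∈ → let (x′ , p) = π-surjective x in
          subst (τ ∋_) p (trans (sym (lookup-act τ x′))
            (⊆ᵇ-elim (act σ) (act τ) e x′ (trans (lookup-act σ x′) (trans (cong (lookup σ) p) x∈)))))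
        (λ e → ⊆ᵇ-intro (act σ) (act τ) λ x x∈ →
          trans (lookup-act τ x) (⊆ᵇ-elim σ τ e (π x) (trans (sym (lookup-act σ x)) x∈)))

      act-disjoint : ∀ σ τ → disjointᵇ (act σ) (act τ) ≡ disjointᵇ σ τ
      act-disjoint σ τ = bool-ext
        (λ e → disjointᵇ-intro σ τ λ x x∈σ x∈τ → let (x′ , p) = π-surjective x in
          disjointᵇ-elim (act σ) (act τ) e x′
            (trans (lookup-act σ x′) (trans (cong (lookup σ) p) x∈σ))
            (trans (lookup-act τ x′) (trans (cong (lookup τ) p) x∈τ)))
        (λ e → disjointᵇ-intro (act σ) (act τ) λ x x∈σ x∈τ →
          disjointᵇ-elim σ τ e (π x) (trans (sym (lookup-act σ x)) x∈σ) (trans (sym (lookup-act τ x)) x∈τ))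

      F-act : ∀ m R → F H m (act R) ≡ F H m R
      F-act ℕ.zero    R = refl
      F-act (ℕ.suc m) R = trans (sym (act-sum _)) (sum-cong λ τ →
        cong₂ _*_ (cong 𝟙 (cong₂ _∧_ (act-independent τ) (act-disjoint τ R)))
                  (cong₂ _*_ (act-sgn τ) (F-act m τ)))

      G-act : ∀ m A B → G H m (act A) (act B) ≡ G H m A B
      G-act m A B = trans (sym (act-sum _)) (sum-cong λ τ →
        cong₂ _*_ (cong 𝟙 (cong₂ _∧_ (act-independent τ) (act-⊆ τ A)))
                  (cong₂ _*_ (act-sgn τ) (trans (cong (F H m) (act-∪ τ B)) (F-act m (τ ∪ B)))))

  next : ∀ {n} → Fin (ℕ.suc n) → Fin (ℕ.suc n)
  next i with view i
  ... | ‵fromℕ     = zero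
  ... | ‵inject₁ j = suc j

  next-fromℕ : ∀ n → next (fromℕ n) ≡ zero
  next-fromℕ n rewrite view-fromℕ n = refl

  next-inject₁ : ∀ {n} (j : Fin n) → next (inject₁ j) ≡ suc j
  next-inject₁ j rewrite view-inject₁ j = refl

  next-surjective : ∀ {n} (i : Fin (ℕ.suc n)) → ∃ λ j → next j ≡ i
  next-surjective {n} zero = fromℕ n , next-fromℕ n
  next-surjective (suc j)  = inject₁ j , next-inject₁ j

  next-injective : ∀ {n} (i j : Fin (ℕ.suc n)) → next i ≡ next j → i ≡ j
  next-injective i j e with view i | view j
  ... | ‵fromℕ     | ‵fromℕ     = refl
  ... | ‵inject₁ k | ‵inject₁ l with refl ← e = refl

  next-≢ : ∀ {n} (i : Fin (ℕ.suc (ℕ.suc n))) → i ≢ next i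
  next-≢ {n} i e with view i
  next-≢ {n} .(fromℕ (ℕ.suc n)) () | ‵fromℕ
  next-≢ .(inject₁ k) e | ‵inject₁ k =
    ℕ.1+n≢n (sym (trans (sym (toℕ-inject₁ k)) (cong toℕ e)))

  module _ {n : ℕ} where
    open Graph (cycle (ℕ.suc n)) using (_∼_)

    ∼⇒next : ∀ i j → i ∼ j → j ≡ next i ⊎ i ≡ next j
    ∼⇒next i j (_ , adj) = Data.Sum.Base.map (go i j) (go j i) adj
      where
      go : ∀ i j → ℕ.suc (toℕ i) ≡ toℕ j ⊎ (ℕ.suc (toℕ i) ≡ ℕ.suc n × toℕ j ≡ 0) → j ≡ next i
      go i j p with view i
      go i j (inj₁ p) | ‵fromℕ =
        ⊥-elim (ℕ.<-irrefl (trans (sym p) (cong ℕ.suc (toℕ-fromℕ n))) (toℕ<n j))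
      go i j (inj₂ (_ , p)) | ‵fromℕ = toℕ-injective p
      go i j (inj₁ p) | ‵inject₁ k = toℕ-injective (trans (sym p) (cong ℕ.suc (toℕ-inject₁ k)))
      go i j (inj₂ (p , _)) | ‵inject₁ k =
        ⊥-elim (ℕ.<-irrefl (trans (sym (toℕ-inject₁ k)) (ℕ.suc-injective p)) (toℕ<n k))

    next⇒∼ : ∀ i j → i ≢ j → j ≡ next i → i ∼ j
    next⇒∼ i j i≢j e = i≢j , inj₁ (subst (λ j → ℕ.suc (toℕ i) ≡ toℕ j ⊎ (ℕ.suc (toℕ i) ≡ ℕ.suc n × toℕ j ≡ 0))
                                    (sym e) (go i))
      where
      go : ∀ i → ℕ.suc (toℕ i) ≡ toℕ (next i) ⊎ (ℕ.suc (toℕ i) ≡ ℕ.suc n × toℕ (next i) ≡ 0)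
      go i with view i
      ... | ‵fromℕ     = inj₂ (cong ℕ.suc (toℕ-fromℕ n) , refl)
      ... | ‵inject₁ k = inj₁ (cong ℕ.suc (toℕ-inject₁ k))

    next-preserves : ∀ i j → i ∼ j → next i ∼ next j
    next-preserves i j i∼j with ∼⇒next i j i∼j
    ... | inj₁ refl = next⇒∼ (next i) (next j) (proj₁ i∼j ∘ next-injective i j) refl
    ... | inj₂ refl = Graph.sym-∼ (cycle (ℕ.suc n))
      (next⇒∼ (next j) (next i) (λ e → proj₁ i∼j (sym (next-injective j i e))) refl)

    next-reflects : ∀ i j → next i ∼ next j → i ∼ j
    next-reflects i j a with ∼⇒next (next i) (next j) a
    ... | inj₁ e = next⇒∼ i j (proj₁ a ∘ cong next) (next-injective j (next i) e)
    ... | inj₂ e = Graph.sym-∼ (cycle (ℕ.suc n))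
      (next⇒∼ j i (λ j≡i → proj₁ a (cong next (sym j≡i))) (next-injective i (next j) e))

    opposite-injective : ∀ {i j : Fin (ℕ.suc n)} → opposite i ≡ opposite j → i ≡ j
    opposite-injective {i} {j} e =
      trans (sym (opposite-involutive i)) (trans (cong opposite e) (opposite-involutive j))

    opposite-next : ∀ (i : Fin (ℕ.suc n)) → opposite i ≡ next (opposite (next i))
    opposite-next i with view i
    ... | ‵fromℕ     = trans (opposite-involutive zero) (sym (next-fromℕ n))
    ... | ‵inject₁ k = trans (opposite-inject₁ k) (sym (next-inject₁ (opposite k)))
      where
      opposite-inject₁ : ∀ {m} (k : Fin m) → opposite (inject₁ k) ≡ suc (opposite k)
      opposite-inject₁ {ℕ.suc m} zero    = refl
      opposite-inject₁ {ℕ.suc m} (suc k) = cong inject₁ (opposite-inject₁ k)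

    opposite-preserves : ∀ i j → i ∼ j → opposite i ∼ opposite j
    opposite-preserves i j i∼j with ∼⇒next i j i∼j
    ... | inj₁ refl = Graph.sym-∼ (cycle (ℕ.suc n))
      (next⇒∼ (opposite j) (opposite i) (λ e → proj₁ i∼j (sym (opposite-injective e))) (opposite-next i))
    ... | inj₂ refl = next⇒∼ (opposite i) (opposite j) (proj₁ i∼j ∘ opposite-injective) (opposite-next j)

    opposite-reflects : ∀ i j → opposite i ∼ opposite j → i ∼ j
    opposite-reflects i j a = subst₂ _∼_ (opposite-involutive i) (opposite-involutive j)
                                (opposite-preserves (opposite i) (opposite j) a)

  lookup-∷ʳ-inject₁ : ∀ {n} {A : Set} (v : Vec A n) x j → lookup (v ∷ʳ x) (inject₁ j) ≡ lookup v j
  lookup-∷ʳ-inject₁ (y ∷ v) x zero    = refl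
  lookup-∷ʳ-inject₁ (y ∷ v) x (suc j) = lookup-∷ʳ-inject₁ v x j

  lookup-∷ʳ-fromℕ : ∀ {n} {A : Set} (v : Vec A n) x → lookup (v ∷ʳ x) (fromℕ n) ≡ x
  lookup-∷ʳ-fromℕ []      x = refl
  lookup-∷ʳ-fromℕ (y ∷ v) x = lookup-∷ʳ-fromℕ v x

  sgn-∷ʳ : ∀ {n} (σ : Subset n) x → sgn (σ ∷ʳ x) ≡ sgn (x ∷ σ)
  sgn-∷ʳ []          x     = refl
  sgn-∷ʳ (true  ∷ σ) true  = cong -_ (sgn-∷ʳ σ true)
  sgn-∷ʳ (true  ∷ σ) false = cong -_ (sgn-∷ʳ σ false)
  sgn-∷ʳ (false ∷ σ) true  = sgn-∷ʳ σ true
  sgn-∷ʳ (false ∷ σ) false = sgn-∷ʳ σ false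

  rotate-∷ : ∀ {n} x (σ : Subset n) → tabulate (lookup (x ∷ σ) ∘ next) ≡ σ ∷ʳ x
  rotate-∷ x σ = lookup-ext _ _ λ i → trans (lookup∘tabulate (lookup (x ∷ σ) ∘ next) i) (at i)
    where
    at : ∀ i → lookup (x ∷ σ) (next i) ≡ lookup (σ ∷ʳ x) i
    at i with view i
    ... | ‵fromℕ     = sym (lookup-∷ʳ-fromℕ σ x)
    ... | ‵inject₁ j = sym (lookup-∷ʳ-inject₁ σ x j)

  reflect-∷ʳ : ∀ {n} x (σ : Subset n) →
    tabulate (lookup (σ ∷ʳ x) ∘ opposite) ≡ x ∷ tabulate (lookup σ ∘ opposite)
  reflect-∷ʳ x σ = cong₂ _∷_ (lookup-∷ʳ-fromℕ σ x) (tabulate-cong λ i → lookup-∷ʳ-inject₁ σ x (opposite i))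

  -- Rotation moves the first entry to the end, so splitting by the first entry turns into splitting
  -- by the last one.
  rotate-sum : ∀ {n} (g : Subset (ℕ.suc n) → ℤ) →
    sumOverSubsets (λ σ → g (tabulate (lookup σ ∘ next))) ≡ sumOverSubsets g
  rotate-sum g = trans
    (cong₂ _+_ (sum-cong λ σ → cong g (rotate-∷ true σ)) (sum-cong λ σ → cong g (rotate-∷ false σ)))
    (sym (sum-∷ʳ g))

  rotate-sgn : ∀ {n} (σ : Subset (ℕ.suc n)) → sgn (tabulate (lookup σ ∘ next)) ≡ sgn σ
  rotate-sgn (x ∷ σ) = trans (cong sgn (rotate-∷ x σ)) (sgn-∷ʳ σ x)

  reflect-sum : ∀ {n} (g : Subset n → ℤ) →
    sumOverSubsets (λ σ → g (tabulate (lookup σ ∘ opposite))) ≡ sumOverSubsets g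
  reflect-sum {ℕ.zero}  g = refl
  reflect-sum {ℕ.suc n} g = trans (sum-∷ʳ (λ σ → g (tabulate (lookup σ ∘ opposite))))
    (cong₂ _+_ (branch true) (branch false))
    where
    branch : ∀ x → sumOverSubsets (λ σ → g (tabulate (lookup (σ ∷ʳ x) ∘ opposite))) ≡
                   sumOverSubsets (g ∘ (x ∷_))
    branch x = trans (sum-cong λ σ → cong g (reflect-∷ʳ x σ)) (reflect-sum (g ∘ (x ∷_)))

  reflect-sgn : ∀ {n} (σ : Subset n) → sgn (tabulate (lookup σ ∘ opposite)) ≡ sgn σ
  reflect-sgn {ℕ.zero}  [] = refl
  reflect-sgn {ℕ.suc n} σ with initLast σ
  ... | τ , x , refl = trans (cong sgn (reflect-∷ʳ x τ)) (trans (head x) (sym (sgn-∷ʳ τ x)))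
    where
    head : ∀ x → sgn (x ∷ tabulate (lookup τ ∘ opposite)) ≡ sgn (x ∷ τ)
    head true  = cong -_ (reflect-sgn τ)
    head false = reflect-sgn τ

  Periodic : {X : Set} → ℕ → (ℤ → X) → Set
  Periodic N x = ∀ p → x (p + + N) ≡ x p

  -- Sets of vertices are handled as N-periodic predicates on ℤ, the universal cover on which
  -- necklaces live too. The neighbours of p are then `p + 1ℤ` and `p + -1ℤ`, without a special case
  -- where the circle closes.
  window : ∀ N → (ℤ → Bool) → Subset N
  window N x = tabulate λ i → x (+ toℕ i)

  lookup-window : ∀ {N} x i → lookup (window N x) i ≡ x (+ toℕ i)
  lookup-window x = lookup∘tabulate (λ i → x (+ toℕ i))

  window-cong : ∀ {N} {x y : ℤ → Bool} → x ≗ y → window N x ≡ window N y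
  window-cong e = tabulate-cong λ i → e (+ toℕ i)

  next-ℤ : ∀ {n} {X : Set} (x : ℤ → X) → Periodic (ℕ.suc n) x → ∀ (i : Fin (ℕ.suc n)) →
           x (+ toℕ (next i)) ≡ x (+ toℕ i + 1ℤ)
  next-ℤ {n} x per i with view i
  ... | ‵fromℕ     = trans (sym (per 0ℤ)) (cong x (trans (cong +_ (ℕ.+-comm 1 n))
                       (cong (λ k → + k + 1ℤ) (sym (toℕ-fromℕ n)))))
  ... | ‵inject₁ k = cong x (cong +_ (trans (ℕ.+-comm 1 (toℕ k)) (cong (ℕ._+ 1) (sym (toℕ-inject₁ k)))))

  module _ {n : ℕ} where
    private
      N = ℕ.suc n
      H = cycle N

    periodic-shift : {X : Set} {x : ℤ → X} → Periodic N x → ∀ r → Periodic N (λ p → x (p + r))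
    periodic-shift {x = x} per r p = trans (cong x (comm p r (+ N))) (per (p + r))
      where
      comm : ∀ p r s → p + s + r ≡ p + r + s
      comm = solve-∀

    G-shift : ∀ m {x y} → Periodic N x → Periodic N y →
      G H m (window N λ p → x (p + 1ℤ)) (window N λ p → y (p + 1ℤ)) ≡ G H m (window N x) (window N y)
    G-shift m {x} {y} px py = trans
      (cong₂ (G H m) (rotated x px) (rotated y py))
      (Automorphism.G-act H next next-surjective next-preserves next-reflects
         rotate-sum rotate-sgn m (window N x) (window N y))
      where
      rotated : ∀ x → Periodic N x → window N (λ p → x (p + 1ℤ)) ≡ tabulate (lookup (window N x) ∘ next)
      rotated x px = tabulate-cong λ i → sym (trans (lookup-window x (next i)) (next-ℤ x px i))

    G-translate⁺ : ∀ m {x y} → Periodic N x → Periodic N y → ∀ r →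
      G H m (window N λ p → x (p + + r)) (window N λ p → y (p + + r)) ≡ G H m (window N x) (window N y)
    G-translate⁺ m {x} {y} px py ℕ.zero =
      cong₂ (G H m) (window-cong (cong x ∘ ℤ.+-identityʳ)) (window-cong (cong y ∘ ℤ.+-identityʳ))
    G-translate⁺ m {x} {y} px py (ℕ.suc r) = trans
      (cong₂ (G H m) (window-cong (cong x ∘ assoc)) (window-cong (cong y ∘ assoc)))
      (trans (G-shift m (periodic-shift {x = x} px (+ r)) (periodic-shift {x = y} py (+ r)))
             (G-translate⁺ m px py r))
      where
      assoc : ∀ p → p + + ℕ.suc r ≡ (p + 1ℤ) + + r
      assoc p = sym (ℤ.+-assoc p 1ℤ (+ r))

    G-translate : ∀ m {x y} → Periodic N x → Periodic N y → ∀ r →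
      G H m (window N λ p → x (p + r)) (window N λ p → y (p + r)) ≡ G H m (window N x) (window N y)
    G-translate m px py (+ r) = G-translate⁺ m px py r
    -- A negative translation is undone by a positive one.
    G-translate m {x} {y} px py r@(-[1+ k ]) = sym (trans
      (cong₂ (G H m) (window-cong (cong x ∘ back)) (window-cong (cong y ∘ back)))
      (G-translate⁺ m (periodic-shift {x = x} px r) (periodic-shift {x = y} py r) (ℕ.suc k)))
      where
      cancel : ∀ p s → p ≡ p + s + - s
      cancel = solve-∀
      back : ∀ p → p ≡ p + + ℕ.suc k + r
      back p = cancel p (+ ℕ.suc k)

    periodic-reflect : {X : Set} {x : ℤ → X} → Periodic N x → ∀ r → Periodic N (λ p → x (r - p))
    periodic-reflect {x = x} per r p = trans (sym (per (r - (p + + N)))) (cong x (cancel r p (+ N)))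
      where
      cancel : ∀ r p s → r - (p + s) + s ≡ r - p
      cancel = solve-∀

    -- `opposite` is the reflection p ↦ n - p of the circle with n + 1 vertices; any other centre
    -- differs from it by a translation.
    G-reflect : ∀ m {x y} → Periodic N x → Periodic N y → ∀ r →
      G H m (window N λ p → x (r - p)) (window N λ p → y (r - p)) ≡ G H m (window N x) (window N y)
    G-reflect m {x} {y} px py r = trans
      (cong₂ (G H m) (window-cong (cong x ∘ recentre)) (window-cong (cong y ∘ recentre)))
      (trans (G-translate m (periodic-reflect {x = x} px (+ n)) (periodic-reflect {x = y} py (+ n)) (+ n - r))
      (trans (cong₂ (G H m) (reflected x) (reflected y))
             (Automorphism.G-act H opposite (λ i → opposite i , opposite-involutive i)
                opposite-preserves opposite-reflects reflect-sum reflect-sgn m (window N x) (window N y))))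
      where
      lemma : ∀ r p n → r - p ≡ n - (p + (n - r))
      lemma = solve-∀
      recentre : ∀ p → r - p ≡ + n - (p + (+ n - r))
      recentre p = lemma r p (+ n)
      reflected : ∀ x → window N (λ p → x (+ n - p)) ≡ tabulate (lookup (window N x) ∘ opposite)
      reflected x = tabulate-cong λ i → sym (trans (lookup-window x (opposite i)) (cong x
        (trans (cong +_ (opposite-prop i))
        (trans (sym (ℤ.⊖-≥ (ℕ.≤-pred (toℕ<n i)))) (sym (ℤ.m-n≡m⊖n n (toℕ i)))))))

  module _ {n : ℕ} where
    private
      N = ℕ.suc (ℕ.suc n)
    open Graph (cycle N) using (_∼_)

    private
      cancel : ∀ p → p ≡ p + 1ℤ + -1ℤ
      cancel = solve-∀

    avoids-neighbours : ∀ {x} → Periodic N x → ∀ i →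
      x (+ toℕ i + 1ℤ) ≡ false → x (+ toℕ i + -1ℤ) ≡ false → ∀ y → window N x ∋ y → ¬ i ∼ y
    avoids-neighbours {x} px i right left y y∈ i∼y with ∼⇒next i y i∼y
    ... | inj₁ refl with () ← trans (sym y∈) (trans (lookup-window x (next i)) (trans (next-ℤ x px i) right))
    ... | inj₂ refl with () ← trans (sym y∈) (trans (lookup-window x y)
                            (trans (cong x (cancel (+ toℕ y)))
                            (trans (sym (next-ℤ (λ p → x (p + -1ℤ)) (periodic-shift {x = x} px -1ℤ) y)) left)))

    -- On a circle with at least two vertices the places on both sides of p are different from p,
    -- hence true neighbours, and can be tested.
    neighbours-avoided : ∀ {x} → Periodic N x → ∀ i → (∀ y → window N x ∋ y → ¬ i ∼ y) →
      x (+ toℕ i + 1ℤ) ≡ false × x (+ toℕ i + -1ℤ) ≡ false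
    neighbours-avoided {x} px i f = falsum right , falsum left
      where
      falsum : ∀ {b} → ¬ (b ≡ true) → b ≡ false
      falsum {false} _ = refl
      falsum {true}  f = ⊥-elim (f refl)
      right : ¬ (x (+ toℕ i + 1ℤ) ≡ true)
      right e = f (next i) (trans (lookup-window x (next i)) (trans (next-ℤ x px i) e))
                  (next⇒∼ i (next i) (next-≢ i) refl)
      left : ¬ (x (+ toℕ i + -1ℤ) ≡ true)
      left e with next-surjective i
      ... | j , refl = f j (trans (lookup-window x j) (trans (cong x (cancel (+ toℕ j)))
                         (trans (sym (next-ℤ (λ p → x (p + -1ℤ)) (periodic-shift {x = x} px -1ℤ) j)) e)))
                       (Graph.sym-∼ (cycle N) (next⇒∼ j (next j) (next-≢ j) refl))

-- Words of cells and exhaustive search for local facts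

module Cells where
  open import Data.Integer.Base using (_+_)
  open import Data.Nat.Base using (suc)
  open import Data.Vec.Base using (map)
  open SubsetSums using (∧-split; ∧-join; does-elim)

  -- A pattern is encoded by one cell per vertex of the circle.  Cells A lie between
  -- stones facing away from each other and cells B between stones facing each other;
  -- the sign is the parity of the distance to the stones, and ⁺ marks the places that
  -- can belong to the first row (A) or be missing from the second (B).  A× is an A⁻
  -- in the pattern B⁻ A⁻ B⁻ singled out for a merger of the two adjacent zones.
  data Cell : Set where
    A⁺ A⁻ B⁻ B⁺ A× : Cell

  plain toggle : Cell → Cell
  plain A× = A⁻
  plain c  = c
  toggle A⁺ = A⁻
  toggle A⁻ = A⁺
  toggle B⁻ = B⁺
  toggle B⁺ = B⁻
  toggle A× = A⁺

  -- An injection into ℕ yields decidable equality without comparing all pairs of constructors.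
  code : Cell → ℕ
  code A⁺ = 0
  code A⁻ = 1
  code B⁻ = 2
  code B⁺ = 3
  code A× = 4

  decode : ℕ → Cell
  decode 0 = A⁺
  decode 1 = A⁻
  decode 2 = B⁻
  decode 3 = B⁺
  decode _ = A×

  decode-code : ∀ c → decode (code c) ≡ c
  decode-code A⁺ = refl
  decode-code A⁻ = refl
  decode-code B⁻ = refl
  decode-code B⁺ = refl
  decode-code A× = refl

  infix 4 _≟_ _≡ᵇ_
  _≟_ : (c d : Cell) → Dec (c ≡ d)
  c ≟ d = map′ (λ e → trans (sym (decode-code c)) (trans (cong decode e) (decode-code d)))
               (cong code) (code c ℕ.≟ code d)

  _≡ᵇ_ : Cell → Cell → Bool
  c ≡ᵇ d = does (c ≟ d)

  -- Zones A begin and end with `A⁻`, hence have an odd number of cells, as `away` demands. The cell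
  -- of a zone B next to a stone is `B⁻` for length 1 and `B⁺` for length 2, so alternation makes
  -- the number of cells plus both lengths odd, as `towards` demands.
  stepᵇ : Cell → Cell → Bool
  stepᵇ A⁺ A⁻ = true
  stepᵇ A⁻ A⁺ = true
  stepᵇ A⁻ B⁻ = true
  stepᵇ A⁻ B⁺ = true
  stepᵇ B⁻ B⁺ = true
  stepᵇ B⁻ A⁻ = true
  stepᵇ B⁺ B⁻ = true
  stepᵇ B⁺ A⁻ = true
  stepᵇ _  _  = false

  -- With `short₄ᵇ` and `short₅ᵇ` this expresses the lower bound in `towards`: no zone B has one or
  -- two cells, and one with three cells lies between stones of length 1.
  short₃ᵇ : Cell → Cell → Cell → Bool
  short₃ᵇ A⁻ B⁻ A⁻ = true
  short₃ᵇ A⁻ B⁺ A⁻ = true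
  short₃ᵇ _  _  _  = false

  short₄ᵇ : Cell → Cell → Cell → Cell → Bool
  short₄ᵇ A⁻ B⁻ B⁺ A⁻ = true
  short₄ᵇ A⁻ B⁺ B⁻ A⁻ = true
  short₄ᵇ _  _  _  _  = false

  short₅ᵇ : Cell → Cell → Cell → Cell → Cell → Bool
  short₅ᵇ A⁻ B⁺ B⁻ B⁺ A⁻ = true
  short₅ᵇ _  _  _  _  _  = false

  -- Five cells are the smallest window that shows a zone B of three cells together with both of its
  -- ends.
  plainGoodᵇ : Vec Cell 5 → Bool
  plainGoodᵇ (a ∷ b ∷ c ∷ d ∷ e ∷ []) =
    stepᵇ a b ∧ stepᵇ b c ∧ stepᵇ c d ∧ stepᵇ d e ∧
    not (short₃ᵇ a b c) ∧ not (short₃ᵇ b c d) ∧ not (short₃ᵇ c d e) ∧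
    not (short₄ᵇ a b c d) ∧ not (short₄ᵇ b c d e) ∧ not (short₅ᵇ a b c d e)

  markᵇ : Cell → Cell → Cell → Bool
  markᵇ a b c = not (b ≡ᵇ A×) ∨ ((a ≡ᵇ B⁻) ∧ (c ≡ᵇ B⁻))

  goodᵇ : Vec Cell 5 → Bool
  goodᵇ w@(a ∷ b ∷ c ∷ d ∷ e ∷ []) =
    plainGoodᵇ (map plain w) ∧ markᵇ a b c ∧ markᵇ b c d ∧ markᵇ c d e

  -- The base point p and the offset a are kept apart: offsets are numerals whose sums evaluate, so
  -- that segments around a variable p match by computation.
  segment : {X : Set} → (ℤ → X) → ℤ → ℤ → ∀ n → Vec X n
  segment z p a 0       = []
  segment z p a (suc n) = z (p + a) ∷ segment z p (ℤ.suc a) n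

  segment-+ : ∀ {X : Set} (z : ℤ → X) p a b n → segment z (p + a) b n ≡ segment z p (a + b) n
  segment-+ z p a b 0       = refl
  segment-+ z p a b (suc n) = cong₂ _∷_ (cong z (ℤ.+-assoc p a b))
    (trans (segment-+ z p a (ℤ.suc b) n) (cong (λ c → segment z p c n) (lemma a b)))
    where
    lemma : ∀ a b → a + (1ℤ + b) ≡ 1ℤ + (a + b)
    lemma = solve-∀

  segment-cong : ∀ {X : Set} {y z : ℤ → X} → y ≗ z → ∀ p a n → segment y p a n ≡ segment z p a n
  segment-cong e p a 0       = refl
  segment-cong e p a (suc n) = cong₂ _∷_ (e (p + a)) (segment-cong e p (ℤ.suc a) n)

  segment-map : ∀ {X Y : Set} (f : X → Y) z p a n → segment (f ∘ z) p a n ≡ map f (segment z p a n)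
  segment-map f z p a 0       = refl
  segment-map f z p a (suc n) = cong (f (z (p + a)) ∷_) (segment-map f z p (ℤ.suc a) n)

  segment-∘+ : ∀ {X : Set} (z : ℤ → X) r p a n → segment (λ q → z (q + r)) p a n ≡ segment z (p + r) a n
  segment-∘+ z r p a 0       = refl
  segment-∘+ z r p a (suc n) = cong₂ _∷_ (cong z (lemma p a r)) (segment-∘+ z r p (ℤ.suc a) n)
    where
    lemma : ∀ p a r → p + a + r ≡ p + r + a
    lemma = solve-∀

  slide : ∀ {X Y : Set} {n} → (Vec X 5 → Y) → Vec X (4 ℕ.+ n) → Vec Y n
  slide {n = 0}     f _ = []
  slide {n = suc n} f (a ∷ b ∷ c ∷ d ∷ e ∷ w) = f (a ∷ b ∷ c ∷ d ∷ e ∷ []) ∷ slide f (b ∷ c ∷ d ∷ e ∷ w)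

  blockMap : ∀ {X Y : Set} → (Vec X 5 → Y) → (ℤ → X) → ℤ → Y
  blockMap f z p = f (segment z p (-[1+ 1 ]) 5)

  -- A rule with windows of five looks two cells to either side, so n cells after it depend on n + 4
  -- cells before it.
  segment-blockMap : ∀ {X Y : Set} (f : Vec X 5 → Y) z p a n →
    segment (blockMap f z) p a n ≡ slide f (segment z p (a + -[1+ 1 ]) (4 ℕ.+ n))
  segment-blockMap f z p a 0       = refl
  segment-blockMap f z p a (suc n) = cong₂ _∷_
    (cong f (segment-+ z p a -[1+ 1 ] 5))
    (trans (segment-blockMap f z p (ℤ.suc a) n)
           (cong (λ b → slide f (segment z p b (4 ℕ.+ n))) (ℤ.+-assoc 1ℤ a -[1+ 1 ])))

  Good : (ℤ → Cell) → Set
  Good z = ∀ p → goodᵇ (segment z p 0ℤ 5) ≡ true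

  every : (Cell → Bool) → Bool
  every q = q A⁺ ∧ q A⁻ ∧ q B⁻ ∧ q B⁺ ∧ q A×

  every-sound : ∀ q → every q ≡ true → ∀ c → q c ≡ true
  every-sound q e A⁺ = proj₁ (∧-split e)
  every-sound q e A⁻ = proj₁ (∧-split (proj₂ (∧-split {q A⁺} e)))
  every-sound q e B⁻ = proj₁ (∧-split (proj₂ (∧-split {q A⁻} (proj₂ (∧-split {q A⁺} e)))))
  every-sound q e B⁺ = proj₁ (∧-split (proj₂ (∧-split {q B⁻} (proj₂ (∧-split {q A⁻} (proj₂ (∧-split {q A⁺} e)))))))
  every-sound q e A× = proj₂ (∧-split {q B⁺} (proj₂ (∧-split {q B⁻} (proj₂ (∧-split {q A⁻} (proj₂ (∧-split {q A⁺} e)))))))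

  -- Local facts about good patterns are decided by exhausting the good words.
  grow : Cell → Cell → Cell → Cell → ∀ n → (Vec Cell n → Bool) → Bool
  grow a b c d 0       q = q []
  grow a b c d (suc n) q = every λ e →
    if goodᵇ (a ∷ b ∷ c ∷ d ∷ e ∷ []) then grow b c d e n (q ∘ (e ∷_)) else true

  search : ∀ n → (Vec Cell (4 ℕ.+ n) → Bool) → Bool
  search n q = every λ a → every λ b → every λ c → every λ d →
    grow a b c d n (λ w → q (a ∷ b ∷ c ∷ d ∷ w))

  chainᵇ : ∀ {n} → Vec Cell (4 ℕ.+ n) → Bool
  chainᵇ {0}     _ = true
  chainᵇ {suc n} (a ∷ b ∷ c ∷ d ∷ e ∷ w) = goodᵇ (a ∷ b ∷ c ∷ d ∷ e ∷ []) ∧ chainᵇ (b ∷ c ∷ d ∷ e ∷ w)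

  grow-sound : ∀ a b c d n q → grow a b c d n q ≡ true →
               ∀ w → chainᵇ (a ∷ b ∷ c ∷ d ∷ w) ≡ true → q w ≡ true
  grow-sound a b c d 0       q e []      _ = e
  grow-sound a b c d (suc n) q e (x ∷ w) h =
    let (good , rest) = ∧-split {goodᵇ (a ∷ b ∷ c ∷ d ∷ x ∷ [])} h in
    grow-sound b c d x n (q ∘ (x ∷_))
      (trans (sym (cong (λ b′ → if b′ then grow b c d x n (q ∘ (x ∷_)) else true) good))
             (every-sound (λ y → if goodᵇ (a ∷ b ∷ c ∷ d ∷ y ∷ []) then grow b c d y n (q ∘ (y ∷_)) else true) e x))
      w rest

  search-sound : ∀ n q → search n q ≡ true → ∀ w → chainᵇ w ≡ true → q w ≡ true
  search-sound n q e (a ∷ b ∷ c ∷ d ∷ w) h =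
    grow-sound a b c d n (λ w → q (a ∷ b ∷ c ∷ d ∷ w))
      (every-sound (λ d → grow a b c d n (λ w → q (a ∷ b ∷ c ∷ d ∷ w)))
      (every-sound (λ c → every λ d → grow a b c d n (λ w → q (a ∷ b ∷ c ∷ d ∷ w)))
      (every-sound (λ b → every λ c → every λ d → grow a b c d n (λ w → q (a ∷ b ∷ c ∷ d ∷ w)))
      (every-sound (λ a → every λ b → every λ c → every λ d → grow a b c d n (λ w → q (a ∷ b ∷ c ∷ d ∷ w)))
       e a) b) c) d) w h

  segment-chain : ∀ {z} → Good z → ∀ p a n → chainᵇ (segment z p a (4 ℕ.+ n)) ≡ true
  segment-chain g p a 0       = refl
  segment-chain {z} g p a (suc n) = ∧-join
    (trans (cong goodᵇ (sym (trans (segment-+ z p a 0ℤ 5)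
                                   (cong (λ b → segment z p b 5) (ℤ.+-identityʳ a))))) (g (p + a)))
    (segment-chain {z} g p (ℤ.suc a) n)

  -- Proof by reflection: the search is a closed Boolean, so `refl` is passed for it. Words are
  -- extended only by cells that keep the last window good, which keeps the search small.
  locally : ∀ n (P : Vec Cell (4 ℕ.+ n) → Set) (P? : ∀ w → Dec (P w)) → search n (does ∘ P?) ≡ true →
            ∀ {z} → Good z → ∀ p a → P (segment z p a (4 ℕ.+ n))
  locally n P P? e {z} g p a =
    does-elim (P? _) (search-sound n (does ∘ P?) e _ (segment-chain {z} g p a n))

-- The necklace dynamics as a cellular automaton

module LocalRules where
  open import Data.Integer.Base using (_+_; _-_; -_)
  open import Data.Vec.Base using (map)
  open Cells

  -- The transformation T as a cellular automaton.  Far from the stones it exchanges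
  -- A⁺ with B⁺ and A⁻ with B⁻, up to a shift of the parity in the zones B; the other
  -- rules move the stones.  In B⁻ A⁻ B⁻ two stones jump to distance 3 and FIX applies,
  -- while in B⁻ A× B⁻ they disappear, so that the two zones B become a single zone A.
  advance : Vec Cell 5 → Cell
  advance (_  ∷ _  ∷ A⁺ ∷ _  ∷ _  ∷ []) = B⁺
  advance (_  ∷ _  ∷ A× ∷ _  ∷ _  ∷ []) = A⁻
  advance (_  ∷ B⁻ ∷ A⁻ ∷ B⁻ ∷ _  ∷ []) = B⁺
  advance (_  ∷ _  ∷ A⁻ ∷ _  ∷ _  ∷ []) = B⁻
  advance (B⁻ ∷ A⁻ ∷ B⁻ ∷ _  ∷ _  ∷ []) = B⁻
  advance (_  ∷ A× ∷ B⁻ ∷ _  ∷ _  ∷ []) = A⁺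
  advance (_  ∷ A⁻ ∷ B⁻ ∷ _  ∷ _  ∷ []) = B⁺
  advance (_  ∷ _  ∷ B⁻ ∷ A⁻ ∷ B⁻ ∷ []) = B⁻
  advance (_  ∷ _  ∷ B⁻ ∷ A× ∷ _  ∷ []) = A⁺
  advance (_  ∷ _  ∷ B⁻ ∷ A⁻ ∷ _  ∷ []) = B⁺
  advance (A⁻ ∷ B⁺ ∷ B⁻ ∷ _  ∷ _  ∷ []) = B⁻
  advance (_  ∷ _  ∷ B⁻ ∷ B⁺ ∷ A⁻ ∷ []) = B⁻
  advance (_  ∷ _  ∷ B⁻ ∷ _  ∷ _  ∷ []) = A⁺
  advance (_  ∷ A⁻ ∷ B⁺ ∷ _  ∷ _  ∷ []) = B⁺
  advance (_  ∷ _  ∷ B⁺ ∷ A⁻ ∷ _  ∷ []) = B⁺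
  advance (_  ∷ _  ∷ B⁺ ∷ _  ∷ _  ∷ []) = A⁻

  -- The progression of vertices of a zone A continues for one more place beyond a
  -- stone of length 2, hence the roles of A⁻ B⁺ and B⁺ A⁻.
  presentᵇ missingᵇ : Vec Cell 3 → Bool
  presentᵇ (_  ∷ A⁺ ∷ _  ∷ []) = true
  presentᵇ (A⁻ ∷ B⁺ ∷ _  ∷ []) = true
  presentᵇ (_  ∷ B⁺ ∷ A⁻ ∷ []) = true
  presentᵇ _                   = false
  missingᵇ (A⁻ ∷ B⁺ ∷ _  ∷ []) = false
  missingᵇ (_  ∷ B⁺ ∷ A⁻ ∷ []) = false
  missingᵇ (_  ∷ B⁺ ∷ _  ∷ []) = true
  missingᵇ _                   = false

  -- Two stones of length 1 face away from each other at distance 1 here, and the next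
  -- first row contains three consecutive vertices.
  meetingᵇ chosenᵇ : Vec Cell 3 → Bool
  meetingᵇ (B⁻ ∷ c ∷ B⁻ ∷ []) = plain c ≡ᵇ A⁻
  meetingᵇ _                  = false
  chosenᵇ w@(_ ∷ c ∷ _ ∷ []) = meetingᵇ w ∧ not (c ≡ᵇ A×)

  step : (ℤ → Cell) → ℤ → Cell
  step = blockMap advance

  firstRow secondGap meeting chosen : (ℤ → Cell) → ℤ → Bool
  firstRow  z p = presentᵇ (segment z p -1ℤ 3)
  secondGap z p = missingᵇ (segment z p -1ℤ 3)
  meeting   z p = meetingᵇ (segment z p -1ℤ 3)
  chosen    z p = chosenᵇ  (segment z p -1ℤ 3)

  Unmarked : (ℤ → Cell) → Set
  Unmarked z = ∀ p → z p ≢ A×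

  -- A stone is a change of zone, with zone A behind it and zone B in front. The cell of zone B
  -- beside it records its length, and the cell of zone A is always `A⁻`.
  source target : StoneVector → Cell
  source -2⃗ = B⁺
  source -1⃗ = B⁻
  source 1⃗  = A⁻
  source 2⃗  = A⁻
  target -2⃗ = A⁻
  target -1⃗ = A⁻
  target 1⃗  = B⁻
  target 2⃗  = B⁺

  -- A stone at p lies between the vertices p and p + 1.
  Stone : (ℤ → Cell) → ℤ → StoneVector → Set
  Stone z p v = z p ≡ source v × z (p + 1ℤ) ≡ target v

  private
    stone? : ∀ c d → Dec (∃ λ v → c ≡ source v × d ≡ target v)
    stone? c d = map′
      (λ { (inj₁ (inj₁ p)) → -2⃗ , p ; (inj₁ (inj₂ p)) → -1⃗ , p ; (inj₂ (inj₁ p)) → 1⃗ , p ; (inj₂ (inj₂ p)) → 2⃗ , p })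
      (λ { (-2⃗ , p) → inj₁ (inj₁ p) ; (-1⃗ , p) → inj₁ (inj₂ p) ; (1⃗ , p) → inj₂ (inj₁ p) ; (2⃗ , p) → inj₂ (inj₂ p) })
      ((at? -2⃗ ⊎-dec at? -1⃗) ⊎-dec (at? 1⃗ ⊎-dec at? 2⃗))
      where
      at? : ∀ v → Dec (c ≡ source v × d ≡ target v)
      at? v = (c ≟ source v) ×-dec (d ≟ target v)

  hasStone? : ∀ z p → Dec (∃ (Stone z p))
  hasStone? z p = stone? (z p) (z (p + 1ℤ))

  stone-unique : ∀ {z p v w} → Stone z p v → Stone z p w → v ≡ w
  stone-unique {v = v} {w} (s , t) (s′ , t′) = go v w (trans (sym s) s′) (trans (sym t) t′)
    where
    go : ∀ v w → source v ≡ source w → target v ≡ target w → v ≡ w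
    go -2⃗ -2⃗ _ _ = refl
    go -1⃗ -1⃗ _ _ = refl
    go 1⃗  1⃗  _ _ = refl
    go 2⃗  2⃗  _ _ = refl
    go -2⃗ -1⃗ () _
    go -2⃗ 1⃗  () _
    go -2⃗ 2⃗  () _
    go -1⃗ -2⃗ () _
    go -1⃗ 1⃗  () _
    go -1⃗ 2⃗  () _
    go 1⃗  -2⃗ () _
    go 1⃗  -1⃗ () _
    go 1⃗  2⃗  _ ()
    go 2⃗  -2⃗ () _
    go 2⃗  -1⃗ () _
    go 2⃗  1⃗  _ ()

  at-0 : ∀ {X : Set} (z : ℤ → X) p → z (p + 0ℤ) ≡ z p
  at-0 z p = cong z (ℤ.+-identityʳ p)

  step-at : ∀ z p a → step z (p + a) ≡ advance (segment z p (a + -[1+ 1 ]) 5)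
  step-at z p a = cong advance (segment-+ z p a -[1+ 1 ] 5)

  step-at-1 : ∀ z p a → step z (p + a + 1ℤ) ≡ advance (segment z p ((a + 1ℤ) + -[1+ 1 ]) 5)
  step-at-1 z p a = trans (cong (step z) (ℤ.+-assoc p a 1ℤ)) (step-at z p (a + 1ℤ))

  step-cong : ∀ {y z} → y ≗ z → step y ≗ step z
  step-cong e p = cong advance (segment-cong e p -[1+ 1 ] 5)

  module _ {z : ℤ → Cell} (good : Good z) where

    -- Five cells after the step are determined by nine before it, so the good words of length nine
    -- decide the claim.
    step-good : Good (step z)
    step-good p = trans (cong goodᵇ (segment-blockMap advance z p 0ℤ 5))
      (locally 5 (λ w → goodᵇ (slide {n = 5} advance w) ≡ true) (λ w → _ Bool.≟ _) refl {z} good p -[1+ 1 ])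

    -- Marks are consumed by the step; a pattern is marked afresh before the next one.
    step-unmarked : Unmarked (step z)
    step-unmarked p = locally 1 (λ w → advance w ≢ A×) (λ w → ¬? (_ ≟ _)) refl {z} good p -[1+ 1 ]

    -- Necklaces are identified under reflections too, so goodness must not depend on the
    -- orientation of the circle.
    reverse-good : ∀ r → Good (λ p → z (r - p))
    reverse-good r p = trans
      (cong goodᵇ (cong₂ _∷_ (cong z (lemma₀ r p)) (cong₂ _∷_ (cong z (lemma₁ r p))
        (cong₂ _∷_ (cong z (lemma₂ r p)) (cong₂ _∷_ (cong z (lemma₃ r p))
        (cong₂ _∷_ (cong z (lemma₄ r p)) refl))))))
      (locally 1 (λ { (a ∷ b ∷ c ∷ d ∷ e ∷ []) → goodᵇ (e ∷ d ∷ c ∷ b ∷ a ∷ []) ≡ true })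
         (λ { (a ∷ b ∷ c ∷ d ∷ e ∷ []) → _ Bool.≟ _ }) refl {z} good (r - p - + 4) 0ℤ)
      where
      lemma₀ : ∀ r p → r - (p + + 0) ≡ (r - p - + 4) + + 4
      lemma₀ = solve-∀
      lemma₁ : ∀ r p → r - (p + + 1) ≡ (r - p - + 4) + + 3
      lemma₁ = solve-∀
      lemma₂ : ∀ r p → r - (p + + 2) ≡ (r - p - + 4) + + 2
      lemma₂ = solve-∀
      lemma₃ : ∀ r p → r - (p + + 3) ≡ (r - p - + 4) + + 1
      lemma₃ = solve-∀
      lemma₄ : ∀ r p → r - (p + + 4) ≡ (r - p - + 4) + + 0
      lemma₄ = solve-∀

    firstRow-at : ∀ p a → firstRow z (p + a) ≡ presentᵇ (segment z p (a + -1ℤ) 3)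
    firstRow-at p a = cong presentᵇ (segment-+ z p a -1ℤ 3)

    -- This and `rows-disjoint` supply the hypotheses of `G-step` on A and B.
    firstRow-nonadjacent : ∀ p → firstRow z p ∧ firstRow z (p + 1ℤ) ≡ false
    firstRow-nonadjacent p = trans (cong (firstRow z p ∧_) (firstRow-at p 1ℤ))
      (locally 1 (λ { (a ∷ b ∷ c ∷ d ∷ e ∷ []) → presentᵇ (a ∷ b ∷ c ∷ []) ∧ presentᵇ (b ∷ c ∷ d ∷ []) ≡ false })
         (λ { (a ∷ b ∷ c ∷ d ∷ e ∷ []) → _ Bool.≟ _ }) refl {z} good p -1ℤ)

    rows-disjoint : ∀ p → firstRow z p ∧ secondGap z p ≡ false
    rows-disjoint p =
      locally 1 (λ { (a ∷ b ∷ c ∷ d ∷ e ∷ []) → presentᵇ (a ∷ b ∷ c ∷ []) ∧ missingᵇ (a ∷ b ∷ c ∷ []) ≡ false })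
        (λ { (a ∷ b ∷ c ∷ d ∷ e ∷ []) → _ Bool.≟ _ }) refl {z} good p -1ℤ

    -- The set A′ of `G-step`, in terms of cells.
    free : ℤ → Bool
    free p = not (firstRow z p) ∧ not (secondGap z p) ∧ not (firstRow z (p + 1ℤ)) ∧ not (firstRow z (p + -1ℤ))

    private
      freeᵇ : Vec Cell 5 → Bool
      freeᵇ (a ∷ b ∷ c ∷ d ∷ e ∷ []) = not (presentᵇ (b ∷ c ∷ d ∷ [])) ∧ not (missingᵇ (b ∷ c ∷ d ∷ []))
        ∧ not (presentᵇ (c ∷ d ∷ e ∷ [])) ∧ not (presentᵇ (a ∷ b ∷ c ∷ []))

      free-segment : ∀ p → free p ≡ freeᵇ (segment z p -[1+ 1 ] 5)
      free-segment p = cong₂ (λ x y → not (firstRow z p) ∧ not (secondGap z p) ∧ not x ∧ not y)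
        (firstRow-at p 1ℤ) (firstRow-at p -1ℤ)

    -- With `meeting-nonadjacent`, this is what `G-split` requires of C: it lies in the available
    -- row and has no edge.
    meeting-free : ∀ p → meeting z p ∧ not (free p) ≡ false
    meeting-free p = trans (cong (λ b → meeting z p ∧ not b) (free-segment p))
      (locally 1 (λ { w@(a ∷ b ∷ c ∷ d ∷ e ∷ []) → meetingᵇ (b ∷ c ∷ d ∷ []) ∧ not (freeᵇ w) ≡ false })
         (λ { (a ∷ b ∷ c ∷ d ∷ e ∷ []) → _ Bool.≟ _ }) refl {z} good p -[1+ 1 ])

    meeting-nonadjacent : ∀ p → meeting z p ∧ meeting z (p + 1ℤ) ≡ false
    meeting-nonadjacent p = trans (cong (λ w → meeting z p ∧ meetingᵇ w) (segment-+ z p 1ℤ -1ℤ 3))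
      (locally 1 (λ { (a ∷ b ∷ c ∷ d ∷ e ∷ []) → meetingᵇ (a ∷ b ∷ c ∷ []) ∧ meetingᵇ (b ∷ c ∷ d ∷ []) ≡ false })
         (λ { (a ∷ b ∷ c ∷ d ∷ e ∷ []) → _ Bool.≟ _ }) refl {z} good p -1ℤ)

    -- The right-hand side is what `G-step` followed by `G-split` leaves of the row, with the
    -- meeting places as C and the chosen ones as c. Together with `secondGap-step` this says that
    -- the automaton carries out the recurrence.
    firstRow-step : ∀ p → firstRow (step z) p ≡
      free p ∧ not (meeting z p) ∧ not (chosen z (p + 1ℤ)) ∧ not (chosen z (p + -1ℤ))
    firstRow-step p = trans (cong presentᵇ (segment-blockMap advance z p -1ℤ 3))
      (trans (locally 3
        (λ { w@(a ∷ b ∷ c ∷ d ∷ e ∷ f ∷ g ∷ []) → presentᵇ (slide {n = 3} advance w) ≡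
               freeᵇ (b ∷ c ∷ d ∷ e ∷ f ∷ []) ∧ not (meetingᵇ (c ∷ d ∷ e ∷ []))
               ∧ not (chosenᵇ (d ∷ e ∷ f ∷ [])) ∧ not (chosenᵇ (b ∷ c ∷ d ∷ [])) })
        (λ { (a ∷ b ∷ c ∷ d ∷ e ∷ f ∷ g ∷ []) → _ Bool.≟ _ }) refl {z} good p -[1+ 2 ])
      (sym (trans (cong (_∧ (not (meeting z p) ∧ not (chosen z (p + 1ℤ)) ∧ not (chosen z (p + -1ℤ)))) (free-segment p))
        (cong₂ (λ x y → freeᵇ (segment z p -[1+ 1 ] 5) ∧ not (meeting z p) ∧ not (chosenᵇ x) ∧ not (chosenᵇ y))
           (segment-+ z p 1ℤ -1ℤ 3) (segment-+ z p -1ℤ -1ℤ 3)))))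

    secondGap-step : ∀ p → secondGap (step z) p ≡ firstRow z p ∨ chosen z p
    secondGap-step p = trans (cong missingᵇ (segment-blockMap advance z p -1ℤ 3))
      (locally 3
        (λ { w@(a ∷ b ∷ c ∷ d ∷ e ∷ f ∷ g ∷ []) → missingᵇ (slide {n = 3} advance w) ≡
               presentᵇ (c ∷ d ∷ e ∷ []) ∨ chosenᵇ (c ∷ d ∷ e ∷ []) })
        (λ { (a ∷ b ∷ c ∷ d ∷ e ∷ f ∷ g ∷ []) → _ Bool.≟ _ }) refl {z} good p -[1+ 2 ])

    -- A stone of length 2 turns into one of length 1, which FIX leaves alone, so the outcome is the
    -- same whatever its neighbours are.
    jump-right₂ : ∀ p → Stone z p 2⃗ → Stone (step z) (p + + 2) -1⃗
    jump-right₂ p (s , t) =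
      let (x , y) = locally 2
            (λ { (a ∷ b ∷ c ∷ d ∷ e ∷ f ∷ []) → a ≡ A⁻ → b ≡ B⁺ →
                 advance (a ∷ b ∷ c ∷ d ∷ e ∷ []) ≡ B⁻ × advance (b ∷ c ∷ d ∷ e ∷ f ∷ []) ≡ A⁻ })
            (λ { (a ∷ b ∷ c ∷ d ∷ e ∷ f ∷ []) → (_ ≟ _) →-dec ((_ ≟ _) →-dec ((_ ≟ _) ×-dec (_ ≟ _))) })
            refl {z} good p 0ℤ (trans (at-0 z p) s) t
      in trans (step-at z p (+ 2)) x , trans (step-at-1 z p (+ 2)) y

    jump-left₂ : ∀ p → Stone z p -2⃗ → Stone (step z) (p + -[1+ 1 ]) 1⃗
    jump-left₂ p (s , t) =
      let (x , y) = locally 2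
            (λ { (a ∷ b ∷ c ∷ d ∷ e ∷ f ∷ []) → e ≡ B⁺ → f ≡ A⁻ →
                 advance (a ∷ b ∷ c ∷ d ∷ e ∷ []) ≡ A⁻ × advance (b ∷ c ∷ d ∷ e ∷ f ∷ []) ≡ B⁻ })
            (λ { (a ∷ b ∷ c ∷ d ∷ e ∷ f ∷ []) → (_ ≟ _) →-dec ((_ ≟ _) →-dec ((_ ≟ _) ×-dec (_ ≟ _))) })
            refl {z} good p -[1+ 3 ] (trans (at-0 z p) s) t
      in trans (step-at z p -[1+ 1 ]) x , trans (step-at-1 z p -[1+ 1 ]) y

    private
      -- The cell behind the `A⁻` decides: if it is `B⁻`, the zone A is that single cell with a
      -- stone of length 1 on its other side, so the two stones meet after the jump and FIX shortens
      -- the result.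
      right₁ : ∀ p → Stone z p 1⃗ →
        (z (p + -1ℤ) ≡ B⁻ → Stone (step z) (p + 1ℤ) -1⃗) × (z (p + -1ℤ) ≢ B⁻ → Stone (step z) (p + 1ℤ) -2⃗)
      right₁ p (s , t) =
        let (x , y) = locally 2
              (λ { (a ∷ b ∷ c ∷ d ∷ e ∷ f ∷ []) → b ≡ A⁻ → c ≡ B⁻ →
                   (a ≡ B⁻ → advance (a ∷ b ∷ c ∷ d ∷ e ∷ []) ≡ B⁻ × advance (b ∷ c ∷ d ∷ e ∷ f ∷ []) ≡ A⁻) ×
                   (a ≢ B⁻ → advance (a ∷ b ∷ c ∷ d ∷ e ∷ []) ≡ B⁺ × advance (b ∷ c ∷ d ∷ e ∷ f ∷ []) ≡ A⁻) })
              (λ { (a ∷ b ∷ c ∷ d ∷ e ∷ f ∷ []) → (_ ≟ _) →-dec ((_ ≟ _) →-dec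
                   (((_ ≟ _) →-dec ((_ ≟ _) ×-dec (_ ≟ _))) ×-dec (¬? (_ ≟ _) →-dec ((_ ≟ _) ×-dec (_ ≟ _))))) })
              refl {z} good p -1ℤ (trans (at-0 z p) s) t
        in (λ e → trans (step-at z p 1ℤ) (proj₁ (x e)) , trans (step-at-1 z p 1ℤ) (proj₂ (x e)))
         , (λ e → trans (step-at z p 1ℤ) (proj₁ (y e)) , trans (step-at-1 z p 1ℤ) (proj₂ (y e)))

      left₁ : ∀ p → Stone z p -1⃗ →
        (z (p + + 2) ≡ B⁻ → Stone (step z) (p + -1ℤ) 1⃗) × (z (p + + 2) ≢ B⁻ → Stone (step z) (p + -1ℤ) 2⃗)
      left₁ p (s , t) =
        let (x , y) = locally 2
              (λ { (a ∷ b ∷ c ∷ d ∷ e ∷ f ∷ []) → d ≡ B⁻ → e ≡ A⁻ →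
                   (f ≡ B⁻ → advance (a ∷ b ∷ c ∷ d ∷ e ∷ []) ≡ A⁻ × advance (b ∷ c ∷ d ∷ e ∷ f ∷ []) ≡ B⁻) ×
                   (f ≢ B⁻ → advance (a ∷ b ∷ c ∷ d ∷ e ∷ []) ≡ A⁻ × advance (b ∷ c ∷ d ∷ e ∷ f ∷ []) ≡ B⁺) })
              (λ { (a ∷ b ∷ c ∷ d ∷ e ∷ f ∷ []) → (_ ≟ _) →-dec ((_ ≟ _) →-dec
                   (((_ ≟ _) →-dec ((_ ≟ _) ×-dec (_ ≟ _))) ×-dec (¬? (_ ≟ _) →-dec ((_ ≟ _) ×-dec (_ ≟ _))))) })
              refl {z} good p -[1+ 2 ] (trans (at-0 z p) s) t
        in (λ e → trans (step-at z p -1ℤ) (proj₁ (x e)) , trans (step-at-1 z p -1ℤ) (proj₂ (x e)))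
         , (λ e → trans (step-at z p -1ℤ) (proj₁ (y e)) , trans (step-at-1 z p -1ℤ) (proj₂ (y e)))

      -1+1 : ∀ p → p ≡ p + -1ℤ + 1ℤ
      -1+1 = solve-∀
      +1+1 : ∀ p → p + + 2 ≡ p + 1ℤ + 1ℤ
      +1+1 = solve-∀

    jump-right₁-meeting : ∀ p → Stone z p 1⃗ → Stone z (p + -1ℤ) -1⃗ → Stone (step z) (p + 1ℤ) -1⃗
    jump-right₁-meeting p s (s′ , _) = proj₁ (right₁ p s) s′

    jump-right₁ : ∀ p → Stone z p 1⃗ → ¬ Stone z (p + -1ℤ) -1⃗ → Stone (step z) (p + 1ℤ) -2⃗
    jump-right₁ p s ¬m = proj₂ (right₁ p s) λ e → ¬m (e , trans (cong z (sym (-1+1 p))) (proj₁ s))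

    jump-left₁-meeting : ∀ p → Stone z p -1⃗ → Stone z (p + 1ℤ) 1⃗ → Stone (step z) (p + -1ℤ) 1⃗
    jump-left₁-meeting p s (_ , t′) = proj₁ (left₁ p s) (trans (cong z (+1+1 p)) t′)

    jump-left₁ : ∀ p → Stone z p -1⃗ → ¬ Stone z (p + 1ℤ) 1⃗ → Stone (step z) (p + -1ℤ) 2⃗
    jump-left₁ p s ¬m = proj₂ (left₁ p s) λ e → ¬m (proj₂ s , trans (cong z (sym (+1+1 p))) e)

    -- The step creates no stones. The four alternatives are the places at distance 1 or 2 from
    -- which a stone can have come.
    jumped-from : ∀ p v → Stone (step z) p v → ∃ λ u → Stone z (p - displacement u) u
    jumped-from p v (s , t) with locally 2
        (λ { (a ∷ b ∷ c ∷ d ∷ e ∷ f ∷ []) →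
             ∃ (λ v → advance (a ∷ b ∷ c ∷ d ∷ e ∷ []) ≡ source v × advance (b ∷ c ∷ d ∷ e ∷ f ∷ []) ≡ target v) →
             ((a ≡ A⁻ × b ≡ B⁺) ⊎ (b ≡ A⁻ × c ≡ B⁻)) ⊎ ((d ≡ B⁻ × e ≡ A⁻) ⊎ (e ≡ B⁺ × f ≡ A⁻)) })
        (λ { (a ∷ b ∷ c ∷ d ∷ e ∷ f ∷ []) → stone? _ _ →-dec
             ((((_ ≟ _) ×-dec (_ ≟ _)) ⊎-dec ((_ ≟ _) ×-dec (_ ≟ _))) ⊎-dec
              (((_ ≟ _) ×-dec (_ ≟ _)) ⊎-dec ((_ ≟ _) ×-dec (_ ≟ _)))) })
        refl {z} good p -[1+ 1 ]
        (v , s , trans (sym (step-at z p 1ℤ)) t)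
    ... | inj₁ (inj₁ (x , y)) = 2⃗ , x , trans (cong z (lemma p)) y
      where
      lemma : ∀ p → p + -[1+ 1 ] + 1ℤ ≡ p + -1ℤ
      lemma = solve-∀
    ... | inj₁ (inj₂ (x , y)) = 1⃗ , x , trans (cong z (lemma p)) y
      where
      lemma : ∀ p → p + -1ℤ + 1ℤ ≡ p + 0ℤ
      lemma = solve-∀
    ... | inj₂ (inj₁ (x , y)) = -1⃗ , x , trans (cong z (lemma p)) y
      where
      lemma : ∀ p → p + 1ℤ + 1ℤ ≡ p + + 2
      lemma = solve-∀
    ... | inj₂ (inj₂ (x , y)) = -2⃗ , x , trans (cong z (lemma p)) y
      where
      lemma : ∀ p → p + + 2 + 1ℤ ≡ p + + 3
      lemma = solve-∀

    -- A merger only removes stones: wherever a stone survives, the cells beside it are those of the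
    -- step without marks.
    marks-erase : ∀ p v → Stone (step z) p v → Stone (step (plain ∘ z)) p v
    marks-erase p v (s , t) =
      let (x , y) = locally 2
            (λ { (a ∷ b ∷ c ∷ d ∷ e ∷ f ∷ []) →
                 ∃ (λ v → advance (a ∷ b ∷ c ∷ d ∷ e ∷ []) ≡ source v × advance (b ∷ c ∷ d ∷ e ∷ f ∷ []) ≡ target v) →
                 advance (map plain (a ∷ b ∷ c ∷ d ∷ e ∷ [])) ≡ advance (a ∷ b ∷ c ∷ d ∷ e ∷ []) ×
                 advance (map plain (b ∷ c ∷ d ∷ e ∷ f ∷ [])) ≡ advance (b ∷ c ∷ d ∷ e ∷ f ∷ []) })
            (λ { (a ∷ b ∷ c ∷ d ∷ e ∷ f ∷ []) → stone? _ _ →-dec ((_ ≟ _) ×-dec (_ ≟ _)) })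
            refl {z} good p -[1+ 1 ] (v , s , trans (sym (step-at z p 1ℤ)) t)
      in trans x s , trans (step-at (plain ∘ z) p 1ℤ) (trans y (trans (sym (step-at z p 1ℤ)) t))

    -- In `B⁻ A⁻ B⁻` around p the left stone would jump from p - 1 to p - 2 and become `1⃗` by FIX;
    -- marking the middle cell removes it. It witnesses that a merger strictly lowers the number of
    -- stones.
    marked-stone : ∀ p → z p ≡ A× →
      Stone (step (plain ∘ z)) (p + -[1+ 1 ]) 1⃗ × (∀ v → ¬ Stone (step z) (p + -[1+ 1 ]) v)
    marked-stone p e =
      let (x , y , n) = locally 2
            (λ { (a ∷ b ∷ c ∷ d ∷ e ∷ f ∷ []) → e ≡ A× →
                 advance (map plain (a ∷ b ∷ c ∷ d ∷ e ∷ [])) ≡ A⁻ ×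
                 advance (map plain (b ∷ c ∷ d ∷ e ∷ f ∷ [])) ≡ B⁻ ×
                 ¬ ∃ (λ v → advance (a ∷ b ∷ c ∷ d ∷ e ∷ []) ≡ source v × advance (b ∷ c ∷ d ∷ e ∷ f ∷ []) ≡ target v) })
            (λ { (a ∷ b ∷ c ∷ d ∷ e ∷ f ∷ []) → (_ ≟ _) →-dec ((_ ≟ _) ×-dec ((_ ≟ _) ×-dec ¬? (stone? _ _))) })
            refl {z} good p -[1+ 3 ] (trans (at-0 z p) e)
      in (trans (step-at (plain ∘ z) p -[1+ 1 ]) x , trans (step-at-1 (plain ∘ z) p -[1+ 1 ]) y)
       , λ v (s , t) → n (v , trans (sym (step-at z p -[1+ 1 ])) s , trans (sym (step-at-1 z p -[1+ 1 ])) t)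

    module _ (unmarked : Unmarked z) where

      stone-or-toggle : ∀ p → ∃ (Stone z p) ⊎ z (p + 1ℤ) ≡ toggle (z p)
      stone-or-toggle p = subst (λ c → ∃ (λ v → c ≡ source v × z (p + 1ℤ) ≡ target v) ⊎ z (p + 1ℤ) ≡ toggle c) (at-0 z p)
        (locally 1
          (λ { (a ∷ b ∷ c ∷ d ∷ e ∷ []) → a ≢ A× → b ≢ A× →
               ∃ (λ v → a ≡ source v × b ≡ target v) ⊎ b ≡ toggle a })
          (λ { (a ∷ b ∷ c ∷ d ∷ e ∷ []) → ¬? (_ ≟ _) →-dec (¬? (_ ≟ _) →-dec (stone? _ _ ⊎-dec (_ ≟ _))) })
          refl {z} good p 0ℤ (unmarked (p + 0ℤ)) (unmarked (p + 1ℤ)))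

    zone-length : ∀ p → z p ≡ A⁻ → (z (p + 1ℤ) ≡ B⁻ ⊎ z (p + 1ℤ) ≡ B⁺) →
      z (p + + 2) ≢ A⁻ × z (p + + 3) ≢ A⁻ × (z (p + + 4) ≡ A⁻ → z (p + 1ℤ) ≡ B⁻ × z (p + + 3) ≡ B⁻)
    zone-length p s t = locally 1
      (λ { (a ∷ b ∷ c ∷ d ∷ e ∷ []) → a ≡ A⁻ → (b ≡ B⁻ ⊎ b ≡ B⁺) →
           c ≢ A⁻ × d ≢ A⁻ × (e ≡ A⁻ → b ≡ B⁻ × d ≡ B⁻) })
      (λ { (a ∷ b ∷ c ∷ d ∷ e ∷ []) → (_ ≟ _) →-dec (((_ ≟ _) ⊎-dec (_ ≟ _)) →-dec
           (¬? (_ ≟ _) ×-dec (¬? (_ ≟ _) ×-dec ((_ ≟ _) →-dec ((_ ≟ _) ×-dec (_ ≟ _)))))) })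
      refl {z} good p 0ℤ (trans (at-0 z p) s) t

-- Periodic patterns and the marking of mergers

module Patterns where
  open import Data.Fin.Base using (opposite)
  open import Data.Fin.Properties using (toℕ-injective; toℕ-fromℕ<; opposite-prop; toℕ<n)
  open import Data.Integer.Base using (_+_; _*_)
  open import Data.Nat.Base using (suc)
  open import Data.Nat.DivMod using (_/_; _mod_; m≡m%n+[m/n]*n; m%n<n; [m+n]%n≡m%n; m<n⇒m%n≡m)
  open SubsetSums
  open Transfer
  open Circle
  open Cells
  open LocalRules

  private
    mod-+ : ∀ k n → (k ℕ.+ suc n) mod suc n ≡ k mod suc n
    mod-+ k n = toℕ-injective (trans (toℕ-fromℕ< (m%n<n (k ℕ.+ suc n) (suc n)))
      (trans ([m+n]%n≡m%n k (suc n)) (sym (toℕ-fromℕ< (m%n<n k (suc n))))))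

    mod-toℕ : ∀ {n} (i : Fin (suc n)) → toℕ i mod suc n ≡ i
    mod-toℕ {n} i = toℕ-injective (trans (toℕ-fromℕ< (m%n<n (toℕ i) (suc n))) (m<n⇒m%n≡m (toℕ<n i)))

  -- `-[1+ k ]` is congruent to n - k modulo n + 1, and `opposite` subtracts from n.
  residue : ∀ n → ℤ → Fin (suc n)
  residue n (+ k)    = k mod suc n
  residue n -[1+ k ] = opposite (k mod suc n)

  residue-periodic : ∀ n → Periodic (suc n) (residue n)
  residue-periodic n (+ k) = mod-+ k n
  residue-periodic n -[1+ k ] with k ℕ.<? suc n
  ... | yes k<N = trans (cong (residue n) (ℤ.⊖-≥ k<N)) (toℕ-injective
        (trans (toℕ-fromℕ< (m%n<n (n ℕ.∸ k) (suc n)))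
        (trans (m<n⇒m%n≡m (ℕ.s≤s (ℕ.m∸n≤m n k)))
        (sym (trans (opposite-prop (k mod suc n)) (cong (n ℕ.∸_)
          (trans (toℕ-fromℕ< (m%n<n k (suc n))) (m<n⇒m%n≡m k<N))))))))
  ... | no k≮N with ℕ.m≤n⇒∃[o]m+o≡n (ℕ.≮⇒≥ k≮N)
  ...   | j , refl = trans (cong (residue n) (wrap n j)) (cong opposite (sym
        (trans (cong (λ a → a mod suc n) (ℕ.+-comm (suc n) j)) (mod-+ j n))))
    where
    wrap : ∀ n j → suc n ℤ.⊖ suc (suc n ℕ.+ j) ≡ -[1+ j ]
    wrap n j = trans (cong (suc n ℤ.⊖_) (sym (ℕ.+-suc (suc n) j)))
      (trans (cong (λ a → a ℤ.⊖ (suc n ℕ.+ suc j)) (sym (ℕ.+-identityʳ (suc n))))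
             (ℤ.+-cancelˡ-⊖ (suc n) 0 (suc j)))

  extend : ∀ {n} → Subset (suc n) → ℤ → Bool
  extend c p = lookup c (residue _ p)

  extend-periodic : ∀ {n} (c : Subset (suc n)) → Periodic (suc n) (extend c)
  extend-periodic c p = cong (lookup c) (residue-periodic _ p)

  extend-at : ∀ {n} (c : Subset (suc n)) i → extend c (+ toℕ i) ≡ lookup c i
  extend-at c i = cong (lookup c) (mod-toℕ i)

  module _ {n : ℕ} {X : Set} {z : ℤ → X} (periodic : Periodic (suc n) z) where

    periodic-* : ∀ q t → z (q + + t * + suc n) ≡ z q
    periodic-* q ℕ.zero  = cong z (ℤ.+-identityʳ q)
    periodic-* q (suc t) = trans (cong z (lemma q (+ t) (+ suc n)))
      (trans (periodic (q + + t * + suc n)) (periodic-* q t))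
      where
      lemma : ∀ q t s → q + (1ℤ + t) * s ≡ q + t * s + s
      lemma = solve-∀

    at-residue⁺ : ∀ k → z (+ k) ≡ z (+ toℕ (residue n (+ k)))
    at-residue⁺ k = trans (cong z (trans (cong +_ (trans (m≡m%n+[m/n]*n k (suc n))
         (cong (ℕ._+ (k / suc n) ℕ.* suc n) (sym (toℕ-fromℕ< (m%n<n k (suc n)))))))
         (cong (λ a → + toℕ (residue n (+ k)) + a) (ℤ.pos-* (k / suc n) (suc n)))))
       (periodic-* (+ toℕ (residue n (+ k))) (k / suc n))

  at-residue : ∀ {n} {X : Set} {z : ℤ → X} → Periodic (suc n) z → ∀ p → z p ≡ z (+ toℕ (residue n p))
  at-residue pz (+ k) = at-residue⁺ pz k
  at-residue {n} {z = z} pz p@(-[1+ k ]) = begin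
    z p                                  ≡⟨ periodic-* pz p (suc k) ⟨
    z (p + + suc k * + suc n)            ≡⟨ cong z shift ⟩
    z (+ j)                              ≡⟨ at-residue⁺ pz j ⟩
    z (+ toℕ (residue n (+ j)))          ≡⟨ cong (λ q → z (+ toℕ (residue n q))) shift ⟨
    z (+ toℕ (residue n (p + + suc k * + suc n))) ≡⟨ cong (λ i → z (+ toℕ i)) (periodic-* (residue-periodic n) p (suc k)) ⟩
    z (+ toℕ (residue n p))              ∎
    where
    open ≡-Reasoning
    -- Adding k + 1 periods suffices to lift `-[1+ k ]` to a natural number.
    j = suc k ℕ.* suc n ℕ.∸ suc k
    shift : p + + suc k * + suc n ≡ + j
    shift = trans (cong (λ a → p + a) (sym (ℤ.pos-* (suc k) (suc n)))) (ℤ.⊖-≥ (ℕ.m≤m*n (suc k) (suc n)))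

  extend-window : ∀ {n x} → Periodic (suc n) x → ∀ p → extend (window (suc n) x) p ≡ x p
  extend-window {n} {x} px p = trans (lookup-window x (residue n p)) (sym (at-residue px p))

  window-extend : ∀ {n} (c : Subset (suc n)) → window (suc n) (extend c) ≡ c
  window-extend c = lookup-ext _ _ λ i → trans (lookup-window (extend c) i) (extend-at c i)

  record Pattern (N : ℕ) (z : ℤ → Cell) : Set where
    field
      good     : Good z
      unmarked : Unmarked z
      periodic : Periodic N z

  module _ {N : ℕ} where

    segment-periodic : ∀ {X : Set} {z : ℤ → X} → Periodic N z → ∀ p a n →
                       segment z (p + + N) a n ≡ segment z p a n
    segment-periodic {z = z} pz p a n = trans (sym (segment-∘+ z (+ N) p a n)) (segment-cong pz p a n)

    module _ {z : ℤ → Cell} (pz : Periodic N z) where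

      firstRow-periodic : Periodic N (firstRow z)
      firstRow-periodic p = cong presentᵇ (segment-periodic pz p -1ℤ 3)

      secondGap-periodic : Periodic N (secondGap z)
      secondGap-periodic p = cong missingᵇ (segment-periodic pz p -1ℤ 3)

      meeting-periodic : Periodic N (meeting z)
      meeting-periodic p = cong meetingᵇ (segment-periodic pz p -1ℤ 3)

      step-periodic : Periodic N (step z)
      step-periodic p = cong advance (segment-periodic pz p -[1+ 1 ] 5)

    step-pattern : ∀ {z} → Pattern N z → Pattern N (step z)
    step-pattern {z} P = record
      { good = step-good {z} good ; unmarked = step-unmarked {z} good ; periodic = step-periodic periodic }
      where open Pattern P

  -- The argument c marks the meeting places where FIX is applied; at all others the zones merge.
  mark : (ℤ → Cell) → (ℤ → Bool) → ℤ → Cell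
  mark z c p = if meeting z p ∧ not (c p) then A× else z p

  module _ {z : ℤ → Cell} (good : Good z) (unmarked : Unmarked z) (c : ℤ → Bool) where

    private
      meeting-elim : ∀ p → meeting z p ≡ true → z (p + -1ℤ) ≡ B⁻ × z p ≡ A⁻ × z (p + 1ℤ) ≡ B⁻
      meeting-elim p e =
        let (x , y , w) = go (z (p + -1ℤ)) (z (p + 0ℤ)) (z (p + 1ℤ)) (unmarked (p + 0ℤ)) e
        in x , trans (sym (at-0 z p)) y , w
        where
        go : ∀ a b c → b ≢ A× → meetingᵇ (a ∷ b ∷ c ∷ []) ≡ true → a ≡ B⁻ × b ≡ A⁻ × c ≡ B⁻
        go B⁻ A⁻ B⁻ _ _ = refl , refl , refl
        go B⁻ A× B⁻ b≢ _ = ⊥-elim (b≢ refl)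

      mark-fixed : ∀ p → z p ≡ B⁻ → mark z c p ≡ B⁻
      mark-fixed p e with meeting z p in m
      ... | false = e
      ... | true with () ← trans (sym e) (proj₁ (proj₂ (meeting-elim p m)))

    unmarked-plain : ∀ q → plain (z q) ≡ z q
    unmarked-plain q with z q in e
    ... | A⁺ = refl
    ... | A⁻ = refl
    ... | B⁻ = refl
    ... | B⁺ = refl
    ... | A× = ⊥-elim (unmarked q e)

    plain-mark : ∀ p → plain (mark z c p) ≡ z p
    plain-mark p with meeting z p in m | c p
    ... | false | _     = unmarked-plain p
    ... | true  | false = sym (proj₁ (proj₂ (meeting-elim p m)))
    ... | true  | true  = trans (cong plain (proj₁ (proj₂ (meeting-elim p m)))) (sym (proj₁ (proj₂ (meeting-elim p m))))

    private
      not-marked : ∀ {a b d} → b ≢ A× → markᵇ a b d ≡ true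
      not-marked {a} {b} {d} b≢ = cong (λ x → not x ∨ ((a ≡ᵇ B⁻) ∧ (d ≡ᵇ B⁻))) (dec-false (b ≟ A×) b≢)

      mark-marks : ∀ p → markᵇ (mark z c (p + -1ℤ)) (mark z c p) (mark z c (p + 1ℤ)) ≡ true
      mark-marks p with meeting z p in m | c p
      ... | true | false rewrite mark-fixed (p + -1ℤ) (proj₁ (meeting-elim p m))
                               | mark-fixed (p + 1ℤ) (proj₂ (proj₂ (meeting-elim p m))) = refl
      ... | true  | true  = not-marked {mark z c (p + -1ℤ)} {d = mark z c (p + 1ℤ)} (unmarked p)
      ... | false | _     = not-marked {mark z c (p + -1ℤ)} {d = mark z c (p + 1ℤ)} (unmarked p)

      marks-at : ∀ p q r s → q + -1ℤ ≡ p → q + 1ℤ ≡ r → q ≡ s →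
                 markᵇ (mark z c p) (mark z c s) (mark z c r) ≡ true
      marks-at p q r .q refl refl refl = mark-marks q

    -- Erasing the marks restores z, and both cells beside a meeting place are `B⁻`, hence carry no
    -- mark themselves.
    mark-good : Good (mark z c)
    mark-good p = ∧-join
      (trans (cong plainGoodᵇ (trans (sym (segment-map plain (mark z c) p 0ℤ 5)) (segment-cong plain-mark p 0ℤ 5)))
             (trans (cong plainGoodᵇ (trans (sym (segment-cong unmarked-plain p 0ℤ 5)) (segment-map plain z p 0ℤ 5)))
                    (proj₁ (∧-split (good p)))))
      (∧-join (marks-at _ (p + + 1) _ _ (l₁ p) (r₁ p) refl)
      (∧-join (marks-at _ (p + + 2) _ _ (l₂ p) (r₂ p) refl) (marks-at _ (p + + 3) _ _ (l₃ p) (r₃ p) refl)))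
      where
      l₁ : ∀ p → p + + 1 + -1ℤ ≡ p + + 0
      l₁ = solve-∀
      r₁ : ∀ p → p + + 1 + 1ℤ ≡ p + + 2
      r₁ = solve-∀
      l₂ : ∀ p → p + + 2 + -1ℤ ≡ p + + 1
      l₂ = solve-∀
      r₂ : ∀ p → p + + 2 + 1ℤ ≡ p + + 3
      r₂ = solve-∀
      l₃ : ∀ p → p + + 3 + -1ℤ ≡ p + + 2
      l₃ = solve-∀
      r₃ : ∀ p → p + + 3 + 1ℤ ≡ p + + 4
      r₃ = solve-∀

    private
      -- In good words neither rows nor meeting places distinguish `A×` from `A⁻`.
      unaffected : ∀ (g : Vec Cell 3 → Bool) →
        search 1 (λ { (_ ∷ a ∷ b ∷ d ∷ _) → does (g (a ∷ b ∷ d ∷ []) Bool.≟ g (plain a ∷ plain b ∷ plain d ∷ [])) }) ≡ true →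
        ∀ p → g (segment (mark z c) p -1ℤ 3) ≡ g (segment z p -1ℤ 3)
      unaffected g e p = trans
        (locally 1 (λ { (_ ∷ a ∷ b ∷ d ∷ _) → g (a ∷ b ∷ d ∷ []) ≡ g (plain a ∷ plain b ∷ plain d ∷ []) })
           (λ { (_ ∷ a ∷ b ∷ d ∷ _) → _ Bool.≟ _ }) e {mark z c} mark-good p -[1+ 1 ])
        (cong g (trans (sym (segment-map plain (mark z c) p -1ℤ 3)) (segment-cong plain-mark p -1ℤ 3)))

    firstRow-mark : ∀ p → firstRow (mark z c) p ≡ firstRow z p
    firstRow-mark = unaffected presentᵇ refl

    secondGap-mark : ∀ p → secondGap (mark z c) p ≡ secondGap z p
    secondGap-mark = unaffected missingᵇ refl

    meeting-mark : ∀ p → meeting (mark z c) p ≡ meeting z p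
    meeting-mark = unaffected meetingᵇ refl

    chosen-mark : ∀ p → chosen (mark z c) p ≡ meeting z p ∧ c p
    chosen-mark p = trans (cong (λ b → meeting (mark z c) p ∧ not (b ≡ᵇ A×)) (at-0 (mark z c) p))
      (trans (cong (_∧ not (mark z c p ≡ᵇ A×)) (meeting-mark p)) marked)
      where
      marked : meeting z p ∧ not (mark z c p ≡ᵇ A×) ≡ meeting z p ∧ c p
      marked with meeting z p in m | c p
      ... | false | _     = refl
      ... | true  | false = refl
      ... | true  | true  rewrite proj₁ (proj₂ (meeting-elim p m)) = refl

  mark-periodic : ∀ {N z c} → Periodic N z → Periodic N c → Periodic N (mark z c)
  mark-periodic pz pc p = cong₂ (λ b a → if b then A× else a)
    (cong₂ (λ a b → a ∧ not b) (meeting-periodic pz p) (pc p)) (pz p)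

-- The recurrence for the series of a pattern

module Recurrence where
  open import Data.Integer.Base using (_+_; _*_)
  open import Data.Nat.Base using (suc)
  open SubsetSums
  open Transfer
  open GridRows
  open Circle
  open Cells
  open LocalRules
  open Patterns

  not-true : ∀ {b} → ¬ (b ≡ true) → b ≡ false
  not-true {false} _ = refl
  not-true {true}  n = ⊥-elim (n refl)

  true≢false : ∀ {b} → b ≡ true → ¬ (b ≡ false)
  true≢false refl ()

  not-elim : ∀ {b} → not b ≡ true → b ≡ false
  not-elim {false} _ = refl

  not-intro : ∀ {b} → b ≡ false → not b ≡ true
  not-intro refl = refl

  -- The grid has m + 1 rows, since m counts the rows beyond the first.
  patternZ : ℕ → ℕ → (ℤ → Cell) → ℤ
  patternZ N m z = G (cycle N) m (window N (firstRow z)) (window N (secondGap z))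

  patternZ-cong : ∀ N m {y z} → y ≗ z → patternZ N m y ≡ patternZ N m z
  patternZ-cong N m {y} {z} e = cong₂ (G (cycle N) m)
    (window-cong λ p → cong presentᵇ (segment-cong e p -1ℤ 3))
    (window-cong λ p → cong missingᵇ (segment-cong e p -1ℤ 3))

  module _ {n : ℕ} where
    private
      N = suc (suc n)
      H = cycle N
    open Graph H using (_∼_)

    window-nonadjacent : ∀ {x} → Periodic N x → (∀ p → x p ∧ x (p + 1ℤ) ≡ false) →
      ∀ i j → window N x ∋ i → window N x ∋ j → ¬ i ∼ j
    window-nonadjacent {x} px nonadj i j i∈ j∈ = avoids-neighbours {x = x} px i
      (not-true λ e → true≢false (∧-join xi e) (nonadj (+ toℕ i)))
      (not-true λ e → true≢false (∧-join e (trans (cong x (sym (cancel (+ toℕ i)))) xi)) (nonadj (+ toℕ i + -1ℤ)))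
      j j∈
      where
      xi = trans (sym (lookup-window x i)) i∈
      cancel : ∀ p → p ≡ p + -1ℤ + 1ℤ
      cancel = solve-∀

    module _ {z : ℤ → Cell} (P : Pattern N z) where
      open Pattern P

      sectors : Subset N
      sectors = window N (meeting z)

      successor : Subset N → ℤ → Cell
      successor c = step (mark z (extend c))

      private
        A = window N (firstRow z)
        B = window N (secondGap z)
        A* = window N (free {z} good)
        row : ∀ i → lookup A i ≡ firstRow z (+ toℕ i)
        row = lookup-window (firstRow z)
        gap : ∀ i → lookup B i ≡ secondGap z (+ toℕ i)
        gap = lookup-window (secondGap z)
        free-at : ∀ i → lookup A* i ≡ free {z} good (+ toℕ i)
        free-at = lookup-window (free {z} good)
        pA = firstRow-periodic {N} periodic

        module _ (c : Subset N) (c⊆ : ∀ x → c ∋ x → sectors ∋ x) where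
          z′ = mark z (extend c)

          good′ : Good z′
          good′ = mark-good {z} good unmarked (extend c)

          chosen≡extend : ∀ p → chosen z′ p ≡ extend c p
          chosen≡extend p = trans (chosen-mark {z} good unmarked (extend c) p) (absorb λ e →
            trans (sym (extend-window (meeting-periodic {N} periodic) p)) (c⊆ (residue _ p) e))
            where
            absorb : ∀ {a b} → (b ≡ true → a ≡ true) → a ∧ b ≡ b
            absorb {true}          f = refl
            absorb {false} {false} f = refl
            absorb {false} {true}  f = f refl

          free-mark : ∀ p → free {z′} good′ p ≡ free {z} good p
          free-mark p = cong₂ _∧_ (cong not (firstRow-mark {z} good unmarked (extend c) p))
            (cong₂ _∧_ (cong not (secondGap-mark {z} good unmarked (extend c) p))
            (cong₂ _∧_ (cong not (firstRow-mark {z} good unmarked (extend c) (p + 1ℤ)))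
                       (cong not (firstRow-mark {z} good unmarked (extend c) (p + -1ℤ)))))

          new-row : ∀ p → firstRow (step z′) p ≡
            free {z} good p ∧ not (meeting z p) ∧ not (extend c (p + 1ℤ)) ∧ not (extend c (p + -1ℤ))
          new-row p = trans (firstRow-step {z′} good′ p) (cong₂ _∧_ (free-mark p)
            (cong₂ _∧_ (cong not (meeting-mark {z} good unmarked (extend c) p))
            (cong₂ _∧_ (cong not (chosen≡extend (p + 1ℤ))) (cong not (chosen≡extend (p + -1ℤ))))))

          new-gap : window N (secondGap (step z′)) ≡ c ∪ A
          new-gap = lookup-ext _ _ λ i → trans (lookup-window (secondGap (step z′)) i)
            (trans (secondGap-step {z′} good′ (+ toℕ i))
            (trans (cong₂ _∨_ (firstRow-mark {z} good unmarked (extend c) (+ toℕ i))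
                              (trans (chosen≡extend (+ toℕ i)) (extend-at c i)))
            (trans (∨-comm (firstRow z (+ toℕ i)) (lookup c i))
                   (sym (trans (∪-∋ c A i) (cong (lookup c i ∨_) (row i)))))))
            where open import Data.Bool.Properties using (∨-comm)

          c-avoids : ∀ i → extend c (+ toℕ i + 1ℤ) ≡ false → extend c (+ toℕ i + -1ℤ) ≡ false →
                     ∀ y → c ∋ y → ¬ i ∼ y
          c-avoids i r l y y∈ = avoids-neighbours {x = extend c} (extend-periodic c) i r l y
            (trans (cong (λ s → lookup s y) (window-extend c)) y∈)

          c-avoided : ∀ i → (∀ y → c ∋ y → ¬ i ∼ y) →
                      extend c (+ toℕ i + 1ℤ) ≡ false × extend c (+ toℕ i + -1ℤ) ≡ false
          c-avoided i av = neighbours-avoided {x = extend c} (extend-periodic c) i λ y y∈ →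
            av y (trans (cong (λ s → lookup s y) (sym (window-extend c))) y∈)

      first-step : ∀ m → patternZ N (suc m) z ≡ sgn (window N (firstRow z)) * G H m A* A
      first-step m = G-step H m A B A*
        (window-nonadjacent {x = firstRow z} pA (firstRow-nonadjacent {z} good))
        (λ i i∈A i∈B → true≢false (∧-join (trans (sym (row i)) i∈A) (trans (sym (gap i)) i∈B)) (rows-disjoint {z} good (+ toℕ i)))
        (λ i i∈ → let (a , e) = ∧-split {not (firstRow z (+ toℕ i))} (trans (sym (free-at i)) i∈)
                      (b , e′) = ∧-split {not (secondGap z (+ toℕ i))} e
                      (r , l) = ∧-split {not (firstRow z (+ toℕ i + 1ℤ))} e′ in
          (λ i∈A → true≢false (trans (sym (row i)) i∈A) (not-elim a))
          , (λ i∈B → true≢false (trans (sym (gap i)) i∈B) (not-elim b))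
          , avoids-neighbours {x = firstRow z} pA i (not-elim r) (not-elim l))
        (λ i i∉A i∉B av → let (r , l) = neighbours-avoided {x = firstRow z} pA i av in
          trans (free-at i) (∧-join (not-intro (not-true λ e → i∉A (trans (row i) e)))
            (∧-join (not-intro (not-true λ e → i∉B (trans (gap i) e)))
            (∧-join (not-intro r) (not-intro l)))))

      second-step : ∀ m → G H m A* A ≡
        sumOverSubsets λ c → 𝟙 (c ⊆ᵇ sectors) * (sgn c * patternZ N m (successor c))
      second-step m = trans
        (G-split H m A* A sectors (λ c → window N (firstRow (successor c)))
          (λ i i∈ → trans (free-at i) (unfree (meet-at i i∈) (meeting-free {z} good (+ toℕ i))))
          (window-nonadjacent {x = meeting z} (meeting-periodic periodic) (meeting-nonadjacent {z} good))
          λ c c⊆ →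
            (λ i i∈ → let (fr , e) = ∧-split {free {z} good (+ toℕ i)} (trans (sym (trans (lookup-window (firstRow (successor c)) i) (new-row c c⊆ (+ toℕ i)))) i∈)
                          (nm , e′) = ∧-split {not (meeting z (+ toℕ i))} e
                          (r , l) = ∧-split {not (extend c (+ toℕ i + 1ℤ))} e′ in
              trans (free-at i) fr
              , (λ i∈C → true≢false (meet-at i i∈C) (not-elim nm))
              , c-avoids c c⊆ i (not-elim r) (not-elim l))
            , (λ i i∈A* i∉C av → let (r , l) = c-avoided c c⊆ i av in
              trans (lookup-window (firstRow (successor c)) i) (trans (new-row c c⊆ (+ toℕ i))
                (∧-join (trans (sym (free-at i)) i∈A*)
                (∧-join (not-intro (not-true λ e → i∉C (trans (lookup-window (meeting z) i) e)))
                (∧-join (not-intro r) (not-intro l)))))))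
        (sum-cong gaps)
        where
        meet-at : ∀ i → sectors ∋ i → meeting z (+ toℕ i) ≡ true
        meet-at i i∈ = trans (sym (lookup-window (meeting z) i)) i∈

        unfree : ∀ {a b} → a ≡ true → a ∧ not b ≡ false → b ≡ true
        unfree {true} {true} _ _ = refl

        gaps : ∀ c → 𝟙 (c ⊆ᵇ sectors) * (sgn c * G H m (window N (firstRow (successor c))) (c ∪ A)) ≡
                     𝟙 (c ⊆ᵇ sectors) * (sgn c * patternZ N m (successor c))
        gaps c = 𝟙-cong (c ⊆ᵇ sectors) λ e →
          cong (λ B → sgn c * G H m (window N (firstRow (successor c))) B) (sym (new-gap c (⊆ᵇ-elim c sectors e)))

      -- The sum runs over the sets c of meeting places that receive FIX: `sectors P` itself belongs
      -- to T, and every smaller c involves mergers.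
      recurrence : ∀ m → patternZ N (suc m) z ≡ sgn (window N (firstRow z)) *
        sumOverSubsets λ c → 𝟙 (c ⊆ᵇ sectors) * (sgn c * patternZ N m (successor c))
      recurrence m = trans (first-step m) (cong (sgn (window N (firstRow z)) *_) (second-step m))

-- Initial patterns from the odd vertices of the first row

module Initial where
  open import Data.Fin.Subset using (⊤; ⊥)
  open import Data.Fin.Subset.Properties using (∪-identityʳ)
  open import Data.Integer.Base using (_+_; _*_)
  open import Data.Nat.Base using (suc)
  open import Data.Vec.Properties using (lookup-replicate)
  open SubsetSums
  open Transfer
  open GridRows
  open Circle
  open Cells
  open LocalRules
  open Patterns
  open Recurrence

  odd : ℤ → Bool
  odd (+ 0)        = false
  odd (+ suc k)    = not (odd (+ k))
  odd -[1+ 0 ]     = true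
  odd -[1+ suc k ] = not (odd -[1+ k ])

  odd-suc : ∀ p → odd (p + 1ℤ) ≡ not (odd p)
  odd-suc (+ k)        = cong (odd ∘ +_) (ℕ.+-comm k 1)
  odd-suc -[1+ 0 ]     = refl
  odd-suc -[1+ suc k ] = sym (Bool.not-involutive (odd -[1+ k ]))

  odd-pred : ∀ p → odd (p + -1ℤ) ≡ not (odd p)
  odd-pred p = trans (sym (Bool.not-involutive (odd (p + -1ℤ))))
    (cong not (trans (sym (odd-suc (p + -1ℤ))) (cong odd (cancel p))))
    where
    cancel : ∀ p → p + -1ℤ + 1ℤ ≡ p
    cancel = solve-∀

  -- Evenness of the length enters here: only then is the parity of a place defined on the circle.
  odd-periodic : ∀ h → Periodic (h ℕ.+ h) odd
  odd-periodic 0       p = cong odd (ℤ.+-identityʳ p)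
  odd-periodic (suc h) p = trans (cong odd (trans (cong (λ k → p + + suc k) (ℕ.+-suc h h)) (lemma p (+ (h ℕ.+ h)))))
    (trans (odd-suc (p + + (h ℕ.+ h) + 1ℤ)) (trans (cong not (odd-suc (p + + (h ℕ.+ h))))
    (trans (Bool.not-involutive _) (odd-periodic h p))))
    where
    lemma : ∀ p s → p + (1ℤ + (1ℤ + s)) ≡ p + s + 1ℤ + 1ℤ
    lemma = solve-∀

  -- The arguments are the parity of a place and the membership in c of its left neighbour, itself
  -- and its right neighbour. Even places without a neighbour in c stay in the first row, and odd
  -- places in c are missing from the second. Every zone B begins and ends with `B⁻`, so all stones
  -- have length 1.
  initialCell : Bool → Bool → Bool → Bool → Cell
  initialCell true  _ b _ = if b then B⁺ else A⁻
  initialCell false a _ d = if a ∨ d then B⁻ else A⁺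

  -- A segment of `initial c` depends on one parity and finitely many values of c, so its local
  -- properties are decided on Boolean words.
  initialWord : ∀ {n} → Bool → Vec Bool (2 ℕ.+ n) → Vec Cell n
  initialWord {0}     o _               = []
  initialWord {suc n} o (a ∷ b ∷ d ∷ w) = initialCell o a b d ∷ initialWord (not o) (b ∷ d ∷ w)

  initial : (ℤ → Bool) → ℤ → Cell
  initial c p = initialCell (odd p) (c (p + -1ℤ)) (c p) (c (p + 1ℤ))

  segment-initial : ∀ c p a n →
    segment (initial c) p a n ≡ initialWord (odd (p + a)) (segment c p (a + -1ℤ) (2 ℕ.+ n))
  segment-initial c p a 0       = refl
  segment-initial c p a (suc n) = cong₂ _∷_ head (trans (segment-initial c p (ℤ.suc a) n)
    (cong₂ initialWord (trans (cong odd (next-odd p a)) (odd-suc (p + a)))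
                       (cong (λ b → segment c p b (2 ℕ.+ n)) (ℤ.+-assoc 1ℤ a -1ℤ))))
    where
    next-odd : ∀ p a → p + (1ℤ + a) ≡ p + a + 1ℤ
    next-odd = solve-∀
    l₂ : ∀ p a → p + a ≡ p + (1ℤ + (a + -1ℤ))
    l₂ = solve-∀
    l₃ : ∀ p a → p + a + 1ℤ ≡ p + (1ℤ + (1ℤ + (a + -1ℤ)))
    l₃ = solve-∀
    head : initial c (p + a) ≡ initialCell (odd (p + a)) (c (p + (a + -1ℤ)))
             (c (p + ℤ.suc (a + -1ℤ))) (c (p + ℤ.suc (ℤ.suc (a + -1ℤ))))
    head = trans (cong (λ q → initialCell (odd (p + a)) (c q) (c (p + a)) (c (p + a + 1ℤ))) (ℤ.+-assoc p a -1ℤ))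
      (cong₂ (λ q r → initialCell (odd (p + a)) (c (p + (a + -1ℤ))) (c q) (c r)) (l₂ p a) (l₃ p a))

  private
    everyWord : ∀ n → (Vec Bool n → Bool) → Bool
    everyWord 0       q = q []
    everyWord (suc n) q = everyWord n (q ∘ (true ∷_)) ∧ everyWord n (q ∘ (false ∷_))

    everyWord-sound : ∀ n q → everyWord n q ≡ true → ∀ w → q w ≡ true
    everyWord-sound 0       q e []          = e
    everyWord-sound (suc n) q e (true  ∷ w) =
      everyWord-sound n (q ∘ (true ∷_)) (proj₁ (∧-split e)) w
    everyWord-sound (suc n) q e (false ∷ w) =
      everyWord-sound n (q ∘ (false ∷_)) (proj₂ (∧-split {everyWord n (q ∘ (true ∷_))} e)) w

    words : ∀ n (P : Vec Bool n → Set) (P? : ∀ w → Dec (P w)) → everyWord n (does ∘ P?) ≡ true → ∀ w → P w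
    words n P P? e w = does-elim (P? w) (everyWord-sound n (does ∘ P?) e w)

  module _ (c : ℤ → Bool) where

    initial-good : Good (initial c)
    initial-good p = trans (cong goodᵇ (segment-initial c p 0ℤ 5))
      (words 8 (λ { (o ∷ w) → goodᵇ (initialWord o w) ≡ true }) (λ { (o ∷ w) → _ Bool.≟ _ }) refl
         (odd (p + 0ℤ) ∷ segment c p -1ℤ 7))

    initial-unmarked : Unmarked (initial c)
    initial-unmarked p = go (odd p) (c (p + -1ℤ)) (c p) (c (p + 1ℤ))
      where
      go : ∀ o a b d → initialCell o a b d ≢ A×
      go true  _     true  _     ()
      go true  _     false _     ()
      go false true  _     _     ()
      go false false _     true  ()
      go false false _     false ()

    firstRow-initial : ∀ p → firstRow (initial c) p ≡ not (odd p) ∧ not (c (p + 1ℤ)) ∧ not (c (p + -1ℤ))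
    firstRow-initial p = trans (cong presentᵇ (segment-initial c p -1ℤ 3))
      (trans (words 6 (λ { (o ∷ w@(_ ∷ l ∷ _ ∷ r ∷ _ ∷ [])) → presentᵇ (initialWord o w) ≡ o ∧ not r ∧ not l })
               (λ { (o ∷ w@(_ ∷ l ∷ _ ∷ r ∷ _ ∷ [])) → _ Bool.≟ _ }) refl (odd (p + -1ℤ) ∷ segment c p -[1+ 1 ] 5))
             (cong (_∧ (not (c (p + 1ℤ)) ∧ not (c (p + -1ℤ)))) (odd-pred p)))

    secondGap-initial : ∀ p → secondGap (initial c) p ≡ odd p ∧ c p
    secondGap-initial p = trans (cong missingᵇ (segment-initial c p -1ℤ 3))
      (trans (words 6 (λ { (o ∷ w@(_ ∷ _ ∷ m ∷ _ ∷ _ ∷ [])) → missingᵇ (initialWord o w) ≡ not o ∧ m })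
               (λ { (o ∷ w@(_ ∷ _ ∷ m ∷ _ ∷ _ ∷ [])) → _ Bool.≟ _ }) refl (odd (p + -1ℤ) ∷ segment c p -[1+ 1 ] 5))
             (cong₂ _∧_ (trans (cong not (odd-pred p)) (Bool.not-involutive (odd p))) (at-0 c p)))

  initial-pattern : ∀ {N c} → Periodic N odd → Periodic N c → Pattern N (initial c)
  initial-pattern {N} {c} po pc = record
    { good = initial-good c ; unmarked = initial-unmarked c
    ; periodic = λ p → cong₂ (λ o (x : Bool × Bool × Bool) → initialCell o (proj₁ x) (proj₁ (proj₂ x)) (proj₂ (proj₂ x)))
        (po p) (cong₂ _,_ (periodic-shift′ -1ℤ p) (cong₂ _,_ (pc p) (periodic-shift′ 1ℤ p))) }
    where
    swap : ∀ p s r → p + s + r ≡ p + r + s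
    swap = solve-∀
    periodic-shift′ : ∀ r p → c (p + + N + r) ≡ c (p + r)
    periodic-shift′ r p = trans (cong c (swap p (+ N) r)) (pc (p + r))

  module _ {n : ℕ} (po : Periodic (suc (suc n)) odd) where
    private
      N = suc (suc n)
      H = cycle N
      odds = window N odd

    -- Sorting the independent sets of the first row by their odd elements.
    f-initial : ∀ m → f N (suc m) ≡
      sumOverSubsets λ c → 𝟙 (c ⊆ᵇ odds) * (sgn c * patternZ N m (initial (extend c)))
    f-initial m = trans (Z-grid-suc H m) (trans
      (G-split H m ⊤ ⊥ odds (λ c → window N (firstRow (initial (extend c))))
        (λ i _ → lookup-replicate i true)
        (window-nonadjacent {x = odd} po λ p → trans (cong (odd p ∧_) (odd-suc p)) (Bool.∧-inverseʳ (odd p)))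
        λ c c⊆ →
          (λ i i∈ → let (e , e′) = ∧-split {not (odd (+ toℕ i))} (trans (sym (row c i)) i∈)
                        (r , l) = ∧-split {not (extend c (+ toℕ i + 1ℤ))} e′ in
            lookup-replicate i true
            , (λ i∈C → true≢false (trans (sym (lookup-window odd i)) i∈C) (not-elim e))
            , λ y y∈ → avoids-neighbours {x = extend c} (extend-periodic c) i (not-elim r) (not-elim l) y
                (trans (cong (λ s → lookup s y) (window-extend c)) y∈))
          , (λ i _ i∉C av → let (r , l) = neighbours-avoided {x = extend c} (extend-periodic c) i λ y y∈ →
                                     av y (trans (cong (λ s → lookup s y) (sym (window-extend c))) y∈) in
            trans (row c i) (∧-join (not-intro (not-true λ e → i∉C (trans (lookup-window odd i) e)))
              (∧-join (not-intro r) (not-intro l)))))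
      (sum-cong λ c → 𝟙-cong (c ⊆ᵇ odds) λ e →
        cong (λ B → sgn c * G H m (window N (firstRow (initial (extend c)))) B) (gap c (⊆ᵇ-elim c odds e))))
      where
      row : ∀ c i → lookup (window N (firstRow (initial (extend c)))) i ≡ _
      row c i = trans (lookup-window (firstRow (initial (extend c))) i) (firstRow-initial (extend c) (+ toℕ i))

      absorb : ∀ {a b} → (b ≡ true → a ≡ true) → b ≡ a ∧ b
      absorb {true}          g = refl
      absorb {false} {false} g = refl
      absorb {false} {true}  g = sym (g refl)

      gap : ∀ c → (∀ x → c ∋ x → odds ∋ x) → c ∪ ⊥ ≡ window N (secondGap (initial (extend c)))
      gap c c⊆ = trans (∪-identityʳ c) (lookup-ext _ _ λ i →
        trans (absorb λ i∈c → trans (sym (lookup-window odd i)) (c⊆ i i∈c))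
        (sym (trans (lookup-window (secondGap (initial (extend c))) i)
          (trans (secondGap-initial (extend c) (+ toℕ i)) (cong (odd (+ toℕ i) ∧_) (extend-at c i))))))

-- Enumerating a periodic set of integers in increasing order

module Places where
  open import Data.Integer.Base using (_+_; _-_; -_; _<_; _≤_)
  open import Data.Nat.Base using (suc)
  open import Relation.Binary.Definitions using (tri<; tri≈; tri>)

  <⇒0<difference : ∀ {p q} → p < q → 0ℤ < q - p
  <⇒0<difference {p} {q} p<q = subst (_< q - p) (ℤ.+-inverseʳ p) (ℤ.+-monoˡ-< (- p) p<q)

  <-offset : ∀ {p q} → p < q → ∃ λ d → q ≡ p + + suc d
  <-offset {p} {q} p<q with q - p in e | <⇒0<difference p<q
  ... | + suc d | _ = d , trans (lemma p q) (cong (λ a → p + a) e)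
    where
    lemma : ∀ p q → q ≡ p + (q - p)
    lemma = solve-∀
  ... | + 0     | ℤ.+<+ ()

  offset-< : ∀ p d → p < p + + suc d
  offset-< p d = subst (_< p + + suc d) (ℤ.+-identityʳ p) (ℤ.+-monoʳ-< p (ℤ.+<+ (ℕ.s≤s ℕ.z≤n)))

  offset-cancel-< : ∀ p {a b} → p + a < p + b → a < b
  offset-cancel-< p {a} {b} l = subst₂ _<_ (lemma p a) (lemma p b) (ℤ.+-monoʳ-< (- p) l)
    where
    lemma : ∀ p a → - p + (p + a) ≡ a
    lemma = solve-∀

  ℤ-induction : (P : ℤ → Set) → P 0ℤ → (∀ i → P i → P (ℤ.suc i)) → (∀ i → P (ℤ.suc i) → P i) → ∀ i → P i
  ℤ-induction P base up down (+ 0)        = base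
  ℤ-induction P base up down (+ suc k)    = up (+ k) (ℤ-induction P base up down (+ k))
  ℤ-induction P base up down -[1+ 0 ]     = down -[1+ 0 ] base
  ℤ-induction P base up down -[1+ suc k ] = down -[1+ suc k ] (ℤ-induction P base up down -[1+ k ])

  module Increasing {pos : ℤ → ℤ} (step : ∀ i → pos i < pos (ℤ.suc i)) where

    private
      climb : ∀ i d → pos i < pos (i + + suc d)
      climb i 0       = subst (λ j → pos i < pos j) (ℤ.+-comm 1ℤ i) (step i)
      climb i (suc d) = ℤ.<-trans (climb i d) (subst (λ j → pos (i + + suc d) < pos j) (lemma i (+ suc d)) (step (i + + suc d)))
        where
        lemma : ∀ i a → 1ℤ + (i + a) ≡ i + (1ℤ + a)
        lemma = solve-∀

    mono : ∀ {i j} → i < j → pos i < pos j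
    mono {i} i<j with <-offset i<j
    ... | d , refl = climb i d

    reflects : ∀ {i j} → pos i < pos j → i < j
    reflects {i} {j} l with ℤ.<-cmp i j
    ... | tri< a _ _    = a
    ... | tri≈ _ refl _ = ⊥-elim (ℤ.<-irrefl refl l)
    ... | tri> _ _ c    = ⊥-elim (ℤ.<-asym l (mono c))

    injective : ∀ {i j} → pos i ≡ pos j → i ≡ j
    injective {i} {j} e with ℤ.<-cmp i j
    ... | tri< a _ _ = ⊥-elim (ℤ.<-irrefl e (mono a))
    ... | tri≈ _ e _ = e
    ... | tri> _ _ c = ⊥-elim (ℤ.<-irrefl (sym e) (mono c))

  private
    least : ∀ {P : ℕ → Set} (P? : ∀ d → Dec (P d)) n → P n → ∃ λ m → P m × (∀ j → j ℕ.< m → ¬ P j)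
    least P? 0       p = 0 , p , λ _ ()
    least {P} P? (suc n) p with P? 0
    ... | yes p₀ = 0 , p₀ , λ _ ()
    ... | no ¬p₀ with least {λ d → P (suc d)} (λ d → P? (suc d)) n p
    ...   | m , q , below = suc m , q , λ { 0 _ → ¬p₀ ; (suc j) (ℕ.s≤s l) → below j l }

  module Enumeration {E : ℤ → Set} (E? : ∀ p → Dec (E p)) {n : ℕ}
    (up : ∀ p → E p → E (p + + suc n)) (down : ∀ p → E (p + + suc n) → E p)
    {p₀ : ℤ} (e₀ : E p₀) where

    record Consecutive (p q : ℤ) : Set where
      field
        here    : E p
        there   : E q
        before  : p < q
        between : ∀ r → p < r → r < q → ¬ E r
    open Consecutive

    -- Periodicity puts an element at distance n + 1, which bounds the search for the nearest one.
    successor : ∀ p → E p → ∃ (Consecutive p)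
    successor p e with least {λ d → E (p + + suc d)} (λ d → E? (p + + suc d)) n (up p e)
    ... | d , e′ , below = p + + suc d , record
      { here = e ; there = e′ ; before = offset-< p d
      ; between = λ r p<r r<q → gap r p<r r<q }
      where
      gap : ∀ r → p < r → r < p + + suc d → ¬ E r
      gap r p<r r<q with <-offset p<r
      ... | j , refl = below j (ℕ.≤-pred (ℤ.drop‿+<+ (offset-cancel-< p r<q)))

    predecessor : ∀ q → E q → ∃ λ p → Consecutive p q
    predecessor q e with least {λ d → E (q - + suc d)} (λ d → E? (q - + suc d)) n
                           (down (q - + suc n) (subst E (sym (cancel q (+ suc n))) e))
      where
      cancel : ∀ q s → q - s + s ≡ q
      cancel = solve-∀
    ... | d , e′ , below = q - + suc d , record
      { here = e′ ; there = e
      ; before = subst (q - + suc d <_) (cancel q (+ suc d)) (offset-< (q - + suc d) d)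
      ; between = gap }
      where
      cancel : ∀ q s → q - s + s ≡ q
      cancel = solve-∀
      uncancel : ∀ r s → r ≡ r + s - s
      uncancel = solve-∀
      gap : ∀ r → q - + suc d < r → r < q → ¬ E r
      gap r l r<q er with <-offset r<q
      ... | j , refl = below j (ℕ.≤-pred (ℤ.drop‿+<+ (offset-cancel-< (r - + suc d)
                         (subst₂ _<_ (swap r (+ suc j) (+ suc d)) (cancel′ r (+ suc d)) l))))
                         (subst E (uncancel r (+ suc j)) er)
        where
        swap : ∀ r s t → r + s - t ≡ r - t + s
        swap = solve-∀
        cancel′ : ∀ r s → r ≡ r - s + s
        cancel′ = solve-∀

    unique-there : ∀ {p q q′} → Consecutive p q → Consecutive p q′ → q ≡ q′
    unique-there {q = q} {q′} a b with ℤ.<-cmp q q′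
    ... | tri< l _ _ = ⊥-elim (between b q (before a) l (there a))
    ... | tri≈ _ e _ = e
    ... | tri> _ _ l = ⊥-elim (between a q′ (before b) l (there b))

    unique-here : ∀ {p p′ q} → Consecutive p q → Consecutive p′ q → p ≡ p′
    unique-here {p} {p′} a b with ℤ.<-cmp p p′
    ... | tri< l _ _ = ⊥-elim (between a p′ l (before b) (here b))
    ... | tri≈ _ e _ = e
    ... | tri> _ _ l = ⊥-elim (between b p l (before a) (here a))

    place : ℤ → ∃ E
    place (+ 0)        = p₀ , e₀
    place (+ suc k)    = let (p , e) = place (+ k) ; (q , c) = successor p e in q , there c
    place -[1+ 0 ]     = let (q , c) = predecessor p₀ e₀ in q , here c
    place -[1+ suc k ] = let (p , e) = place -[1+ k ] ; (q , c) = predecessor p e in q , here c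

    pos : ℤ → ℤ
    pos i = proj₁ (place i)

    consecutive : ∀ i → Consecutive (pos i) (pos (ℤ.suc i))
    consecutive (+ k)        = proj₂ (successor (pos (+ k)) (proj₂ (place (+ k))))
    consecutive -[1+ 0 ]     = proj₂ (predecessor p₀ e₀)
    consecutive -[1+ suc k ] = proj₂ (predecessor (pos -[1+ k ]) (proj₂ (place -[1+ k ])))

    pos-increasing : ∀ i → pos i < pos (ℤ.suc i)
    pos-increasing i = before (consecutive i)

    open Increasing pos-increasing

    private
      -- Elements are passed one after the other; every passage shortens the remaining distance d,
      -- which the fuel bounds.
      upward : ∀ fuel i d → d ℕ.≤ fuel → E (pos i + + d) → ∃ λ j → pos j ≡ pos i + + d
      upward _          i 0       _         _ = i , sym (ℤ.+-identityʳ (pos i))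
      upward (suc fuel) i (suc d) (ℕ.s≤s l) e with ℤ.<-cmp (pos (ℤ.suc i)) (pos i + + suc d)
      ... | tri> _ _ l′ = ⊥-elim (between (consecutive i) _ (offset-< (pos i) d) l′ e)
      ... | tri≈ _ e′ _ = ℤ.suc i , e′
      ... | tri< l′ _ _ with <-offset l′ | <-offset (pos-increasing i)
      ...   | b , eb | a , ea = let (j , ej) = upward fuel (ℤ.suc i) (suc b) (ℕ.≤-trans (ℕ.m≤n+m (suc b) a) (ℕ.≤-trans (ℕ.≤-reflexive small) l)) (subst E eb e)
                                in j , trans ej (sym eb)
        where
        assoc : pos i + (+ suc a + + suc b) ≡ pos i + + suc d
        assoc = trans (sym (ℤ.+-assoc (pos i) (+ suc a) (+ suc b))) (trans (cong (_+ + suc b) (sym ea)) (sym eb))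
        cancel : ∀ p a b → p + a ≡ p + b → a ≡ b
        cancel p a b h = trans (lemma p a) (trans (cong (λ c → - p + c) h) (sym (lemma p b)))
          where
          lemma : ∀ p a → a ≡ - p + (p + a)
          lemma = solve-∀
        small : a ℕ.+ suc b ≡ d
        small = ℕ.suc-injective (ℤ.+-injective (cancel (pos i) (+ suc a + + suc b) (+ suc d) assoc))

      downward : ∀ fuel i d → d ℕ.≤ fuel → E (pos i - + d) → ∃ λ j → pos j ≡ pos i - + d
      downward _          i 0       _         _ = i , sym (ℤ.+-identityʳ (pos i))
      downward (suc fuel) i (suc d) (ℕ.s≤s l) e = go (subst (Consecutive (pos (ℤ.pred i))) (cong pos (ℤ.suc-pred i)) (consecutive (ℤ.pred i)))
        where
        q = pos i - + suc d
        q<pos : q < pos i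
        q<pos = subst (q <_) (lemma (pos i) (+ suc d)) (offset-< q d)
          where
          lemma : ∀ p s → p - s + s ≡ p
          lemma = solve-∀
        go : Consecutive (pos (ℤ.pred i)) (pos i) → ∃ λ j → pos j ≡ q
        go c with ℤ.<-cmp q (pos (ℤ.pred i))
        ... | tri> _ _ l′ = ⊥-elim (between c q l′ q<pos e)
        ... | tri≈ _ e′ _ = ℤ.pred i , sym e′
        ... | tri< l′ _ _ with <-offset l′ | <-offset (before c)
        ...   | b , eb | a , ea = let (j , ej) = downward fuel (ℤ.pred i) (suc b) (ℕ.≤-trans (ℕ.m≤n+m (suc b) a) (ℕ.≤-trans (ℕ.≤-reflexive small) l)) (subst E q≡ e)
                                  in j , trans ej (sym q≡)
          where
          q≡ : q ≡ pos (ℤ.pred i) - + suc b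
          q≡ = trans (lemma q (+ suc b)) (cong (_- + suc b) (sym eb))
            where
            lemma : ∀ q s → q ≡ q + s - s
            lemma = solve-∀
          total : pos i - + suc d + + suc b + + suc a ≡ pos i
          total = trans (cong (_+ + suc a) (sym eb)) (sym ea)
          small : a ℕ.+ suc b ≡ d
          small = ℕ.suc-injective (ℤ.+-injective (trans (lemma₁ (pos i) (+ suc d) (+ suc b) (+ suc a))
                    (trans (cong (λ c → c - pos i + + suc d) total) (lemma₂ (pos i) (+ suc d)))))
            where
            lemma₁ : ∀ p d b a → a + b ≡ (p - d + b + a) - p + d
            lemma₁ = solve-∀
            lemma₂ : ∀ p d → p - p + d ≡ d
            lemma₂ = solve-∀

    surjective : ∀ q → E q → ∃ λ i → pos i ≡ q
    surjective q e with ℤ.<-cmp p₀ q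
    ... | tri≈ _ refl _ = 0ℤ , refl
    ... | tri< l _ _ with <-offset l
    ...   | d , refl = upward (suc d) 0ℤ (suc d) ℕ.≤-refl e
    surjective q e | tri> _ _ l with <-offset l
    ...   | d , eq = let q≡ = trans (lemma q (+ suc d)) (cong (_- + suc d) (sym eq))
                         (i , ei) = downward (suc d) 0ℤ (suc d) ℕ.≤-refl (subst E q≡ e)
                     in i , trans ei (sym q≡)
      where
      lemma : ∀ q s → q ≡ q + s - s
      lemma = solve-∀

    consecutive-shift : ∀ {p q} → Consecutive p q → Consecutive (p + + suc n) (q + + suc n)
    consecutive-shift {p} {q} c = record
      { here = up p (here c) ; there = up q (there c) ; before = ℤ.+-monoˡ-< (+ suc n) (before c)
      ; between = λ r l l′ er → between c (r - + suc n)
          (subst (_< r - + suc n) (cancel p (+ suc n)) (ℤ.+-monoˡ-< (- + suc n) l))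
          (subst (r - + suc n <_) (cancel q (+ suc n)) (ℤ.+-monoˡ-< (- + suc n) l′))
          (down (r - + suc n) (subst E (uncancel r (+ suc n)) er)) }
      where
      cancel : ∀ p s → p + s - s ≡ p
      cancel = solve-∀
      uncancel : ∀ r s → r ≡ r - s + s
      uncancel = solve-∀

    -- The index found here is the number of elements in one period, later the number of stones of a
    -- necklace.
    period : ∃ λ M → pos (+ suc M) ≡ p₀ + + suc n
    period with surjective (p₀ + + suc n) (up p₀ e₀)
    ... | i , e with <-offset (reflects {0ℤ} {i} (subst (p₀ <_) (sym e) (offset-< p₀ n)))
    ...   | M , refl = M , e

    -- Consecutive elements determine each other in both directions, so agreement at index 0 spreads
    -- to all of ℤ.
    periodic : ∀ {M} → pos (+ M) ≡ p₀ + + suc n → ∀ i → pos (i + + M) ≡ pos i + + suc n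
    periodic {M} e = ℤ-induction _ (trans (cong pos (ℤ.+-identityˡ (+ M))) e)
      (λ i h → unique-there (subst (λ j → Consecutive (pos (i + + M)) (pos j)) (assoc i (+ M)) (consecutive (i + + M)))
                 (subst (λ p → Consecutive p (pos (ℤ.suc i) + + suc n)) (sym h) (consecutive-shift (consecutive i))))
      (λ i h → unique-here (subst (λ j → Consecutive (pos (i + + M)) (pos j)) (assoc i (+ M)) (consecutive (i + + M)))
                 (subst (Consecutive (pos i + + suc n)) (sym h) (consecutive-shift (consecutive i))))
      where
      assoc : ∀ i a → 1ℤ + (i + a) ≡ 1ℤ + i + a
      assoc = solve-∀

-- From patterns with stones to necklaces

module Realisation where
  open import Data.Integer.Base using (_+_; _-_; _*_; -_; _<_; _≤_; +≤+)
  open import Data.Nat.Base using (suc)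
  open Cells
  open LocalRules hiding (step)
  open Patterns
  open Places

  record Represents {k N : ℕ} (z : ℤ → Cell) (X : Necklace k N) : Set where
    open Necklace X
    field
      stones   : ∀ i → Stone z (pos i) (vec i)
      complete : ∀ p v → Stone z p v → ∃ λ i → pos i ≡ p

  flip : Direction → Direction
  flip ↻ = ↺
  flip ↺ = ↻

  flip-≢ : ∀ c d → c ≢ d → d ≡ flip c
  flip-≢ ↻ ↻ n = ⊥-elim (n refl)
  flip-≢ ↻ ↺ n = refl
  flip-≢ ↺ ↻ n = refl
  flip-≢ ↺ ↺ n = ⊥-elim (n refl)

  iterateᵗ : ℕ → Cell → Cell
  iterateᵗ 0       c = c
  iterateᵗ (suc j) c = toggle (iterateᵗ j c)

  module _ {z : ℤ → Cell} (good : Good z) (unmarked : Unmarked z) where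

    toggles : ∀ p d → (∀ r → p < r → r < p + + suc d → ¬ ∃ (Stone z r)) →
              ∀ j → j ℕ.≤ d → z (p + + suc j) ≡ iterateᵗ j (z (p + 1ℤ))
    toggles p d free 0       _ = refl
    toggles p d free (suc j) l with stone-or-toggle {z} good unmarked (p + + suc j)
    ... | inj₁ s = ⊥-elim (free (p + + suc j) (offset-< p j) (ℤ.+-monoʳ-< p (ℤ.+<+ (ℕ.s≤s l))) s)
    ... | inj₂ e = trans (cong z (lemma p (+ suc j))) (trans e (cong toggle (toggles p d free j (ℕ.<⇒≤ l))))
      where
      lemma : ∀ p a → p + (1ℤ + a) ≡ p + a + 1ℤ
      lemma = solve-∀

  private
    two-more : ∀ {z} → Odd z → Odd (+ 2 + z)
    two-more (q , refl) = q + 1ℤ , lemma q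
      where
      lemma : ∀ q → + 2 + (+ 2 * q + 1ℤ) ≡ + 2 * (q + 1ℤ) + 1ℤ
      lemma = solve-∀

    -- Toggling exchanges c with a different cell, so a return to c takes an even number d of
    -- toggles, and the distance between the two stones is d + 1.
    even-toggles : ∀ d c → toggle (toggle c) ≡ c → toggle c ≢ c → iterateᵗ d c ≡ c → Odd (+ suc d)
    even-toggles 0             c i n e = 0ℤ , refl
    even-toggles 1             c i n e = ⊥-elim (n e)
    even-toggles (suc (suc d)) c i n e = two-more (even-toggles d c i n
      (trans (sym (involutive d c i)) e))
      where
      involutive : ∀ d c → toggle (toggle c) ≡ c → toggle (toggle (iterateᵗ d c)) ≡ iterateᵗ d c
      involutive 0       c i = i
      involutive (suc d) c i = cong toggle (involutive d c i)

    -- A zone is named by the facing of the stone that opens it on its left.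
    zone : Cell → Direction
    zone A⁺ = ↺
    zone A⁻ = ↺
    zone A× = ↺
    zone B⁻ = ↻
    zone B⁺ = ↻

    zone-target : ∀ v → zone (target v) ≡ facing v
    zone-target -2⃗ = refl
    zone-target -1⃗ = refl
    zone-target 1⃗  = refl
    zone-target 2⃗  = refl

    zone-source : ∀ v → zone (source v) ≡ flip (facing v)
    zone-source -2⃗ = refl
    zone-source -1⃗ = refl
    zone-source 1⃗  = refl
    zone-source 2⃗  = refl

    zone-toggles : ∀ d c → zone (iterateᵗ d c) ≡ zone c
    zone-toggles 0       c = refl
    zone-toggles (suc d) c = trans (zone-toggle (iterateᵗ d c)) (zone-toggles d c)
      where
      zone-toggle : ∀ c → zone (toggle c) ≡ zone c
      zone-toggle A⁺ = refl
      zone-toggle A⁻ = refl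
      zone-toggle B⁻ = refl
      zone-toggle B⁺ = refl
      zone-toggle A× = refl

    -- Toggling never leaves a zone, and the stone that closes a zone faces opposite to the one that
    -- opens it.
    alternate : ∀ d v w → iterateᵗ d (target v) ≡ source w → facing v ≢ facing w
    alternate d v w e f = flip-fixed (facing w) (trans (sym f) (trans (sym (zone-target v))
      (trans (sym (zone-toggles d (target v))) (trans (cong zone e) (zone-source w)))))
      where
      flip-fixed : ∀ d → d ≢ flip d
      flip-fixed ↻ ()
      flip-fixed ↺ ()

    away-odd : ∀ d v w → iterateᵗ d (target v) ≡ source w → facing v ≡ ↺ → facing w ≡ ↻ → Odd (+ suc d)
    away-odd d -2⃗ 1⃗ e _ _ = even-toggles d A⁻ refl (λ ()) e
    away-odd d -2⃗ 2⃗ e _ _ = even-toggles d A⁻ refl (λ ()) e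
    away-odd d -1⃗ 1⃗ e _ _ = even-toggles d A⁻ refl (λ ()) e
    away-odd d -1⃗ 2⃗ e _ _ = even-toggles d A⁻ refl (λ ()) e

    towards-odd : ∀ d v w → iterateᵗ d (target v) ≡ source w → facing v ≡ ↻ → facing w ≡ ↺ →
                  Odd (+ suc d + len v + len w)
    towards-odd d 1⃗ -1⃗ e _ _ = subst Odd (lemma (+ suc d)) (two-more (even-toggles d B⁻ refl (λ ()) e))
      where
      lemma : ∀ a → + 2 + a ≡ a + + 1 + + 1
      lemma = solve-∀
    -- Unequal lengths give different cells at the two ends of the zone; one more toggle brings the
    -- word back to its first cell.
    towards-odd d 1⃗ -2⃗ e _ _ = subst Odd (lemma (+ suc d)) (two-more (even-toggles (suc d) B⁻ refl (λ ()) (cong toggle e)))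
      where
      lemma : ∀ a → + 2 + (1ℤ + a) ≡ a + + 1 + + 2
      lemma = solve-∀
    towards-odd d 2⃗ -1⃗ e _ _ = subst Odd (lemma (+ suc d)) (two-more (even-toggles (suc d) B⁺ refl (λ ()) (cong toggle e)))
      where
      lemma : ∀ a → + 2 + (1ℤ + a) ≡ a + + 2 + + 1
      lemma = solve-∀
    towards-odd d 2⃗ -2⃗ e _ _ = subst Odd (lemma (+ suc d)) (two-more (two-more (even-toggles d B⁺ refl (λ ()) e)))
      where
      lemma : ∀ a → + 2 + (+ 2 + a) ≡ a + + 2 + + 2
      lemma = solve-∀

    target-↻ : ∀ {v} → facing v ≡ ↻ → source v ≡ A⁻ × (target v ≡ B⁻ ⊎ target v ≡ B⁺)
    target-↻ {1⃗} _ = refl , inj₁ refl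
    target-↻ {2⃗} _ = refl , inj₂ refl

    source-↺ : ∀ {v} → facing v ≡ ↺ → target v ≡ A⁻
    source-↺ { -2⃗} _ = refl
    source-↺ { -1⃗} _ = refl

    short-target : ∀ {v} → target v ≡ B⁻ → len v ≡ 1ℤ
    short-target {1⃗} _ = refl

    short-source : ∀ {v} → source v ≡ B⁻ → len v ≡ 1ℤ
    short-source { -1⃗} _ = refl

    flips : ℕ → Direction → Direction
    flips 0       d = d
    flips (suc m) d = flip (flips m d)

    even-flips : ∀ M d → flips M d ≡ d → ∃ λ k → M ≡ 2 ℕ.* k
    even-flips 0             d e = 0 , refl
    even-flips 1             ↻ ()
    even-flips 1             ↺ ()
    even-flips (suc (suc M)) d e =
      let (k , e′) = even-flips M d (trans (sym (flip-flip (flips M d))) e)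
      in suc k , trans (cong (λ m → suc (suc m)) e′) (cong suc (sym (ℕ.+-suc k (k ℕ.+ 0))))
      where
      flip-flip : ∀ d → flip (flip d) ≡ d
      flip-flip ↻ = refl
      flip-flip ↺ = refl

  module _ {n : ℕ} {z : ℤ → Cell} (P : Pattern (suc n) z) {p₀ : ℤ} (s₀ : ∃ (Stone z p₀)) where
    open Pattern P
    private
      stone-up : ∀ p → ∃ (Stone z p) → ∃ (Stone z (p + + suc n))
      stone-up p (v , s , t) = v , trans (periodic p) s , trans (cong z (lemma p (+ suc n))) (trans (periodic (p + 1ℤ)) t)
        where
        lemma : ∀ p a → p + a + 1ℤ ≡ p + 1ℤ + a
        lemma = solve-∀

      stone-down : ∀ p → ∃ (Stone z (p + + suc n)) → ∃ (Stone z p)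
      stone-down p (v , s , t) = v , trans (sym (periodic p)) s , trans (sym (trans (cong z (lemma p (+ suc n))) (periodic (p + 1ℤ)))) t
        where
        lemma : ∀ p a → p + a + 1ℤ ≡ p + 1ℤ + a
        lemma = solve-∀

      module E = Enumeration {E = λ p → ∃ (Stone z p)} (hasStone? z) {n} stone-up stone-down {p₀} s₀

      vec : ℤ → StoneVector
      vec i = proj₁ (proj₂ (E.place i))

      stones : ∀ i → Stone z (E.pos i) (vec i)
      stones i = proj₂ (proj₂ (E.place i))

      module Gap (i : ℤ) where
        open E.Consecutive (E.consecutive i)
        d : ℕ
        d = proj₁ (<-offset before)
        next≡ : E.pos (ℤ.suc i) ≡ E.pos i + + suc d
        next≡ = proj₂ (<-offset before)
        run : ∀ j → j ℕ.≤ d → z (E.pos i + + suc j) ≡ iterateᵗ j (target (vec i))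
        run j l = trans (toggles {z} good unmarked (E.pos i) d (λ r a b → between r a (subst (r <_) (sym next≡) b)) j l)
                        (cong (iterateᵗ j) (proj₂ (stones i)))
        ends : iterateᵗ d (target (vec i)) ≡ source (vec (ℤ.suc i))
        ends = trans (sym (run d ℕ.≤-refl)) (trans (cong z (sym next≡)) (proj₁ (stones (ℤ.suc i))))
        dist≡ : E.pos (ℤ.suc i) - E.pos i ≡ + suc d
        dist≡ = trans (cong (_- E.pos i) next≡) (lemma (E.pos i) (+ suc d))
          where
          lemma : ∀ p a → p + a - p ≡ a
          lemma = solve-∀

      alternates : ∀ i → facing (vec i) ≢ facing (vec (ℤ.suc i))
      alternates i = alternate (Gap.d i) (vec i) (vec (ℤ.suc i)) (Gap.ends i)

      M = suc (proj₁ E.period)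

      pos-periodic : ∀ i → E.pos (i + + M) ≡ E.pos i + + suc n
      pos-periodic = E.periodic {M} (proj₂ E.period)

      vec-periodic : ∀ i → vec (i + + M) ≡ vec i
      vec-periodic i = stone-unique {z} {E.pos (i + + M)} (stones (i + + M))
        (subst (λ p → Stone z p (vec i)) (sym (pos-periodic i)) (proj₂ (stone-up-same (E.pos i) (vec i) (stones i))))
        where
        stone-up-same : ∀ p v → Stone z p v → ∃ λ (_ : ℤ) → Stone z (p + + suc n) v
        stone-up-same p v s = p , proj₂ (stone-up p (v , s))

      facings : ∀ m → facing (vec (+ m)) ≡ flips m (facing (vec 0ℤ))
      facings 0       = refl
      facings (suc m) = trans (flip-≢ _ _ (alternates (+ m))) (cong flip (facings m))

      -- Facings alternate and recur after M stones, so M is even; its half is the k of the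
      -- necklace.
      half : ∃ λ k → M ≡ 2 ℕ.* k
      half = even-flips M (facing (vec 0ℤ)) (trans (sym (facings M)) (cong facing (vec-periodic 0ℤ)))

      k = proj₁ half

      positive : ∀ k → M ≡ 2 ℕ.* k → 0 ℕ.< k
      positive 0       ()
      positive (suc k) _ = ℕ.s≤s ℕ.z≤n

      minimum : ∀ i → facing (vec i) ≡ ↻ → facing (vec (ℤ.suc i)) ≡ ↺ →
        + 3 ≤ + suc (Gap.d i) ×
        (+ suc (Gap.d i) ≡ + 3 → len (vec i) ≡ 1ℤ × len (vec (ℤ.suc i)) ≡ 1ℤ)
      minimum i cw acw = go (Gap.d i) refl
        where
        p = E.pos i
        next : z (p + 1ℤ) ≡ target (vec i)
        next = proj₂ (stones i)
        rules = zone-length {z} good p (trans (proj₁ (stones i)) (proj₁ (target-↻ cw)))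
                  (subst (λ c → c ≡ B⁻ ⊎ c ≡ B⁺) (sym next) (proj₂ (target-↻ cw)))
        last : ∀ d → Gap.d i ≡ d → z (p + + suc (suc d)) ≡ A⁻
        last d refl = trans (cong z (trans (lemma p (+ suc d)) (cong (_+ 1ℤ) (sym (Gap.next≡ i)))))
          (trans (proj₂ (stones (ℤ.suc i))) (source-↺ acw))
          where
          lemma : ∀ p a → p + (1ℤ + a) ≡ p + a + 1ℤ
          lemma = solve-∀
        -- The distance is `suc d`, so the cases 0, 1 and 2 are the distances 1, 2 and 3.
        go : ∀ d → Gap.d i ≡ d → + 3 ≤ + suc d × (+ suc d ≡ + 3 → len (vec i) ≡ 1ℤ × len (vec (ℤ.suc i)) ≡ 1ℤ)
        go 0 e = ⊥-elim (proj₁ rules (last 0 e))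
        go 1 e = ⊥-elim (proj₁ (proj₂ rules) (last 1 e))
        go 2 e = +≤+ ℕ.≤-refl , λ _ →
          let (x , y) = proj₂ (proj₂ rules) (last 2 e) in
          short-target (trans (sym next) x)
          , short-source (trans (sym (proj₁ (stones (ℤ.suc i))))
              (trans (cong z (trans (Gap.next≡ i) (cong (λ d → p + + suc d) e))) y))
        go (suc (suc (suc d))) e = +≤+ (ℕ.s≤s (ℕ.s≤s (ℕ.s≤s ℕ.z≤n))) , λ ()

    realise : ∃ λ k → 0 ℕ.< k × Σ (Necklace k (suc n)) (Represents z)
    realise = k , positive k (proj₂ half) , record
      { pos            = E.pos
      ; vec            = vec
      ; pos-increasing = E.pos-increasing
      ; pos-periodic   = subst (λ M → ∀ i → E.pos (i + + M) ≡ E.pos i + + suc n) (proj₂ half) pos-periodic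
      ; vec-periodic   = subst (λ M → ∀ i → vec (i + + M) ≡ vec i) (proj₂ half) vec-periodic
      ; alternating    = alternates
      ; away           = λ i acw cw → subst Odd (sym (Gap.dist≡ i))
          (away-odd (Gap.d i) (vec i) (vec (ℤ.suc i)) (Gap.ends i) acw cw)
      ; towards        = λ i cw acw →
          subst (λ a → Odd (a + len (vec i) + len (vec (ℤ.suc i)))) (sym (Gap.dist≡ i))
            (towards-odd (Gap.d i) (vec i) (vec (ℤ.suc i)) (Gap.ends i) cw acw)
          , subst (+ 3 ≤_) (sym (Gap.dist≡ i)) (proj₁ (minimum i cw acw))
          , λ e → proj₂ (minimum i cw acw) (trans (sym (Gap.dist≡ i)) e)
      } , record { stones = stones ; complete = λ p v s → E.surjective p (v , s) }

-- One step of the automaton as `T`, isometries, and the loss of stones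

module Dynamics where
  open import Data.Empty using (⊥)
  open import Data.Integer.Base using (_+_; _-_; _*_; -_; _<_; _≤_; +≤+)
  open import Data.Nat.Base using (suc)
  open Circle using (window-cong; G-translate; G-reflect; periodic-shift; periodic-reflect)
  open Cells
  open LocalRules
  open Patterns
  open Recurrence using (patternZ; patternZ-cong)
  open Places
  open Realisation

  module _ {k N : ℕ} (X : Necklace k N) where
    open Necklace X

    private
      adjacent-next : ∀ {i j} → pos j ≡ pos i + 1ℤ → j ≡ ℤ.suc i
      adjacent-next {i} {j} e with <-offset (Increasing.reflects pos-increasing {i} {j} (subst (pos i <_) (sym e) (offset-< (pos i) 0)))
      ... | 0     , refl = ℤ.+-comm i 1ℤ
      ... | suc d , refl = ⊥-elim (ℤ.<-irrefl refl (ℤ.<-≤-trans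
            (Increasing.mono pos-increasing {ℤ.suc i} {i + + suc (suc d)} (subst (ℤ.suc i <_) (lemma i (+ suc d)) (offset-< (ℤ.suc i) d)))
            (subst (_≤ pos (ℤ.suc i)) (trans (ℤ.+-comm 1ℤ (pos i)) (sym e)) (ℤ.i<j⇒suc[i]≤j (pos-increasing i)))))
        where
        lemma : ∀ i a → 1ℤ + i + a ≡ i + (1ℤ + a)
        lemma = solve-∀

      gap-≥1 : ∀ i a → pos (ℤ.suc i) - pos i ≡ a → 1ℤ ≤ a
      gap-≥1 i a refl = ℤ.i<j⇒suc[i]≤j (<⇒0<difference (pos-increasing i))

      -- Distance 3 after the jump means distance 3 + a - b before it, with a and b the
      -- displacements of the two stones. For stones facing away from each other this is positive
      -- only if they are `-1⃗` and `1⃗`.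
      meet-shape : ∀ i → Meet X i → vec i ≡ -1⃗ × vec (ℤ.suc i) ≡ 1⃗ × pos (ℤ.suc i) ≡ pos i + 1ℤ
      meet-shape i (cw , acw , e) = go (vec i) (vec (ℤ.suc i)) refl refl cw acw e
        where
        p = pos i
        q = pos (ℤ.suc i)
        solve : ∀ a b → (q + b) - (p + a) ≡ + 3 → q - p ≡ + 3 + a - b
        solve a b h = trans (lemma p q a b) (cong (λ c → c + a - b) h)
          where
          lemma : ∀ p q a b → q - p ≡ (q + b) - (p + a) + a - b
          lemma = solve-∀
        go : ∀ v w → vec i ≡ v → vec (ℤ.suc i) ≡ w → facing (turn v) ≡ ↻ → facing (turn w) ≡ ↺ →
             (q + displacement w) - (p + displacement v) ≡ + 3 → v ≡ -1⃗ × w ≡ 1⃗ × q ≡ p + 1ℤ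
        go -1⃗ 1⃗ _ _ _ _ h = refl , refl , trans (lemma p q) (cong (λ c → p + c) (solve -1ℤ 1ℤ h))
          where
          lemma : ∀ p q → q ≡ p + (q - p)
          lemma = solve-∀
        go -1⃗ 2⃗ _ _ _ _ h with gap-≥1 i _ (solve -1ℤ (+ 2) h)
        ... | +≤+ ()
        go -2⃗ 1⃗ _ _ _ _ h with gap-≥1 i _ (solve (- + 2) 1ℤ h)
        ... | +≤+ ()
        go -2⃗ 2⃗ _ _ _ _ h with gap-≥1 i _ (solve (- + 2) (+ 2) h)
        ... | ()

      shape-meet : ∀ i → vec i ≡ -1⃗ → vec (ℤ.suc i) ≡ 1⃗ → pos (ℤ.suc i) ≡ pos i + 1ℤ → Meet X i
      shape-meet i e e′ q = cong (facing ∘ turn) e , cong (facing ∘ turn) e′ ,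
        trans (cong₂ (λ v w → (pos (ℤ.suc i) + displacement w) - (pos i + displacement v)) e e′)
        (trans (cong (λ c → (c + 1ℤ) - (pos i + -1ℤ)) q) (lemma (pos i)))
        where
        lemma : ∀ p → (p + 1ℤ + 1ℤ) - (p + -1ℤ) ≡ + 3
        lemma = solve-∀

      fixed-long : ∀ i → shorten (turned X i) ≡ turned X i → fixed X i ≡ turned X i
      fixed-long i e with does (meet? X i ⊎-dec meet? X (ℤ.pred i))
      ... | true  = e
      ... | false = refl

      fixed-meet : ∀ i → Meet X i ⊎ Meet X (ℤ.pred i) → fixed X i ≡ shorten (turned X i)
      fixed-meet i m = cong (λ b → if b then shorten (turned X i) else turned X i)
        (dec-true (meet? X i ⊎-dec meet? X (ℤ.pred i)) m)

      fixed-free : ∀ i → ¬ (Meet X i ⊎ Meet X (ℤ.pred i)) → fixed X i ≡ turned X i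
      fixed-free i ¬m = cong (λ b → if b then shorten (turned X i) else turned X i)
        (dec-false (meet? X i ⊎-dec meet? X (ℤ.pred i)) ¬m)

    module _ {z : ℤ → Cell} (good : Good z) (R : Represents z X) where
      open Represents R

      private
        at : ∀ {p v} i → pos i ≡ p → Stone z p v → v ≡ vec i
        at {v = v} i refl s = stone-unique {z} {pos i} s (stones i)

        -- A stone of length 1 meets its neighbour after the jump exactly when the
        -- neighbour is at distance 1, faces away from it, and has length 1 too.
        moved : ∀ i v → vec i ≡ v → Stone (step z) (jumped X i) (fixed X i)
        moved i 2⃗ e = subst₂ (Stone (step z)) (cong (λ v → pos i + displacement v) (sym e))
          (sym (trans (fixed-long i (trans (cong (shorten ∘ turn) e) (cong turn (sym e)))) (cong turn e)))
          (jump-right₂ {z} good (pos i) (subst (Stone z (pos i)) e (stones i)))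
        moved i -2⃗ e = subst₂ (Stone (step z)) (cong (λ v → pos i + displacement v) (sym e))
          (sym (trans (fixed-long i (trans (cong (shorten ∘ turn) e) (cong turn (sym e)))) (cong turn e)))
          (jump-left₂ {z} good (pos i) (subst (Stone z (pos i)) e (stones i)))
        moved i 1⃗ e with meet? X i ⊎-dec meet? X (ℤ.pred i)
        ... | yes (inj₁ (cw , _)) with () ← trans (sym (cong (facing ∘ turn) e)) cw
        ... | yes (inj₂ m) = subst₂ (Stone (step z)) (cong (λ v → pos i + displacement v) (sym e))
              (sym (trans (fixed-meet i (inj₂ m)) (cong (shorten ∘ turn) e)))
              (jump-right₁-meeting {z} good (pos i) (subst (Stone z (pos i)) e (stones i))
                (let (l , _ , q) = meet-shape (ℤ.pred i) m in
                 subst₂ (Stone z) (trans (lemma (pos (ℤ.pred i))) (cong (_+ -1ℤ) (trans (sym q) (cong pos (ℤ.suc-pred i))))) l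
                   (stones (ℤ.pred i))))
          where
          lemma : ∀ p → p ≡ p + 1ℤ + -1ℤ
          lemma = solve-∀
        ... | no ¬m = subst₂ (Stone (step z)) (cong (λ v → pos i + displacement v) (sym e))
              (sym (trans (fixed-free i ¬m) (cong turn e)))
              (jump-right₁ {z} good (pos i) (subst (Stone z (pos i)) e (stones i)) λ s →
                let (j , ej) = complete _ _ s
                    next = trans (lemma (pos i)) (cong (_+ 1ℤ) (sym ej))
                    i≡ = adjacent-next {j} {i} next
                    j≡ = trans (sym (ℤ.pred-suc j)) (cong ℤ.pred (sym i≡))
                in ¬m (inj₂ (subst (Meet X) j≡ (shape-meet j (sym (at j ej s))
                     (trans (cong vec (sym i≡)) e) (trans (cong pos (sym i≡)) next)))))
          where
          lemma : ∀ p → p ≡ p + -1ℤ + 1ℤ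
          lemma = solve-∀
        moved i -1⃗ e with meet? X i ⊎-dec meet? X (ℤ.pred i)
        ... | yes (inj₂ (_ , acw , _)) with () ← trans (sym acw) (cong (facing ∘ turn) (trans (cong vec (ℤ.suc-pred i)) e))
        ... | yes (inj₁ m) = subst₂ (Stone (step z)) (cong (λ v → pos i + displacement v) (sym e))
              (sym (trans (fixed-meet i (inj₁ m)) (cong (shorten ∘ turn) e)))
              (jump-left₁-meeting {z} good (pos i) (subst (Stone z (pos i)) e (stones i))
                (let (_ , r , q) = meet-shape i m in subst₂ (Stone z) q r (stones (ℤ.suc i))))
        ... | no ¬m = subst₂ (Stone (step z)) (cong (λ v → pos i + displacement v) (sym e))
              (sym (trans (fixed-free i ¬m) (cong turn e)))
              (jump-left₁ {z} good (pos i) (subst (Stone z (pos i)) e (stones i)) λ s →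
                let (j , ej) = complete _ _ s
                    j≡ = adjacent-next {i} {j} ej
                in ¬m (inj₁ (shape-meet i e (trans (cong vec (sym j≡)) (sym (at j ej s))) (trans (cong pos (sym j≡)) ej))))

      -- The automaton sees FIX as the local word `B⁻ A⁻ B⁻`, which by `meet-shape` and its converse
      -- is the condition `Meet`; since no stone is created, the images of the old stones are all of
      -- them.
      represents-step : Represents (step z) (T X)
      represents-step = record
        { stones   = λ i → moved i (vec i) refl
        ; complete = λ p v s → let (u , s′) = jumped-from {z} good p v s
                                   (j , ej) = complete _ _ s′
                               in j , trans (cong₂ (λ q w → q + displacement w) ej (sym (at j ej s′)))
                                            (cancel p (displacement u)) }
        where
        cancel : ∀ p a → p - a + a ≡ p
        cancel = solve-∀

    facings-spread : ∀ i → pos i + + 4 ≤ pos (ℤ.suc (ℤ.suc i))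
    facings-spread i with facing (vec i) in e₀ | facing (vec (ℤ.suc i)) in e₁ | facing (vec (ℤ.suc (ℤ.suc i))) in e₂
    ... | ↻ | ↻ | _ = ⊥-elim (alternating i (trans e₀ (sym e₁)))
    ... | ↺ | ↺ | _ = ⊥-elim (alternating i (trans e₀ (sym e₁)))
    ... | ↺ | ↻ | ↻ = ⊥-elim (alternating (ℤ.suc i) (trans e₁ (sym e₂)))
    ... | ↻ | ↺ | _ = spread (proj₁ (proj₂ (towards i e₀ e₁))) (gap-≥1 (ℤ.suc i) _ refl)
      where
      spread : + 3 ≤ dist i → 1ℤ ≤ dist (ℤ.suc i) → pos i + + 4 ≤ pos (ℤ.suc (ℤ.suc i))
      spread a b = subst₂ _≤_ refl (lemma (pos i) (pos (ℤ.suc i)) (pos (ℤ.suc (ℤ.suc i))))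
                     (ℤ.+-monoʳ-≤ (pos i) (ℤ.+-mono-≤ a b))
        where
        lemma : ∀ p q r → p + (q - p + (r - q)) ≡ r
        lemma = solve-∀
    ... | ↺ | ↻ | ↺ = spread (gap-≥1 i _ refl) (proj₁ (proj₂ (towards (ℤ.suc i) e₁ e₂)))
      where
      spread : 1ℤ ≤ dist i → + 3 ≤ dist (ℤ.suc i) → pos i + + 4 ≤ pos (ℤ.suc (ℤ.suc i))
      spread a b = subst₂ _≤_ refl (lemma (pos i) (pos (ℤ.suc i)) (pos (ℤ.suc (ℤ.suc i))))
                     (ℤ.+-monoʳ-≤ (pos i) (ℤ.+-mono-≤ a b))
        where
        lemma : ∀ p q r → p + (q - p + (r - q)) ≡ r
        lemma = solve-∀

    necklace-size : 4 ℕ.* k ℕ.≤ N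
    necklace-size = ℤ.drop‿+≤+ (subst₂ _≤_ (lemma (pos 0ℤ) (+ (4 ℕ.* k))) (lemma (pos 0ℤ) (+ N))
      (ℤ.+-monoʳ-≤ (- pos 0ℤ) (subst (pos 0ℤ + + (4 ℕ.* k) ≤_)
        (trans (cong pos (sym (ℤ.+-identityˡ (+ (2 ℕ.* k))))) (pos-periodic 0ℤ)) (climb k))))
      where
      lemma : ∀ p a → - p + (p + a) ≡ a
      lemma = solve-∀
      climb : ∀ j → pos 0ℤ + + (4 ℕ.* j) ≤ pos (+ (2 ℕ.* j))
      climb 0       = ℤ.≤-reflexive (ℤ.+-identityʳ (pos 0ℤ))
      climb (suc j) = ℤ.≤-trans (subst (_≤ pos (+ (2 ℕ.* j)) + + 4) (trans (assoc (pos 0ℤ) (+ (4 ℕ.* j)))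
          (cong (λ a → pos 0ℤ + a) (cong +_ (sym (ℕ.*-suc 4 j)))))
          (ℤ.+-monoˡ-≤ (+ 4) (climb j)))
        (subst (λ m → pos (+ (2 ℕ.* j)) + + 4 ≤ pos (+ m)) (sym (ℕ.*-suc 2 j)) (facings-spread (+ (2 ℕ.* j))))
        where
        assoc : ∀ p a → p + a + + 4 ≡ p + (+ 4 + a)
        assoc = solve-∀

  module _ {n : ℕ} {y z : ℤ → Cell} (Y : Pattern (suc n) y) (Z : Pattern (suc n) z)
    (y⇒z : ∀ p v → Stone y p v → Stone z p v) (z⇒y : ∀ p v → Stone z p v → Stone y p v)
    {p₀ : ℤ} {v₀ : StoneVector} (s₀ : Stone y p₀ v₀) where
    private
      module Y = Pattern Y
      module Z = Pattern Z

      forward : ∀ j → y (p₀ + 1ℤ + + j) ≡ z (p₀ + 1ℤ + + j)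
      forward 0 = trans (at-0 y (p₀ + 1ℤ)) (trans (proj₂ s₀) (trans (sym (proj₂ (y⇒z p₀ v₀ s₀))) (sym (at-0 z (p₀ + 1ℤ)))))
      forward (suc j) = subst (λ p → y p ≡ z p) (lemma (p₀ + 1ℤ) (+ j)) (go (p₀ + 1ℤ + + j) (forward j))
        where
        lemma : ∀ p a → p + a + 1ℤ ≡ p + (1ℤ + a)
        lemma = solve-∀
        go : ∀ p → y p ≡ z p → y (p + 1ℤ) ≡ z (p + 1ℤ)
        go p e with stone-or-toggle {y} Y.good Y.unmarked p | stone-or-toggle {z} Z.good Z.unmarked p
        ... | inj₁ (v , s) | _            = trans (proj₂ s) (sym (proj₂ (y⇒z p v s)))
        ... | inj₂ _       | inj₁ (v , s) = trans (proj₂ (z⇒y p v s)) (sym (proj₂ s))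
        ... | inj₂ t       | inj₂ t′      = trans t (trans (cong toggle e) (sym t′))

      -- As |d| periods amount to at least d, they carry any place at signed distance d before the
      -- reference stone beyond it.
      excess : ∀ d → ∃ λ j → + ℤ.∣ d ∣ * + suc n ≡ d + + j
      excess (+ a)    = a ℕ.* n , trans (sym (ℤ.pos-* a (suc n))) (cong +_ (ℕ.*-suc a n))
      excess -[1+ a ] = suc a ℕ.+ suc a ℕ.* suc n ,
        trans (lemma (+ suc a) (+ suc a * + suc n)) (cong (λ b → -[1+ a ] + (+ suc a + b)) (sym (ℤ.pos-* (suc a) (suc n))))
        where
        lemma : ∀ a b → b ≡ - a + (a + b)
        lemma = solve-∀

    -- To the right of a common stone each cell follows from its left neighbour, by the stone
    -- between them or by toggling; periodicity extends this to all places.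
    stones-determine : y ≗ z
    stones-determine p = trans (sym (periodic-* Y.periodic p t)) (trans
      (subst (λ q → y q ≡ z q) (sym shift) (forward (proj₁ ex))) (periodic-* Z.periodic p t))
      where
      d = (p₀ + 1ℤ) - p
      t = ℤ.∣ d ∣
      ex = excess d
      shift : p + + t * + suc n ≡ p₀ + 1ℤ + + proj₁ ex
      shift = trans (cong (λ a → p + a) (proj₂ ex)) (lemma p (p₀ + 1ℤ) (+ proj₁ ex))
        where
        lemma : ∀ p q a → p + (q - p + a) ≡ q + a
        lemma = solve-∀

  shift-pattern : ∀ {n z} → Pattern (suc n) z → ∀ r → Pattern (suc n) (λ p → z (p + r))
  shift-pattern {z = z} P r = record
    { good     = λ p → trans (cong goodᵇ (segment-∘+ z r p 0ℤ 5)) (good (p + r))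
    ; unmarked = λ p → unmarked (p + r)
    ; periodic = periodic-shift {x = z} periodic r }
    where open Pattern P

  reflect-pattern : ∀ {n z} → Pattern (suc n) z → ∀ r → Pattern (suc n) (λ p → z (r - p))
  reflect-pattern {z = z} P r = record
    { good     = reverse-good {z} good r
    ; unmarked = λ p → unmarked (r - p)
    ; periodic = periodic-reflect {x = z} periodic r }
    where open Pattern P

  patternZ-shift : ∀ {n z} → Pattern (suc n) z → ∀ r m → patternZ (suc n) m (λ p → z (p + r)) ≡ patternZ (suc n) m z
  patternZ-shift {n} {z} P r m = trans
    (cong₂ (Transfer.G (cycle (suc n)) m)
      (window-cong λ p → cong presentᵇ (segment-∘+ z r p -1ℤ 3))
      (window-cong λ p → cong missingᵇ (segment-∘+ z r p -1ℤ 3)))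
    (G-translate m (firstRow-periodic periodic) (secondGap-periodic periodic) r)
    where
    open Pattern P

  patternZ-reflect : ∀ {n z} → Pattern (suc n) z → ∀ r m → patternZ (suc n) m (λ p → z (r - p)) ≡ patternZ (suc n) m z
  patternZ-reflect {n} {z} P r m = trans
    (cong₂ (Transfer.G (cycle (suc n)) m)
      (window-cong λ p → trans (cong presentᵇ (reversed p)) (present-symmetric (r - p)))
      (window-cong λ p → trans (cong missingᵇ (reversed p)) (missing-symmetric (r - p))))
    (G-reflect m (firstRow-periodic periodic) (secondGap-periodic periodic) r)
    where
    open Pattern P
    reversed : ∀ p → segment (λ q → z (r - q)) p -1ℤ 3 ≡ z (r - p + 1ℤ) ∷ z (r - p + 0ℤ) ∷ z (r - p + -1ℤ) ∷ []
    reversed p = cong₂ _∷_ (cong z (l₁ r p)) (cong₂ _∷_ (cong z (l₂ r p)) (cong₂ _∷_ (cong z (l₃ r p)) refl))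
      where
      l₁ : ∀ r p → r - (p + -1ℤ) ≡ r - p + 1ℤ
      l₁ = solve-∀
      l₂ : ∀ r p → r - (p + + 0) ≡ r - p + + 0
      l₂ = solve-∀
      l₃ : ∀ r p → r - (p + + 1) ≡ r - p + -1ℤ
      l₃ = solve-∀
    present-symmetric : ∀ p → presentᵇ (z (p + 1ℤ) ∷ z (p + 0ℤ) ∷ z (p + -1ℤ) ∷ []) ≡ firstRow z p
    present-symmetric p = locally 1
      (λ { (a ∷ b ∷ c ∷ _) → presentᵇ (c ∷ b ∷ a ∷ []) ≡ presentᵇ (a ∷ b ∷ c ∷ []) })
      (λ { (a ∷ b ∷ c ∷ _) → _ Bool.≟ _ }) refl {z} good p -1ℤ
    missing-symmetric : ∀ p → missingᵇ (z (p + 1ℤ) ∷ z (p + 0ℤ) ∷ z (p + -1ℤ) ∷ []) ≡ secondGap z p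
    missing-symmetric p = locally 1
      (λ { (a ∷ b ∷ c ∷ _) → missingᵇ (c ∷ b ∷ a ∷ []) ≡ missingᵇ (a ∷ b ∷ c ∷ []) })
      (λ { (a ∷ b ∷ c ∷ _) → _ Bool.≟ _ }) refl {z} good p -1ℤ

  -- The isometry is applied to the cells of z: the moved word has the stones of Y, and a pattern
  -- with stones is determined by them.
  patternZ-≅ : ∀ {n k y z} {X Y : Necklace k (suc n)} → Pattern (suc n) z → Pattern (suc n) y →
    Represents z X → Represents y Y → X ≅ Y → ∀ m → patternZ (suc n) m y ≡ patternZ (suc n) m z
  patternZ-≅ {n} {k} {y} {z} {X} {Y} P Q R S (s , r , inj₁ iso) m = trans
    (patternZ-cong (suc n) m (stones-determine Q (shift-pattern P (- r)) y⇒z z⇒y (S.stones 0ℤ)))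
    (patternZ-shift P (- r) m)
    where
    module X = Necklace X
    module Y = Necklace Y
    module R = Represents R
    module S = Represents S
    shifted = λ p → z (p + - r)
    shift-stone : ∀ {p q v} → q ≡ p + - r → Stone z q v → Stone shifted p v
    shift-stone {p} {v = v} refl (a , b) = a , trans (cong z (lemma p (- r))) b
      where
      lemma : ∀ p r → p + 1ℤ + r ≡ p + r + 1ℤ
      lemma = solve-∀
    unshift-stone : ∀ {p v} → Stone shifted p v → Stone z (p + - r) v
    unshift-stone {p} (a , b) = a , trans (cong z (lemma p (- r))) b
      where
      lemma : ∀ p r → p + r + 1ℤ ≡ p + 1ℤ + r
      lemma = solve-∀
    y⇒z : ∀ p v → Stone y p v → Stone shifted p v
    y⇒z p v st with S.complete p v st
    ... | j , refl = shift-stone {Y.pos j} {v = v} (trans (cancel (X.pos (j + s)) r) (cong (_+ - r) (sym (proj₁ (iso j)))))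
        (subst (Stone z (X.pos (j + s))) (trans (sym (proj₂ (iso j))) (stone-unique {y} {Y.pos j} (S.stones j) st)) (R.stones (j + s)))
      where
      cancel : ∀ p r → p ≡ p + r + - r
      cancel = solve-∀
    z⇒y : ∀ p v → Stone shifted p v → Stone y p v
    z⇒y p v st = subst₂ (Stone y)
      (trans (proj₁ (iso (i - s))) (trans (cong (_+ r) (trans (cong X.pos (cancel i s)) ei)) (cancel′ p r)))
      (trans (proj₂ (iso (i - s))) (trans (cong X.vec (cancel i s)) (stone-unique {z} {X.pos i} (R.stones i) (subst (λ q → Stone z q v) (sym ei) st′))))
      (S.stones (i - s))
      where
      st′ = unshift-stone {p} {v} st
      i = proj₁ (R.complete _ _ st′)
      ei = proj₂ (R.complete _ _ st′)
      cancel : ∀ i s → i - s + s ≡ i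
      cancel = solve-∀
      cancel′ : ∀ p r → p + - r + r ≡ p
      cancel′ = solve-∀
  patternZ-≅ {n} {k} {y} {z} {X} {Y} P Q R S (s , r , inj₂ iso) m = trans
    (patternZ-cong (suc n) m (stones-determine Q (reflect-pattern P (r + 1ℤ)) y⇒z z⇒y (S.stones 0ℤ)))
    (patternZ-reflect P (r + 1ℤ) m)
    where
    module X = Necklace X
    module Y = Necklace Y
    module R = Represents R
    module S = Represents S
    -- A stone at p lies halfway between the vertices p and p + 1, so p ↦ r - p on stones is p ↦ r +
    -- 1 - p on vertices.
    reflected = λ p → z (r + 1ℤ - p)
    source-reflect : ∀ v → source (reflect v) ≡ target v × target (reflect v) ≡ source v
    source-reflect -2⃗ = refl , refl
    source-reflect -1⃗ = refl , refl
    source-reflect 1⃗  = refl , refl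
    source-reflect 2⃗  = refl , refl
    reflect-involutive : ∀ v → reflect (reflect v) ≡ v
    reflect-involutive -2⃗ = refl
    reflect-involutive -1⃗ = refl
    reflect-involutive 1⃗  = refl
    reflect-involutive 2⃗  = refl
    l₁ : ∀ r p → r + 1ℤ - p ≡ r - p + 1ℤ
    l₁ = solve-∀
    l₂ : ∀ r p → r + 1ℤ - (p + 1ℤ) ≡ r - p
    l₂ = solve-∀
    reflect-stone : ∀ {p q v} → q ≡ r - p → Stone z q v → Stone reflected p (reflect v)
    reflect-stone {p} {v = v} refl (a , b) =
      trans (cong z (l₁ r p)) (trans b (sym (proj₁ (source-reflect v))))
      , trans (cong z (l₂ r p)) (trans a (sym (proj₂ (source-reflect v))))
    unreflect-stone : ∀ {p v} → Stone reflected p v → Stone z (r - p) (reflect v)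
    unreflect-stone {p} {v} (a , b) =
      trans (cong z (sym (l₂ r p))) (trans b (sym (proj₁ (source-reflect v))))
      , trans (cong z (sym (l₁ r p))) (trans a (sym (proj₂ (source-reflect v))))
    y⇒z : ∀ p v → Stone y p v → Stone reflected p v
    y⇒z p v st with S.complete p v st
    ... | j , refl = subst (Stone reflected (Y.pos j)) (trans (sym (proj₂ (iso j))) (stone-unique {y} {Y.pos j} (S.stones j) st))
        (reflect-stone {Y.pos j} {v = X.vec (s - j)} (trans (cancel r (X.pos (s - j))) (cong (λ p → r - p) (sym (proj₁ (iso j))))) (R.stones (s - j)))
      where
      cancel : ∀ r p → p ≡ r - (r - p)
      cancel = solve-∀
    z⇒y : ∀ p v → Stone reflected p v → Stone y p v
    z⇒y p v st = subst₂ (Stone y)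
      (trans (proj₁ (iso (s - i))) (trans (cong (λ q → r - q) (trans (cong X.pos (cancel s i)) ei)) (cancel r p)))
      (trans (proj₂ (iso (s - i))) (trans (cong (reflect ∘ X.vec) (cancel s i))
        (trans (cong reflect (stone-unique {z} {X.pos i} (R.stones i) (subst (λ q → Stone z q (reflect v)) (sym ei) st′))) (reflect-involutive v))))
      (S.stones (s - i))
      where
      st′ = unreflect-stone {p} {v} st
      i = proj₁ (R.complete _ _ st′)
      ei = proj₂ (R.complete _ _ st′)
      cancel : ∀ s i → s - (s - i) ≡ i
      cancel = solve-∀

  -- The inclusion of the stones induces an increasing map of the indices, which
  -- would be a bijection if the numbers of stones were equal.
  fewer-stones : ∀ {n k k′ y z} {X : Necklace k (suc n)} {X′ : Necklace k′ (suc n)} →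
    Represents z X → Represents y X′ → 0 ℕ.< k′ →
    (∀ p v → Stone y p v → Stone z p v) →
    ∀ p v → Stone z p v → (∀ w → ¬ Stone y p w) → k′ ℕ.< k
  fewer-stones {n} {k} {k′} {y} {z} {X} {X′} R S k′>0 sub p v here ¬there with k′ ℕ.<? k
  ... | yes l = l
  ... | no k′≮k = ⊥-elim (¬there _ (subst (λ q → Stone y q (X′.vec j)) onto (S.stones j)))
    where
    module X = Necklace X
    module X′ = Necklace X′
    module R = Represents R
    module S = Represents S
    module I = Increasing X.pos-increasing

    φ : ℤ → ℤ
    φ i = proj₁ (R.complete _ _ (sub _ _ (S.stones i)))

    φ-pos : ∀ i → X.pos (φ i) ≡ X′.pos i
    φ-pos i = proj₂ (R.complete _ _ (sub _ _ (S.stones i)))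

    φ-increasing : ∀ i → φ i < φ (ℤ.suc i)
    φ-increasing i = I.reflects (subst₂ _<_ (sym (φ-pos i)) (sym (φ-pos (ℤ.suc i))) (X′.pos-increasing i))

    φ-periodic : ∀ i → φ (i + + (2 ℕ.* k′)) ≡ φ i + + (2 ℕ.* k)
    φ-periodic i = I.injective (trans (φ-pos (i + + (2 ℕ.* k′))) (trans (X′.pos-periodic i)
      (trans (cong (_+ + suc n) (sym (φ-pos i))) (sym (X.pos-periodic (φ i))))))

    climb : ∀ i d → φ i + + d ≤ φ (i + + d)
    climb i 0       = ℤ.≤-reflexive (trans (ℤ.+-identityʳ (φ i)) (cong φ (sym (ℤ.+-identityʳ i))))
    climb i (suc d) = subst₂ _≤_ (lemma (φ i) (+ d)) (cong φ (lemma i (+ d)))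
      (ℤ.≤-trans (ℤ.+-monoʳ-≤ 1ℤ (climb i d)) (ℤ.i<j⇒suc[i]≤j (φ-increasing (i + + d))))
      where
      lemma : ∀ i a → 1ℤ + (i + a) ≡ i + (1ℤ + a)
      lemma = solve-∀

    -- Every increment of φ is at least 1. If one were larger, 2k′ steps would raise φ by more than
    -- 2k′ ≥ 2k, against `φ-periodic`.
    tight : ∀ i → φ (ℤ.suc i) ≡ ℤ.suc (φ i)
    tight i with <-offset (φ-increasing i)
    ... | 0     , e = trans e (ℤ.+-comm (φ i) 1ℤ)
    ... | suc d , e = ⊥-elim (contradict (2 ℕ.* k′) refl)
      where
      contradict : ∀ K → 2 ℕ.* k′ ≡ K → ⊥
      contradict 0 eq = ℕ.<-irrefl (sym eq) (ℕ.*-monoʳ-< 2 k′>0)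
      contradict (suc K) eq = ℤ.<-irrefl refl (ℤ.<-≤-trans
        (offset-< (φ i + + (2 ℕ.* k′)) d)
        (ℤ.≤-trans (subst₂ _≤_ shape (trans (cong φ shape′) (φ-periodic i)) (climb (ℤ.suc i) K))
                   (ℤ.+-monoʳ-≤ (φ i) (+≤+ (ℕ.*-monoʳ-≤ 2 (ℕ.≮⇒≥ k′≮k))))))
        where
        lemma : ∀ a d K → a + (1ℤ + d) + K ≡ a + (1ℤ + K) + d
        lemma = solve-∀
        lemma′ : ∀ i K → 1ℤ + i + K ≡ i + (1ℤ + K)
        lemma′ = solve-∀
        shape : φ (ℤ.suc i) + + K ≡ φ i + + (2 ℕ.* k′) + + suc d
        shape = trans (cong (_+ + K) e) (trans (lemma (φ i) (+ suc d) (+ K)) (cong (λ m → φ i + + m + + suc d) (sym eq)))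
        shape′ : ℤ.suc i + + K ≡ i + + (2 ℕ.* k′)
        shape′ = trans (lemma′ i (+ K)) (cong (λ m → i + + m) (sym eq))

    linear : ∀ i → φ i ≡ φ 0ℤ + i
    linear = ℤ-induction _ (sym (ℤ.+-identityʳ (φ 0ℤ)))
      (λ i h → trans (tight i) (trans (cong ℤ.suc h) (lemma (φ 0ℤ) i)))
      (λ i h → trans (trans (sym (ℤ.pred-suc (φ i))) (cong ℤ.pred (trans (sym (tight i)) h))) (lemma′ (φ 0ℤ) i))
      where
      lemma : ∀ a i → 1ℤ + (a + i) ≡ a + (1ℤ + i)
      lemma = solve-∀
      lemma′ : ∀ a i → -1ℤ + (a + (1ℤ + i)) ≡ a + i
      lemma′ = solve-∀

    i = proj₁ (R.complete p v here)
    j = i - φ 0ℤ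
    onto : X′.pos j ≡ p
    onto = trans (sym (φ-pos j)) (trans (cong X.pos (trans (linear j) (lemma (φ 0ℤ) i))) (proj₂ (R.complete p v here)))
      where
      lemma : ∀ a i → a + (i - a) ≡ i
      lemma = solve-∀

-- Shift operators and rationality of power series

module Series where
  open import Data.Integer.Base using (_+_; _-_; _*_; -_)
  open import Data.List.Base using (applyUpTo)
  open import Data.Nat.Base using (suc)
  open SubsetSums using (sum-+; sum-*; sum-neg)

  ⊛-congˡ : ∀ {a b} c → a ≗ b → a ⊛ c ≗ b ⊛ c
  ⊛-congˡ c e 0       = cong (λ x → x * c 0 + 0ℤ) (e 0)
  ⊛-congˡ c e (suc m) = cong₂ _+_ (cong (_* c (suc m)) (e 0)) (⊛-congˡ c (e ∘ suc) m)

  ⊛-congʳ : ∀ a {b c} → b ≗ c → a ⊛ b ≗ a ⊛ c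
  ⊛-congʳ a e 0       = cong (λ x → a 0 * x + 0ℤ) (e 0)
  ⊛-congʳ a e (suc m) = cong₂ _+_ (cong (a 0 *_) (e (suc m))) (⊛-congʳ (a ∘ suc) e m)

  ⊛-⊖ : ∀ a b c → a ⊛ (b ⊖ c) ≗ (a ⊛ b) ⊖ (a ⊛ c)
  ⊛-⊖ a b c 0       = lemma (a 0) (b 0) (c 0)
    where
    lemma : ∀ a b c → a * (b - c) + 0ℤ ≡ (a * b + 0ℤ) - (a * c + 0ℤ)
    lemma = solve-∀
  ⊛-⊖ a b c (suc m) = trans (cong (λ x → a 0 * (b (suc m) - c (suc m)) + x) (⊛-⊖ (a ∘ suc) b c m))
    (lemma (a 0) (b (suc m)) (c (suc m)) (((a ∘ suc) ⊛ b) m) (((a ∘ suc) ⊛ c) m))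
    where
    lemma : ∀ a b c x y → a * (b - c) + (x - y) ≡ (a * b + x) - (a * c + y)
    lemma = solve-∀

  ⊖-⊛ : ∀ a b c → (a ⊖ b) ⊛ c ≗ (a ⊛ c) ⊖ (b ⊛ c)
  ⊖-⊛ a b c 0       = lemma (a 0) (b 0) (c 0)
    where
    lemma : ∀ a b c → (a - b) * c + 0ℤ ≡ (a * c + 0ℤ) - (b * c + 0ℤ)
    lemma = solve-∀
  ⊖-⊛ a b c (suc m) = trans (cong (λ x → (a 0 - b 0) * c (suc m) + x) (⊖-⊛ (a ∘ suc) (b ∘ suc) c m))
    (lemma (a 0) (b 0) (c (suc m)) (((a ∘ suc) ⊛ c) m) (((b ∘ suc) ⊛ c) m))
    where
    lemma : ∀ a b c x y → (a - b) * c + (x - y) ≡ (a * c + x) - (b * c + y)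
    lemma = solve-∀

  scale : ℤ → PowerSeries → PowerSeries
  scale ε a m = ε * a m

  ⊛-scale : ∀ ε a b → a ⊛ scale ε b ≗ scale ε (a ⊛ b)
  ⊛-scale ε a b 0       = lemma ε (a 0) (b 0)
    where
    lemma : ∀ ε a b → a * (ε * b) + 0ℤ ≡ ε * (a * b + 0ℤ)
    lemma = solve-∀
  ⊛-scale ε a b (suc m) = trans (cong (λ x → a 0 * (ε * b (suc m)) + x) (⊛-scale ε (a ∘ suc) b m))
    (lemma ε (a 0) (b (suc m)) (((a ∘ suc) ⊛ b) m))
    where
    lemma : ∀ ε a b x → a * (ε * b) + ε * x ≡ ε * (a * b + x)
    lemma = solve-∀

  scale-⊛ : ∀ ε a b → scale ε a ⊛ b ≗ scale ε (a ⊛ b)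
  scale-⊛ ε a b 0       = lemma ε (a 0) (b 0)
    where
    lemma : ∀ ε a b → ε * a * b + 0ℤ ≡ ε * (a * b + 0ℤ)
    lemma = solve-∀
  scale-⊛ ε a b (suc m) = trans (cong (λ x → ε * a 0 * b (suc m) + x) (scale-⊛ ε (a ∘ suc) b m))
    (lemma ε (a 0) (b (suc m)) (((a ∘ suc) ⊛ b) m))
    where
    lemma : ∀ ε a b x → ε * a * b + ε * x ≡ ε * (a * b + x)
    lemma = solve-∀

  delay₁ : PowerSeries → PowerSeries
  delay₁ s 0       = 0ℤ
  delay₁ s (suc m) = s m

  delay : ℕ → PowerSeries → PowerSeries
  delay 0       s = s
  delay (suc e) s = delay₁ (delay e s)

  delay₁-cong : ∀ {s t} → s ≗ t → delay₁ s ≗ delay₁ t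
  delay₁-cong e 0       = refl
  delay₁-cong e (suc m) = e m

  delay-+ : ∀ e s m → delay e s (e ℕ.+ m) ≡ s m
  delay-+ 0       s m = refl
  delay-+ (suc e) s m = delay-+ e s m

  ⊛-delay₁ : ∀ a c → a ⊛ delay₁ c ≗ delay₁ (a ⊛ c)
  ⊛-delay₁ a c 0             = trans (ℤ.+-identityʳ (a 0 * 0ℤ)) (ℤ.*-zeroʳ (a 0))
  ⊛-delay₁ a c (suc 0)       = cong (λ x → a 0 * c 0 + x) (⊛-delay₁ (a ∘ suc) c 0)
  ⊛-delay₁ a c (suc (suc m)) = cong (λ x → a 0 * c (suc m) + x) (⊛-delay₁ (a ∘ suc) c (suc m))

  ⊛-delay : ∀ e a c → a ⊛ delay e c ≗ delay e (a ⊛ c)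
  ⊛-delay 0       a c m = refl
  ⊛-delay (suc e) a c m = trans (⊛-delay₁ a (delay e c) m) (delay₁-cong (⊛-delay e a c) m)

  0-⊛ : ∀ c → (λ _ → 0ℤ) ⊛ c ≗ λ _ → 0ℤ
  0-⊛ c 0       = refl
  0-⊛ c (suc m) = trans (ℤ.+-identityˡ _) (0-⊛ c m)

  t^-⊛ : ∀ e c → (t^ e) ⊛ c ≗ delay e c
  t^-⊛ 0       c 0       = trans (ℤ.+-identityʳ (1ℤ * c 0)) (ℤ.*-identityˡ (c 0))
  t^-⊛ 0       c (suc m) = trans (cong₂ _+_ (ℤ.*-identityˡ (c (suc m))) (0-⊛ c m)) (ℤ.+-identityʳ (c (suc m)))
  t^-⊛ (suc e) c 0       = refl
  t^-⊛ (suc e) c (suc m) = trans (ℤ.+-identityˡ _) (t^-⊛ e c m)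

  ⊛-t^0 : ∀ a → a ⊛ (t^ 0) ≗ a
  ⊛-t^0 a 0       = lemma (a 0)
    where
    lemma : ∀ a → a * 1ℤ + 0ℤ ≡ a
    lemma = solve-∀
  ⊛-t^0 a (suc m) = trans (cong₂ _+_ (ℤ.*-zeroʳ (a 0)) (⊛-t^0 (a ∘ suc) m)) (ℤ.+-identityˡ (a (suc m)))

  ⊛-factor : ∀ ε e {q} → q ≗ t^ 0 ⊖ scale ε (t^ e) → ∀ a c →
    a ⊛ (q ⊛ c) ≗ (a ⊛ c) ⊖ scale ε (delay e (a ⊛ c))
  ⊛-factor ε e q≗ a c m = trans
    (⊛-congʳ a (λ m → trans (⊛-congˡ c q≗ m) (trans (⊖-⊛ (t^ 0) (scale ε (t^ e)) c m)
      (cong₂ _-_ (t^-⊛ 0 c m) (trans (scale-⊛ ε (t^ e) c m) (cong (ε *_) (t^-⊛ e c m)))))) m)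
    (trans (⊛-⊖ a c (scale ε (delay e c)) m) (cong (λ x → (a ⊛ c) m - x)
      (trans (⊛-scale ε a (delay e c) m) (cong (ε *_) (⊛-delay e a c m)))))

  difference : ℕ → PowerSeries → PowerSeries
  difference e s m = s (e ℕ.+ m) - s m

  differences : ℕ → (ℕ → ℕ) → PowerSeries → PowerSeries
  differences 0       e s = s
  differences (suc n) e s = difference (e 0) (differences n (e ∘ suc) s)

  total : ℕ → (ℕ → ℕ) → ℕ
  total 0       e = 0
  total (suc n) e = e 0 ℕ.+ total n (e ∘ suc)

  swap-+ : ∀ a b c → a ℕ.+ (b ℕ.+ c) ≡ b ℕ.+ (a ℕ.+ c)
  swap-+ a b c = trans (sym (ℕ.+-assoc a b c)) (trans (cong (ℕ._+ c) (ℕ.+-comm a b)) (ℕ.+-assoc b a c))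

  -- Multiplication by 1 - t^e turns the coefficient at e + m into the difference of those at e + m
  -- and m; the offsets of all factors add up to `total n e`.
  ⊛-∏ : ∀ n e a m → (a ⊛ ∏ n (λ i → t^ 0 ⊖ t^ e i)) (total n e ℕ.+ m) ≡ differences n e a m
  ⊛-∏ 0       e a m = ⊛-t^0 a m
  ⊛-∏ (suc n) e a m = trans
    (⊛-factor 1ℤ (e 0) (λ m → cong (λ x → (t^ 0) m - x) (sym (ℤ.*-identityˡ ((t^ e 0) m)))) a rest (e 0 ℕ.+ t ℕ.+ m))
    (cong₂ _-_
      (trans (cong (a ⊛ rest) (trans (ℕ.+-assoc (e 0) t m) (swap-+ (e 0) t m))) (⊛-∏ n (e ∘ suc) a (e 0 ℕ.+ m)))
      (trans (ℤ.*-identityˡ _) (trans (cong (delay (e 0) (a ⊛ rest)) (ℕ.+-assoc (e 0) t m))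
        (trans (delay-+ (e 0) (a ⊛ rest) (t ℕ.+ m)) (⊛-∏ n (e ∘ suc) a m)))))
    where
    rest = ∏ n (λ i → t^ 0 ⊖ t^ e (suc i))
    t = total n (e ∘ suc)

  -- `∏` exposes its first factor and `annihilator` its last, so the last difference has to be moved
  -- innermost.
  differences-last : ∀ n e s m → differences (suc n) e s m ≡ differences n e (difference (e n) s) m
  differences-last 0       e s m = refl
  differences-last (suc n) e s m = cong₂ _-_ (differences-last n (e ∘ suc) s (e 0 ℕ.+ m)) (differences-last n (e ∘ suc) s m)

  -- The operator (S² − ε) ∏_{i < k} (S^{e i} − 1), where S is the shift.
  annihilator : ℤ → (ℕ → ℕ) → ℕ → PowerSeries → PowerSeries
  annihilator ε e 0       s m = s (2 ℕ.+ m) - ε * s m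
  annihilator ε e (suc k) s   = difference (e k) (annihilator ε e k s)

  module _ (ε : ℤ) (e : ℕ → ℕ) where
    private
      E : ℕ → PowerSeries → PowerSeries
      E = annihilator ε e

    annihilator-cong : ∀ k {s t} → s ≗ t → E k s ≗ E k t
    annihilator-cong 0       h m = cong₂ (λ x y → x - ε * y) (h (2 ℕ.+ m)) (h m)
    annihilator-cong (suc k) h m = cong₂ _-_ (annihilator-cong k h (e k ℕ.+ m)) (annihilator-cong k h m)

    annihilator-suc : ∀ k s m → E k (s ∘ suc) m ≡ E k s (suc m)
    annihilator-suc 0       s m = refl
    annihilator-suc (suc k) s m = cong₂ _-_
      (trans (annihilator-suc k s (e k ℕ.+ m)) (cong (E k s) (sym (ℕ.+-suc (e k) m)))) (annihilator-suc k s m)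

    annihilator-* : ∀ k a s m → E k (λ m → a * s m) m ≡ a * E k s m
    annihilator-* 0       a s m = lemma a ε (s (2 ℕ.+ m)) (s m)
      where
      lemma : ∀ a ε x y → a * x - ε * (a * y) ≡ a * (x - ε * y)
      lemma = solve-∀
    annihilator-* (suc k) a s m = trans (cong₂ _-_ (annihilator-* k a s (e k ℕ.+ m)) (annihilator-* k a s m))
      (lemma a (E k s (e k ℕ.+ m)) (E k s m))
      where
      lemma : ∀ a x y → a * x - a * y ≡ a * (x - y)
      lemma = solve-∀

    annihilator-sum : ∀ {n} k (g : Subset n → PowerSeries) m →
      E k (λ m → sumOverSubsets λ σ → g σ m) m ≡ sumOverSubsets λ σ → E k (g σ) m
    annihilator-sum {n} 0       g m = sym (trans (sum-+ (λ σ → g σ (2 ℕ.+ m)) (λ σ → - (ε * g σ m)))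
      (cong (λ x → sumOverSubsets (λ σ → g σ (2 ℕ.+ m)) + x)
        (trans (sum-neg {n} (λ σ → ε * g σ m)) (cong -_ (sum-* {n} ε (λ σ → g σ m))))))
    annihilator-sum {n} (suc k) g m = trans
      (cong₂ _-_ (annihilator-sum k g (e k ℕ.+ m)) (annihilator-sum k g m))
      (sym (trans (sum-+ (λ σ → E k (g σ) (e k ℕ.+ m)) (λ σ → - E k (g σ) m))
        (cong (λ x → sumOverSubsets (λ σ → E k (g σ) (e k ℕ.+ m)) + x) (sum-neg {n} (λ σ → E k (g σ) m)))))

    -- Differences of zeros vanish. Thus one operator kills patterns with different numbers of
    -- stones, which occur side by side in one sum.
    annihilated-mono : ∀ {j k s} → j ℕ.≤ k → (∀ m → E j s m ≡ 0ℤ) → ∀ m → E k s m ≡ 0ℤ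
    annihilated-mono {j} {k} {s} j≤k h with ℕ.m≤n⇒∃[o]m+o≡n j≤k
    ... | o , refl = go o
      where
      go : ∀ o m → E (j ℕ.+ o) s m ≡ 0ℤ
      go 0       m = trans (cong (λ k → E k s m) (ℕ.+-identityʳ j)) (h m)
      go (suc o) m = trans (cong (λ k → E k s m) (ℕ.+-suc j o)) (cong₂ _-_ (go o (e (j ℕ.+ o) ℕ.+ m)) (go o m))

    -- Both operators are polynomials in the shift, so they commute.
    annihilator-difference : ∀ k d s m → E k (difference d s) m ≡ difference d (E k s) m
    annihilator-difference 0       d s m = trans (lemma ε (s (d ℕ.+ (2 ℕ.+ m))) (s (2 ℕ.+ m)) (s (d ℕ.+ m)) (s m))
      (cong (λ i → (s i - ε * s (d ℕ.+ m)) - (s (2 ℕ.+ m) - ε * s m)) (swap-+ d 2 m))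
      where
      lemma : ∀ ε a b c x → (a - b) - ε * (c - x) ≡ (a - ε * c) - (b - ε * x)
      lemma = solve-∀
    annihilator-difference (suc k) d s m = trans
      (cong₂ _-_ (annihilator-difference k d s (e k ℕ.+ m)) (annihilator-difference k d s m))
      (trans (lemma (E k s (d ℕ.+ (e k ℕ.+ m))) (E k s (e k ℕ.+ m)) (E k s (d ℕ.+ m)) (E k s m))
        (cong (λ i → (E k s i - E k s (d ℕ.+ m)) - (E k s (e k ℕ.+ m) - E k s m)) (swap-+ d (e k) m)))
      where
      lemma : ∀ a b c x → (a - b) - (c - x) ≡ (a - c) - (b - x)
      lemma = solve-∀

    annihilator-differences : ∀ k s m → E 0 (differences k e s) m ≡ E k s m
    annihilator-differences 0       s m = refl
    annihilator-differences (suc k) s m = trans (annihilator-cong 0 (differences-last k e s) m)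
      (trans (annihilator-differences k (difference (e k) s) m) (annihilator-difference k (e k) s m))

  eventually-zero : ∀ (b : PowerSeries) M → (∀ m → b (M ℕ.+ m) ≡ 0ℤ) → b ≗ ⟦ applyUpTo b M ⟧
  eventually-zero b 0       z m       = z m
  eventually-zero b (suc M) z 0       = refl
  eventually-zero b (suc M) z (suc m) = eventually-zero (b ∘ suc) M z m

  eventually-polynomial : ∀ (b : PowerSeries) M → (∀ m → b (M ℕ.+ m) ≡ 0ℤ) → ∃ λ (h : Polynomial) → b ≗ ⟦ h ⟧
  eventually-polynomial b M z = applyUpTo b M , eventually-zero b M z

  rational : ∀ ε {q} → q ≗ t^ 0 ⊖ scale ε (t^ 2) → ∀ n e a → (∀ m → annihilator ε e n a (suc m) ≡ 0ℤ) →
    ∃ λ (h : Polynomial) → a ⊛ (q ⊛ ∏ n (λ i → t^ 0 ⊖ t^ e i)) ≗ ⟦ h ⟧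
  -- The 2 comes from the factor 1 - ε t², the `suc` from the coefficient of index 0, about which
  -- nothing is assumed.
  rational ε {q} q≗ n e a z = eventually-polynomial (a ⊛ (q ⊛ P)) (2 ℕ.+ suc (total n e)) λ m →
    trans (⊛-factor ε 2 q≗ a P (2 ℕ.+ suc (total n e) ℕ.+ m))
    (trans (cong₂ (λ x y → x - ε * y)
      (at-shifted (2 ℕ.+ suc m) (trans (cong (suc ∘ suc) (sym (ℕ.+-suc t m))) (swap-+ 2 t (suc m))))
      (at-shifted (suc m) (sym (ℕ.+-suc t m))))
    (trans (annihilator-differences ε e n a (suc m)) (z m)))
    where
    P = ∏ n (λ i → t^ 0 ⊖ t^ e i)
    t = total n e
    at-shifted : ∀ j {i} → i ≡ t ℕ.+ j → (a ⊛ P) i ≡ differences n e a j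
    at-shifted j refl = ⊛-∏ n e a j

-- Annihilation of the series by induction on the number of stones

module Annihilation where
  open import Data.Fin.Properties using (any?)
  open import Data.Integer.Base using (_+_; _-_; _*_; -_)
  open import Data.Nat.Base using (suc)
  open import Data.Nat.GeneralisedArithmetic using (iterate)
  open import Data.Nat.Induction using (<-rec)
  open SubsetSums
  open Circle
  open Cells
  open LocalRules
  open Patterns
  open Recurrence
  open Initial
  open Realisation
  open Dynamics
  open Series

  sum-single : ∀ {n} (g : Subset n → ℤ) C → (∀ c → c ≢ C → g c ≡ 0ℤ) → sumOverSubsets g ≡ g C
  sum-single g []      z = refl
  sum-single {suc n} g (true ∷ C) z = trans
    (cong₂ _+_ (sum-single (g ∘ (true ∷_)) C λ c n → z (true ∷ c) λ { refl → n refl })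
               (trans (sum-cong λ c → z (false ∷ c) λ ()) (sum-zero n)))
    (ℤ.+-identityʳ (g (true ∷ C)))
  sum-single {suc n} g (false ∷ C) z = trans
    (cong₂ _+_ (trans (sum-cong λ c → z (true ∷ c) λ ()) (sum-zero n))
               (sum-single (g ∘ (false ∷_)) C λ c n → z (false ∷ c) λ { refl → n refl }))
    (ℤ.+-identityˡ (g (false ∷ C)))

  missing-element : ∀ {n} (c C : Subset n) → (∀ x → c ∋ x → C ∋ x) → c ≢ C → ∃ λ x → C ∋ x × lookup c x ≡ false
  missing-element []          []          c⊆ n = ⊥-elim (n refl)
  missing-element (false ∷ c) (true ∷ C)  c⊆ n = Fin.zero , refl , refl
  missing-element (true ∷ c)  (false ∷ C) c⊆ n with () ← c⊆ Fin.zero refl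
  missing-element (true ∷ c)  (true ∷ C)  c⊆ n =
    let (x , p , q) = missing-element c C (c⊆ ∘ Fin.suc) (n ∘ cong (true ∷_)) in Fin.suc x , p , q
  missing-element (false ∷ c) (false ∷ C) c⊆ n =
    let (x , p , q) = missing-element c C (c⊆ ∘ Fin.suc) (n ∘ cong (false ∷_)) in Fin.suc x , p , q

  sign : ℕ → ℤ
  sign 0       = 1ℤ
  sign (suc h) = - sign h

  -- Unlike in the type of `sgn`, no argument depends on the length, which can therefore be
  -- rewritten as h + h.
  sgnUpTo : ℕ → (ℕ → Bool) → ℤ
  sgnUpTo 0       x = 1ℤ
  sgnUpTo (suc n) x = if x 0 then - sgnUpTo n (x ∘ suc) else sgnUpTo n (x ∘ suc)

  sgn-window : ∀ N x → sgn (window N x) ≡ sgnUpTo N (x ∘ +_)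
  sgn-window N x = go N (x ∘ +_)
    where
    go : ∀ N (y : ℕ → Bool) → sgn (tabulate {n = N} (y ∘ toℕ)) ≡ sgnUpTo N y
    go 0       y = refl
    go (suc N) y with y 0
    ... | true  = cong -_ (go N (y ∘ suc))
    ... | false = go N (y ∘ suc)

  sgn-empty : ∀ N x → (∀ k → x k ≡ false) → sgnUpTo N x ≡ 1ℤ
  sgn-empty 0       x e = refl
  sgn-empty (suc N) x e rewrite e 0 = sgn-empty N (x ∘ suc) (e ∘ suc)

  -- Each of the h pairs of consecutive places contributes exactly one change of sign.
  sgn-alternating : ∀ h x → (∀ k → x (suc k) ≡ not (x k)) → sgnUpTo (h ℕ.+ h) x ≡ sign h
  sgn-alternating 0       x e = refl
  sgn-alternating (suc h) x e rewrite ℕ.+-suc h h with x 0 | x 1 | e 0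
  ... | true  | false | _ = cong -_ (sgn-alternating h (x ∘ suc ∘ suc) λ k → e (suc (suc k)))
  ... | false | true  | _ = cong -_ (sgn-alternating h (x ∘ suc ∘ suc) λ k → e (suc (suc k)))

  -- The effect of `step` on a cell of a pattern without stones. Applied twice to an unmarked cell
  -- it toggles it, which amounts to a rotation by one place.
  exchange : Cell → Cell
  exchange A⁺ = B⁺
  exchange A⁻ = B⁻
  exchange B⁻ = A⁺
  exchange B⁺ = A⁻
  exchange A× = A⁻

  Stoneless : (ℤ → Cell) → Set
  Stoneless z = ∀ p → ¬ ∃ (Stone z p)

  record Returning (N : ℕ) : Set where
    field
      returns : ∀ k → 0 ℕ.< k → (X : Necklace k N) → iterate T X (N ℕ.∸ 3 ℕ.* k) ≅ X

  -- The index i starts at 0 and stands for k = i + 1. The factor 2 removes the unknown sign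
  -- acquired along a cycle of necklaces.
  cycleExponent : ℕ → ℕ → ℕ
  cycleExponent N i = 2 ℕ.* (N ℕ.∸ 3 ℕ.* suc i)

  module _ {n : ℕ} where
    private N = suc (suc n)

    stone-or-none : ∀ {z} → Periodic N z → (∃ λ p → ∃ (Stone z p)) ⊎ Stoneless z
    stone-or-none {z} pz with any? {n = N} (λ i → hasStone? z (+ toℕ i))
    ... | yes (i , s) = inj₁ (+ toℕ i , s)
    ... | no ¬s = inj₂ λ p (v , s , t) → ¬s (residue (suc n) p , v ,
          trans (sym (at-residue pz p)) s ,
          trans (sym (at-residue {z = λ q → z (q + 1ℤ)} (periodic-shift {x = z} pz 1ℤ) p)) t)

    module _ {z : ℤ → Cell} (P : Pattern N z) where
      open Pattern P

      -- If every meeting place is chosen, nothing is marked.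
      successor-full : successor P (sectors P) ≗ step z
      successor-full = step-cong λ p → cong (if_then A× else z p)
        (trans (cong (λ b → meeting z p ∧ not b) (extend-window (meeting-periodic {N} periodic) p))
               (Bool.∧-inverseʳ (meeting z p)))

      successor-pattern : ∀ c → Pattern N (successor P c)
      successor-pattern c = record
        { good     = step-good {mark z (extend c)} marked
        ; unmarked = step-unmarked {mark z (extend c)} marked
        ; periodic = step-periodic {N} {mark z (extend c)} (mark-periodic {N} {z} {extend c} periodic (extend-periodic c)) }
        where marked = mark-good {z} good unmarked (extend c)

      stone-erase : ∀ c p v → Stone (successor P c) p v → Stone (step z) p v
      stone-erase c p v s =
        let (a , b) = marks-erase {mark z (extend c)} (mark-good {z} good unmarked (extend c)) p v s
            erased = step-cong (plain-mark {z} good unmarked (extend c))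
        in trans (sym (erased p)) a , trans (sym (erased (p + 1ℤ))) b

      -- An omitted meeting place is marked, and `marked-stone` names the stone that disappears.
      stone-lost : ∀ c → (∀ x → c ∋ x → sectors P ∋ x) → c ≢ sectors P →
        ∃₂ λ p v → Stone (step z) p v × (∀ w → ¬ Stone (successor P c) p w)
      stone-lost c c⊆ c≢ = q , Defs.1⃗ , (trans (sym (erased q)) (proj₁ here) , trans (sym (erased (q + 1ℤ))) (proj₂ here)) , proj₂ lost
        where
        i = proj₁ (missing-element c (sectors P) c⊆ c≢)
        q = + toℕ i + -[1+ 1 ]
        here-not = proj₂ (missing-element c (sectors P) c⊆ c≢)
        erased = step-cong (plain-mark {z} good unmarked (extend c))
        marked : mark z (extend c) (+ toℕ i) ≡ A×
        marked = cong (if_then A× else z (+ toℕ i)) (cong₂ (λ a b → a ∧ not b)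
          (trans (sym (lookup-window (meeting z) i)) (proj₁ here-not))
          (trans (extend-at c i) (proj₂ here-not)))
        lost = marked-stone {mark z (extend c)} (mark-good {z} good unmarked (extend c)) (+ toℕ i) marked
        here = proj₁ lost

    private
      -- A meeting place always has a stone of length 1 on its left.
      no-carrier : ∀ {z} (P : Pattern N z) → Stoneless z → ∀ p → meeting z p ≡ false
      no-carrier {z} P none p = not-true λ e → none (p + -1ℤ)
        (Defs.-1⃗ , split e)
        where
        open Pattern P
        split : meeting z p ≡ true → Stone z (p + -1ℤ) Defs.-1⃗
        split e = go (z (p + -1ℤ)) (z (p + 0ℤ)) (z (p + 1ℤ)) refl refl (unmarked (p + 0ℤ)) e
          where
          cancel : ∀ p → p + -1ℤ + 1ℤ ≡ p + 0ℤ
          cancel = solve-∀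
          go : ∀ a b c → z (p + -1ℤ) ≡ a → z (p + 0ℤ) ≡ b → b ≢ A× → meetingᵇ (a ∷ b ∷ c ∷ []) ≡ true → Stone z (p + -1ℤ) Defs.-1⃗
          go B⁻ A⁻ B⁻ x y _ _ = x , trans (cong z (cancel p)) y
          go B⁻ A× B⁻ _ _ n _ = ⊥-elim (n refl)

      module Toggling {z : ℤ → Cell} (P : Pattern N z) (none : Stoneless z) where
        open Pattern P
        toggling : ∀ p → z (p + 1ℤ) ≡ toggle (z p)
        toggling p with stone-or-toggle {z} good unmarked p
        ... | inj₁ s = ⊥-elim (none p s)
        ... | inj₂ e = e

        rule : ∀ p → step z p ≡ exchange (z p) × firstRow z p ≡ (z p ≡ᵇ A⁺)
        rule p = subst (λ c → step z p ≡ exchange c × firstRow z p ≡ (c ≡ᵇ A⁺)) (at-0 z p)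
          (locally 1
            (λ { (a ∷ b ∷ c ∷ d ∷ e ∷ []) → b ≡ toggle a → c ≡ toggle b → d ≡ toggle c → e ≡ toggle d → c ≢ A× →
                 advance (a ∷ b ∷ c ∷ d ∷ e ∷ []) ≡ exchange c × presentᵇ (b ∷ c ∷ d ∷ []) ≡ (c ≡ᵇ A⁺) })
            (λ { (a ∷ b ∷ c ∷ d ∷ e ∷ []) → (_ ≟ _) →-dec ((_ ≟ _) →-dec ((_ ≟ _) →-dec ((_ ≟ _) →-dec
                 (¬? (_ ≟ _) →-dec ((_ ≟ _) ×-dec (_ Bool.≟ _)))))) })
            refl {z} good p -[1+ 1 ] (toggled (l₁ p)) (toggled (l₂ p)) (toggled (l₃ p)) (toggled (l₄ p)) (unmarked (p + 0ℤ)))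
          where
          toggled : ∀ {q r} → r ≡ q + 1ℤ → z r ≡ toggle (z q)
          toggled {q} refl = toggling q
          l₁ : ∀ p → p + -1ℤ ≡ p + -[1+ 1 ] + 1ℤ
          l₁ = solve-∀
          l₂ : ∀ p → p + + 0 ≡ p + -1ℤ + 1ℤ
          l₂ = solve-∀
          l₃ : ∀ p → p + + 1 ≡ p + + 0 + 1ℤ
          l₃ = solve-∀
          l₄ : ∀ p → p + + 2 ≡ p + + 1 + 1ℤ
          l₄ = solve-∀

        exchanged : ∀ p → step z p ≡ exchange (z p)
        exchanged p = proj₁ (rule p)

        present : ∀ p → firstRow z p ≡ (z p ≡ᵇ A⁺)
        present p = proj₂ (rule p)

        still-none : Stoneless (step z)
        still-none p (v , s) = let (u , s′) = jumped-from {z} good p v s in none _ (u , s′)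

    private
      module _ {z w : ℤ → Cell} (tz : ∀ k → z (+ suc k) ≡ toggle (z (+ k)))
               (ew : ∀ k → w (+ k) ≡ exchange (z (+ k))) where

        zoneA : z 0ℤ ≡ A⁺ ⊎ z 0ℤ ≡ A⁻ → ∀ k → z (+ k) ≡ A⁺ ⊎ z (+ k) ≡ A⁻
        zoneA b 0       = b
        zoneA b (suc k) with zoneA b k
        ... | inj₁ x = inj₂ (trans (tz k) (cong toggle x))
        ... | inj₂ x = inj₁ (trans (tz k) (cong toggle x))

        zoneB : z 0ℤ ≡ B⁻ ⊎ z 0ℤ ≡ B⁺ → ∀ k → z (+ k) ≡ B⁻ ⊎ z (+ k) ≡ B⁺
        zoneB b 0       = b
        zoneB b (suc k) with zoneB b k
        ... | inj₁ x = inj₂ (trans (tz k) (cong toggle x))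
        ... | inj₂ x = inj₁ (trans (tz k) (cong toggle x))

        Signs : ℕ → Set
        Signs h = sgnUpTo (h ℕ.+ h) (λ k → z (+ k) ≡ᵇ A⁺) * sgnUpTo (h ℕ.+ h) (λ k → w (+ k) ≡ᵇ A⁺) ≡ sign h

        signsA : ∀ h → z 0ℤ ≡ A⁺ ⊎ z 0ℤ ≡ A⁻ →
          Signs h
        signsA h b = trans (cong₂ _*_
            (sgn-alternating h _ λ k → alternates (zoneA b k) (tz k))
            (sgn-empty (h ℕ.+ h) _ λ k → gone (zoneA b k) (ew k)))
          (ℤ.*-identityʳ (sign h))
          where
          alternates : ∀ {c d} → c ≡ A⁺ ⊎ c ≡ A⁻ → d ≡ toggle c → (d ≡ᵇ A⁺) ≡ not (c ≡ᵇ A⁺)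
          alternates (inj₁ refl) refl = refl
          alternates (inj₂ refl) refl = refl
          gone : ∀ {c d} → c ≡ A⁺ ⊎ c ≡ A⁻ → d ≡ exchange c → (d ≡ᵇ A⁺) ≡ false
          gone (inj₁ refl) refl = refl
          gone (inj₂ refl) refl = refl

        signsB : ∀ h → z 0ℤ ≡ B⁻ ⊎ z 0ℤ ≡ B⁺ →
          Signs h
        signsB h b = trans (cong₂ _*_
            (sgn-empty (h ℕ.+ h) _ λ k → gone (zoneB b k))
            (sgn-alternating h _ λ k → alternates (zoneB b k) (ew k) (trans (ew (suc k)) (cong exchange (tz k)))))
          (ℤ.*-identityˡ (sign h))
          where
          gone : ∀ {c} → c ≡ B⁻ ⊎ c ≡ B⁺ → (c ≡ᵇ A⁺) ≡ false
          gone (inj₁ refl) = refl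
          gone (inj₂ refl) = refl
          alternates : ∀ {c d d′} → c ≡ B⁻ ⊎ c ≡ B⁺ → d ≡ exchange c → d′ ≡ exchange (toggle c) →
                       (d′ ≡ᵇ A⁺) ≡ not (d ≡ᵇ A⁺)
          alternates (inj₁ refl) refl refl = refl
          alternates (inj₂ refl) refl refl = refl

        -- Without stones the circle is a single zone. If it is a zone A, the first row has h
        -- vertices and the next one none; for a zone B it is the other way round.
        signs : ∀ h → z 0ℤ ≢ A× →
          Signs h
        signs h z≢ = go (z 0ℤ) refl
          where
          go : ∀ c → z 0ℤ ≡ c → Signs h
          go A⁺ e = signsA h (inj₁ e)
          go A⁻ e = signsA h (inj₂ e)
          go B⁻ e = signsB h (inj₁ e)
          go B⁺ e = signsB h (inj₂ e)
          go A× e = ⊥-elim (z≢ e)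

    isolate : ∀ (C : Subset N) (value : Subset N → ℤ) →
      (∀ c → (∀ x → c ∋ x → C ∋ x) → c ≢ C → value c ≡ 0ℤ) →
      sumOverSubsets (λ c → 𝟙 (c ⊆ᵇ C) * (sgn c * value c)) ≡ sgn C * value C
    isolate C value z = trans
      (sum-single (λ c → 𝟙 (c ⊆ᵇ C) * (sgn c * value c)) C λ c c≢ →
        trans (𝟙-cong (c ⊆ᵇ C) λ e → trans (cong (sgn c *_) (z c (⊆ᵇ-elim c C e) c≢)) (ℤ.*-zeroʳ (sgn c)))
              (ℤ.*-zeroʳ (𝟙 (c ⊆ᵇ C))))
      (trans (cong (λ b → 𝟙 b * (sgn C * value C)) (⊆ᵇ-intro C C λ _ p → p)) (ℤ.*-identityˡ (sgn C * value C)))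

    stoneless-step : ∀ {z} (P : Pattern N z) → Stoneless z → ∀ m →
      patternZ N (suc m) z ≡ sgn (window N (firstRow z)) * patternZ N m (step z)
    stoneless-step {z} P none m = trans (recurrence P m) (cong (sgn (window N (firstRow z)) *_) (trans
      (isolate (sectors P) (λ c → patternZ N m (successor P c)) λ c c⊆ c≢ →
        let (i , i∈ , _) = missing-element c (sectors P) c⊆ c≢ in
        ⊥-elim (true≢false (trans (sym (lookup-window (meeting z) i)) i∈) (no-carrier P none (+ toℕ i))))
      (trans (cong₂ _*_ (trans (sgn-window N (meeting z)) (sgn-empty N (meeting z ∘ +_) (λ k → no-carrier P none (+ k))))
                        (patternZ-cong N m (successor-full P)))
             (ℤ.*-identityˡ (patternZ N m (step z))))))

    stoneless-twice : ∀ {h} → N ≡ h ℕ.+ h → ∀ {z} → Pattern N z → Stoneless z → ∀ m →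
      patternZ N (2 ℕ.+ m) z ≡ sign h * patternZ N m z
    stoneless-twice {h} N≡ {z} P none m = begin
      patternZ N (2 ℕ.+ m) z
        ≡⟨ stoneless-step P none (suc m) ⟩
      s z * patternZ N (suc m) (step z)
        ≡⟨ cong (s z *_) (stoneless-step P′ Tg.still-none m) ⟩
      s z * (s (step z) * patternZ N m (step (step z)))
        ≡⟨ ℤ.*-assoc (s z) (s (step z)) _ ⟨
      s z * s (step z) * patternZ N m (step (step z))
        ≡⟨ cong₂ _*_ product (trans (patternZ-cong N m shifted) (patternZ-shift P 1ℤ m)) ⟩
      sign h * patternZ N m z ∎
      where
      open ≡-Reasoning
      open Pattern P using (unmarked)
      module Tg = Toggling P none
      P′ : Pattern N (step z)
      P′ = step-pattern {N} {z} P
      module Tg′ = Toggling P′ Tg.still-none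
      s : (ℤ → Cell) → ℤ
      s y = sgn (window N (firstRow y))
      exchange² : ∀ c → c ≢ A× → exchange (exchange c) ≡ toggle c
      exchange² A⁺ _ = refl
      exchange² A⁻ _ = refl
      exchange² B⁻ _ = refl
      exchange² B⁺ _ = refl
      exchange² A× n = ⊥-elim (n refl)
      shifted : ∀ p → step (step z) p ≡ z (p + 1ℤ)
      shifted p = trans (Tg′.exchanged p) (trans (cong exchange (Tg.exchanged p))
        (trans (exchange² (z p) (unmarked p)) (sym (Tg.toggling p))))
      row : ∀ {y} (Q : Pattern N y) (none : Stoneless y) → s y ≡ sgnUpTo (h ℕ.+ h) (λ k → y (+ k) ≡ᵇ A⁺)
      row {y} Q none = trans (cong (sgn {N}) (window-cong {N} (Toggling.present Q none)))
        (trans (sgn-window N (λ p → y p ≡ᵇ A⁺)) (cong (λ M → sgnUpTo M (λ k → y (+ k) ≡ᵇ A⁺)) N≡))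
      product : s z * s (step z) ≡ sign h
      product = trans (cong₂ _*_ (row P none) (row P′ Tg.still-none))
        (signs {z} {step z} (λ k → trans (cong (z ∘ +_) (ℕ.+-comm 1 k)) (Tg.toggling (+ k)))
               (λ k → Tg.exchanged (+ k)) h (unmarked 0ℤ))

    module _ (closed : Returning N)
             {h : ℕ} (N≡h+h : N ≡ h ℕ.+ h) where
      private
        exponent : ℕ → ℕ
        exponent = cycleExponent N

        E : ℕ → (ℕ → ℤ) → ℕ → ℤ
        E = annihilator (sign h) exponent

        series : (ℤ → Cell) → ℕ → ℤ
        series z m = patternZ N m z

      stoneless-annihilated : ∀ {z} → Pattern N z → Stoneless z → ∀ m → E 0 (series z) m ≡ 0ℤ
      stoneless-annihilated {z} P none m = trans (cong (_- sign h * series z m) (stoneless-twice {h} N≡h+h P none m))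
        (ℤ.+-inverseʳ (sign h * series z m))

      private
        -- A pattern either has no stones or represents a necklace with at most κ pairs; in both
        -- cases the operator of level κ contains one that annihilates its series.
        by-stones : ∀ κ {z} → Pattern N z →
          (∀ {k} → 0 ℕ.< k → (X : Necklace k N) → Represents z X → k ℕ.≤ κ × (∀ m → E k (series z) m ≡ 0ℤ)) →
          ∀ m → E κ (series z) m ≡ 0ℤ
        by-stones κ {z} P killed = go (stone-or-none (Pattern.periodic P))
          where
          go : (∃ λ p → ∃ (Stone z p)) ⊎ Stoneless z → ∀ m → E κ (series z) m ≡ 0ℤ
          go (inj₂ none) = annihilated-mono (sign h) exponent {0} {κ} {series z} ℕ.z≤n (stoneless-annihilated P none)
          go (inj₁ (_ , s₀)) = let (k , k>0 , X , R) = realise P s₀ ; (k≤κ , e) = killed k>0 X R in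
            annihilated-mono (sign h) exponent {k} {κ} {series z} k≤κ e

        Annihilated : ℕ → Set
        Annihilated k = 0 ℕ.< k → ∀ {z} {X : Necklace k N} → Pattern N z → Represents z X →
                        ∀ m → E k (series z) m ≡ 0ℤ

        -- Merging zones leaves fewer stones, so modulo series already annihilated only
        -- the term without mergers survives, and it belongs to T X.
        module Cycle (κ : ℕ) (ih : ∀ {k} → k ℕ.< suc κ → Annihilated k) where

          -- A proper subset c loses a stone of the transformed necklace, so the remainder, which
          -- may have no stones at all, falls under the induction hypothesis or the base operator.
          lower : ∀ {z} {X : Necklace (suc κ) N} → (P : Pattern N z) → Represents z X → ∀ c →
            (∀ x → c ∋ x → sectors P ∋ x) → c ≢ sectors P → ∀ m → E κ (series (successor P c)) m ≡ 0ℤ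
          lower {z} {X} P R c c⊆ c≢ = by-stones κ {successor P c} (successor-pattern P c) λ k>0 X′ R′ →
            let (p , v , here , gone) = stone-lost P c c⊆ c≢
                k< = fewer-stones {y = successor P c} {z = step z} {X′ = X′} (represents-step X {z} (Pattern.good P) R) R′ k>0
                       (stone-erase P c) p v here gone
            in ℕ.≤-pred k< , ih k< k>0 {successor P c} {X′} (successor-pattern P c) R′

          Sign : ℤ → Set
          Sign s = s * s ≡ 1ℤ

          Sign-* : ∀ s t → Sign s → Sign t → Sign (s * t)
          Sign-* s t p q = trans (lemma s t) (trans (cong₂ _*_ p q) (ℤ.*-identityˡ 1ℤ))
            where
            lemma : ∀ s t → (s * t) * (s * t) ≡ (s * s) * (t * t)
            lemma = solve-∀

          once : ∀ {z} {X : Necklace (suc κ) N} → Pattern N z → Represents z X →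
            ∃ λ s → Sign s × (∀ m → E κ (series z) (suc m) ≡ s * E κ (series (step z)) m)
          once {z} P R = sgn A * sgn C , Sign-* (sgn A) (sgn C) (sgn² A) (sgn² C) , λ m → begin
            E κ (series z) (suc m)
              ≡⟨ annihilator-suc (sign h) exponent κ (series z) m ⟨
            E κ (series z ∘ suc) m
              ≡⟨ annihilator-cong (sign h) exponent κ (recurrence P) m ⟩
            E κ (λ m → sgn A * sumOverSubsets λ c → 𝟙 (c ⊆ᵇ C) * (sgn c * series (successor P c) m)) m
              ≡⟨ annihilator-* (sign h) exponent κ (sgn A) (λ m → sumOverSubsets λ c → 𝟙 (c ⊆ᵇ C) * (sgn c * series (successor P c) m)) m ⟩
            sgn A * E κ (λ m → sumOverSubsets λ c → 𝟙 (c ⊆ᵇ C) * (sgn c * series (successor P c) m)) m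
              ≡⟨ cong (sgn A *_) (annihilator-sum (sign h) exponent κ (λ c m → 𝟙 (c ⊆ᵇ C) * (sgn c * series (successor P c) m)) m) ⟩
            sgn A * sumOverSubsets (λ c → E κ (λ m → 𝟙 (c ⊆ᵇ C) * (sgn c * series (successor P c) m)) m)
              ≡⟨ cong (sgn A *_) (sum-cong λ c → trans (annihilator-* (sign h) exponent κ (𝟙 (c ⊆ᵇ C)) (λ m → sgn c * series (successor P c) m) m)
                   (cong (𝟙 (c ⊆ᵇ C) *_) (annihilator-* (sign h) exponent κ (sgn c) (series (successor P c)) m))) ⟩
            sgn A * sumOverSubsets (λ c → 𝟙 (c ⊆ᵇ C) * (sgn c * E κ (series (successor P c)) m))
              ≡⟨ cong (sgn A *_) (isolate C (λ c → E κ (series (successor P c)) m) λ c c⊆ c≢ → lower P R c c⊆ c≢ m) ⟩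
            sgn A * (sgn C * E κ (series (successor P C)) m)
              ≡⟨ cong (λ x → sgn A * (sgn C * x)) (annihilator-cong (sign h) exponent κ (λ m → patternZ-cong N m (successor-full P)) m) ⟩
            sgn A * (sgn C * E κ (series (step z)) m)
              ≡⟨ ℤ.*-assoc (sgn A) (sgn C) _ ⟨
            sgn A * sgn C * E κ (series (step z)) m ∎
            where
            open ≡-Reasoning
            A = window N (firstRow z)
            C = sectors P

          many : ∀ L {z} {X : Necklace (suc κ) N} → Pattern N z → Represents z X →
            ∃₂ λ s y → Sign s × Pattern N y × Represents y (iterate T X L) ×
              (∀ m → E κ (series z) (L ℕ.+ m) ≡ s * E κ (series y) m)
          many 0       {z} P R = 1ℤ , z , refl , P , R , λ m → sym (ℤ.*-identityˡ (E κ (series z) m))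
          many (suc L) {z} {X} P R =
            let (s , ss , e) = once P R
                (t , y , tt , Q , S , e′) = many L (step-pattern P) (represents-step X {z} (Pattern.good P) R)
            in s * t , y , Sign-* s t ss tt , Q , S , λ m →
               trans (e (L ℕ.+ m)) (trans (cong (s *_) (e′ m)) (sym (ℤ.*-assoc s t (E κ (series y) m))))

          annihilated : Annihilated (suc κ)
          annihilated k>0 {z} {X} P R m =
            let (s , y , ss , Q , S , e) = many L P R
                round = λ m → trans (e m) (cong (s *_) (annihilator-cong (sign h) exponent κ
                  (λ m → sym (patternZ-≅ {X = iterate T X L} {Y = X} Q P S R (Returning.returns closed (suc κ) k>0 X) m)) m))
            -- One round multiplies the series by s, two rounds by s * s = 1; accordingly
            -- `cycleExponent` unfolds to L + (L + 0).
            in trans (cong (λ i → E κ (series z) i - E κ (series z) m)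
                       (trans (cong (λ j → (L ℕ.+ j) ℕ.+ m) (ℕ.+-identityʳ L)) (ℕ.+-assoc L L m)))
               (trans (cong (_- E κ (series z) m) (trans (round (L ℕ.+ m)) (trans (cong (s *_) (round m))
                   (trans (sym (ℤ.*-assoc s s _)) (trans (cong (_* E κ (series z) m) ss) (ℤ.*-identityˡ _))))))
                 (ℤ.+-inverseʳ (E κ (series z) m)))
            where L = N ℕ.∸ 3 ℕ.* suc κ

      necklace-annihilated : ∀ k → Annihilated k
      necklace-annihilated = <-rec Annihilated λ
        { 0       _  () _
        ; (suc κ) ih → Cycle.annihilated κ ih }

      -- All initial patterns have at most K pairs of stones, so one operator annihilates every
      -- summand of `f-initial`.
      cycle-annihilated : ∀ K → (∀ k → 4 ℕ.* k ℕ.≤ N → k ℕ.≤ K) →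
        ∀ m → annihilator (sign h) (cycleExponent N) K (f N) (suc m) ≡ 0ℤ
      cycle-annihilated K bound m = begin
        E K (f N) (suc m)
          ≡⟨ annihilator-suc (sign h) exponent K (f N) m ⟨
        E K (f N ∘ suc) m
          ≡⟨ annihilator-cong (sign h) exponent K (f-initial odd-N) m ⟩
        E K (λ m → sumOverSubsets λ c → 𝟙 (c ⊆ᵇ odds) * (sgn c * series (initial (extend c)) m)) m
          ≡⟨ annihilator-sum (sign h) exponent K (λ c m → 𝟙 (c ⊆ᵇ odds) * (sgn c * series (initial (extend c)) m)) m ⟩
        sumOverSubsets (λ c → E K (λ m → 𝟙 (c ⊆ᵇ odds) * (sgn c * series (initial (extend c)) m)) m)
          ≡⟨ sum-cong (λ c → trans (annihilator-* (sign h) exponent K (𝟙 (c ⊆ᵇ odds)) (λ m → sgn c * series (initial (extend c)) m) m)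
               (trans (cong (𝟙 (c ⊆ᵇ odds) *_) (trans (annihilator-* (sign h) exponent K (sgn c) (series (initial (extend c))) m)
                 (trans (cong (sgn c *_) (start c m)) (ℤ.*-zeroʳ (sgn c))))) (ℤ.*-zeroʳ (𝟙 (c ⊆ᵇ odds))))) ⟩
        sumOverSubsets {N} (λ _ → 0ℤ)
          ≡⟨ sum-zero N ⟩
        0ℤ ∎
        where
        open ≡-Reasoning
        odds = window N odd
        odd-N : Periodic N odd
        odd-N = subst (λ M → Periodic M odd) (sym N≡h+h) (odd-periodic h)
        start : ∀ c m → E K (series (initial (extend c))) m ≡ 0ℤ
        start c = by-stones K {initial (extend c)} (initial-pattern odd-N (extend-periodic c)) λ {k} k>0 X R →
          bound k (necklace-size X) , necklace-annihilated k k>0 {initial (extend c)} {X} (initial-pattern odd-N (extend-periodic c)) R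

  module _ {N n : ℕ} (N≡ : N ≡ suc (suc n))
    (closed : Returning N)
    {h : ℕ} (N≡h+h : N ≡ h ℕ.+ h)
    (K : ℕ) (bound : ∀ k → 4 ℕ.* k ℕ.≤ N → k ℕ.≤ K)
    {e : ℕ → ℕ} (e≡ : ∀ i → cycleExponent N i ≡ e i) where

    private
      -- The length is generalised so that the equation can be matched: `4 * suc k` does not reduce
      -- to the form `suc (suc n)`.
      annihilated : ∀ {N} → N ≡ suc (suc n) → Returning N → N ≡ h ℕ.+ h → (∀ k → 4 ℕ.* k ℕ.≤ N → k ℕ.≤ K) →
        ∀ m → annihilator (sign h) (cycleExponent N) K (f N) (suc m) ≡ 0ℤ
      annihilated refl closed N≡h+h bound = cycle-annihilated {n} closed {h} N≡h+h K bound

      ∏-cong : ∀ K {a b : ℕ → PowerSeries} → (∀ i → a i ≡ b i) → ∏ K a ≡ ∏ K b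
      ∏-cong 0       e = refl
      ∏-cong (suc K) e = cong₂ _⊛_ (e 0) (∏-cong K λ i → e (suc i))

      factors : ∏ K (λ i → t^ 0 ⊖ t^ cycleExponent N i) ≡ ∏ K (λ i → t^ 0 ⊖ t^ e i)
      factors = ∏-cong K λ i → cong (λ d → t^ 0 ⊖ t^ d) (e≡ i)

    cycle-rational : ∀ {q} → q ≗ t^ 0 ⊖ scale (sign h) (t^ 2) →
      ∃ λ (p : Polynomial) → f N ≐ p / q ⊛ ∏ K (λ i → t^ 0 ⊖ t^ e i)
    cycle-rational {q} q≗ = subst (λ d → ∃ λ (p : Polynomial) → f N ≐ p / q ⊛ d) factors
      (rational (sign h) q≗ K (cycleExponent N) (f N) (annihilated N≡ closed N≡h+h bound))

-- The two residue classes of even lengths modulo 4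

module Conclusion where
  open import Data.Fin.Subset using (⊥)
  open import Data.Nat.Base
  open import Data.Nat.Divisibility using (_∣_; divides)
  open import Data.Nat.GeneralisedArithmetic using (iterate)
  open import Data.Nat.Properties
  import Data.Nat.Tactic.RingSolver as ℕ-Solver
  open Transfer using (F)
  open GridRows using (Z-grid)
  open Series using (rational)
  open Annihilation using (sign; cycleExponent; cycle-rational)

  sign-double : ∀ n → sign (n + n) ≡ 1ℤ
  sign-double zero    = refl
  sign-double (suc n) rewrite +-suc n n = trans (ℤ.neg-involutive (sign (n + n))) (sign-double n)

  -- The laws used for truncated subtraction hold for all arguments, so the index i may be
  -- arbitrary.
  exponent₄ₙ₊₂ : ∀ n i → cycleExponent (2 + 4 * n) i ≡ 8 * n ∸ 2 ∸ 6 * i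
  exponent₄ₙ₊₂ n i = begin
    2 * (2 + 4 * n ∸ 3 * suc i)       ≡⟨ *-distribˡ-∸ 2 (2 + 4 * n) (3 * suc i) ⟩
    2 * (2 + 4 * n) ∸ 2 * (3 * suc i)         ≡⟨ cong₂ _∸_ (l n) (r i) ⟩
    (4 + 8 * n) ∸ (4 + (2 + 6 * i))           ≡⟨ [m+n]∸[m+o]≡n∸o 4 (8 * n) (2 + 6 * i) ⟩
    8 * n ∸ (2 + 6 * i)                       ≡⟨ ∸-+-assoc (8 * n) 2 (6 * i) ⟨
    8 * n ∸ 2 ∸ 6 * i                         ∎
    where
    open ≡-Reasoning
    l : ∀ n → 2 * (2 + 4 * n) ≡ 4 + 8 * n
    l = ℕ-Solver.solve-∀
    r : ∀ i → 2 * (3 * suc i) ≡ 4 + (2 + 6 * i)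
    r = ℕ-Solver.solve-∀

  exponent₄ₙ : ∀ n i → cycleExponent (4 * n) i ≡ 8 * n ∸ 6 ∸ 6 * i
  exponent₄ₙ n i = begin
    2 * (4 * n ∸ 3 * suc i)        ≡⟨ *-distribˡ-∸ 2 (4 * n) (3 * suc i) ⟩
    2 * (4 * n) ∸ 2 * (3 * suc i)  ≡⟨ cong₂ _∸_ (l n) (r i) ⟩
    8 * n ∸ (6 + 6 * i)            ≡⟨ ∸-+-assoc (8 * n) 6 (6 * i) ⟨
    8 * n ∸ 6 ∸ 6 * i              ∎
    where
    open ≡-Reasoning
    l : ∀ n → 2 * (4 * n) ≡ 8 * n
    l = ℕ-Solver.solve-∀
    r : ∀ i → 2 * (3 * suc i) ≡ 6 + 6 * i
    r = ℕ-Solver.solve-∀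

  f-empty : ∀ m → f 0 m ≡ 1ℤ
  f-empty m = trans (Z-grid (cycle 0) m) (ones m)
    where
    ones : ∀ m → F (cycle 0) m ⊥ ≡ 1ℤ
    ones zero    = refl
    ones (suc m) rewrite ones m = refl

  Closed : Set
  Closed = ∀ (N k : ℕ) → 2 ∣ N → 0 < N → 0 < k → (X : Necklace k N) → iterate T X (N ∸ 3 * k) ≅ X

  rational₄ₙ₊₂ : Closed → ∀ n → ∃ λ (h : Polynomial) → f (4 * n + 2) ≐ h / denominator₄ₙ₊₂ n
  rational₄ₙ₊₂ closed n = subst (λ N → ∃ λ (h : Polynomial) → f N ≐ h / denominator₄ₙ₊₂ n) (+-comm 2 (4 * n))
    (cycle-rational {2 + 4 * n} refl (record { returns = λ k → closed (2 + 4 * n) k (divides (1 + 2 * n) (even n)) (s≤s z≤n) })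
      -- Half of the length is 2n + 1, which is odd, so the sign is -1 and the quadratic factor is 1
      -- + t².
      {suc (n + n)} (halves n) n bound (exponent₄ₙ₊₂ n)
      λ m → trans (lemma ((t^ 0) m) ((t^ 2) m)) (cong (λ ε → (t^ 0) m ℤ.- ℤ.- ε ℤ.* (t^ 2) m) (sym (sign-double n))))
    where
    lemma : ∀ x y → x ℤ.+ y ≡ x ℤ.- -1ℤ ℤ.* y
    lemma = solve-∀
    even : ∀ n → 2 + 4 * n ≡ (1 + 2 * n) * 2
    even = ℕ-Solver.solve-∀
    halves : ∀ n → 2 + 4 * n ≡ (1 + (n + n)) + (1 + (n + n))
    halves = ℕ-Solver.solve-∀
    -- Here 4k ≤ 4n + 2 < 4(n + 1), so the remainder 2 leaves no room for another pair of stones.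
    bound : ∀ k → 4 * k ≤ 2 + 4 * n → k ≤ n
    bound k l = ≤-pred (*-cancelˡ-< 4 k (suc n)
      (≤-<-trans l (subst (2 + 4 * n <_) (sym (*-suc 4 n)) (s≤s (s≤s (s≤s (n≤1+n (4 * n))))))))

  scale-1 : ∀ x y → x ℤ.- y ≡ x ℤ.- 1ℤ ℤ.* y
  scale-1 = solve-∀

  rational₄ₙ : Closed → ∀ n → ∃ λ (h : Polynomial) → f (4 * n) ≐ h / denominator₄ₙ n
  -- The recurrence concerns circles with at least two vertices. For the empty circle all
  -- coefficients are 1, and S² - 1 annihilates them directly.
  rational₄ₙ closed zero = rational 1ℤ (λ m → scale-1 ((t^ 0) m) ((t^ 2) m)) 0 (λ i → i) (f 0) λ m →
    cong₂ (λ x y → x ℤ.- 1ℤ ℤ.* y) (f-empty (3 + m)) (f-empty (suc m))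
  rational₄ₙ closed n@(suc k) = cycle-rational {4 * n} {2 + 4 * k} (*-suc 4 k)
      (record { returns = λ k → closed (4 * n) k (divides (2 * n) (even n)) (s≤s z≤n) })
      {n + n} (halves n) n (λ k → *-cancelˡ-≤ 4) (exponent₄ₙ n)
      λ m → trans (scale-1 ((t^ 0) m) ((t^ 2) m)) (cong (λ ε → (t^ 0) m ℤ.- ε ℤ.* (t^ 2) m) (sym (sign-double n)))
    where
    even : ∀ n → 4 * n ≡ (2 * n) * 2
    even = ℕ-Solver.solve-∀
    halves : ∀ n → 4 * n ≡ (n + n) + (n + n)
    halves = ℕ-Solver.solve-∀

open import Data.Nat using (ℕ; _+_; _*_; _∸_; _<_)
open import Data.Nat.Divisibility using (_∣_)
open import Data.Nat.GeneralisedArithmetic using (iterate)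

theorem7p6 : (∀ (N k : ℕ) → 2 ∣ N → 0 < N → 0 < k → (X : Necklace k N) →
    iterate T X (N ∸ 3 * k) ≅ X) →
    ∀ (n : ℕ) →
    (∃ λ (h : Polynomial) → f (4 * n + 2) ≐ h / denominator₄ₙ₊₂ n)
    × (∃ λ (h : Polynomial) → f (4 * n) ≐ h / denominator₄ₙ n)
theorem7p6 closed n = Conclusion.rational₄ₙ₊₂ closed n , Conclusion.rational₄ₙ closed n
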